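{- Let $L=\sum_{P} q^{\text{area of }P}$, where the sum runs over all level three cheesy polyominoes $P$ (on the hexagonal tiling, counted up to translation). Then, as a formal power series in $q$, $L=\dfrac{M}{N}$, where $$\begin{aligned} M ={}& q \cdot (1-11q+49q^{2}-114q^{3}+146q^{4}-94q^{5}+5q^{6}+71q^{7}-143q^{8}\\ &+176q^{9}-154q^{10}+100q^{11}+24q^{12}-121q^{13}+90q^{14}-61q^{15}+19q^{16}\\ &+58q^{17}-32q^{18}-31q^{19}+37q^{20}+14q^{21}-43q^{22}-4q^{23}+21q^{24}\\ &-q^{25}-5q^{26}) \end{aligned}$$ and $$\begin{aligned} N ={}& 1-14q+80q^{2}-243q^{3}+423q^{4}-413q^{5}+174q^{6}+106q^{7}-350q^{8}\\ &+533q^{9}-546q^{10}+427q^{11}-148q^{12}-261q^{13}+383q^{14}-253q^{15}\\ &+158q^{16}+57q^{17}-181q^{18}+10q^{19}+115q^{20}-49q^{21}-96q^{22}\\ &+93q^{23}+49q^{24}-54q^{25}-12q^{26}+12q^{27}+q^{28}. \end{aligned}$$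
   Context: Consider the regular hexagonal tiling of the Euclidean plane, oriented so that every hexagonal tile has two horizontal edges; tiles are called cells. A (hexagonal-celled) polyomino is a union of finitely many (at least one) cells whose interior is connected (for unions of hexagonal cells, this is equivalent to the union being connected). Two polyominoes are considered equal if and only if one is the image of the other under a translation. The area of a polyomino is its number of cells. The cells of a polyomino $P$ are partitioned according to their horizontal projection (cells with the same projection onto the horizontal axis lie in the same block); each block is a column of $P$. Cells of the tiling with the same horizontal projection are stacked vertically, consecutive ones sharing a horizontal edge. A column need not be a connected set; its connected components are its maximal runs of vertically consecutive cells. If a column has two connected components, the gap (hole) between them is the set of cells of the tiling lying in that vertical stack strictly between the two components. Columns are ordered from left to right; the first column is the leftmost one, and two columns are adjacent if they are consecutive in this order. A polyomino $P$ is rightward-semi-directed if the first (leftmost) column of $P$ has no gap (i.e. is connected) and, in every pair of adjacent columns of $P$, every connected component of the right column has at least one edge in common with the left column. For an integer $m\ge 1$, a polyomino $P$ is a level $m$ cheesy polyomino if: (i) $P$ is rightward-semi-directed; (ii) every column of $P$ has at most two connected components; (iii) if a column of $P$ has two connected components, then the gap between the components consists of at most $m$ cells. -}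

module Defs where

open import Agda.Builtin.FromNat using (Number; fromNat)
open import Agda.Builtin.FromNeg using (Negative; fromNeg)
open import Data.Fin.Base using (Fin)
open import Data.Integer.Base as ℤ using (ℤ; +_; 0ℤ; 1ℤ)
import Data.Integer.Literals as ℤ-Literals
import Data.Integer.Properties as ℤ
open import Data.List.Base using (List; []; _∷_; length; map; foldr; upTo)
open import Data.List.Membership.Propositional using (_∈_)
open import Data.List.Relation.Unary.Unique.Propositional using (Unique)
open import Data.Nat.Base using (ℕ; zero; suc; _∸_)
open import Data.Product.Base using (Σ; _×_; _,_; proj₁; ∃-syntax)
open import Data.Sum.Base using (_⊎_)
open import Data.Unit.Base using (tt)
open import Function.Bundles using (_⇔_; mk⇔; Bijection; module Equivalence)
open import Level using (0ℓ)
open import Relation.Binary.Bundles using (Setoid)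
import Relation.Binary.Construct.On as On
open import Relation.Binary.Construct.Closure.ReflexiveTransitive using (Star)
open import Relation.Binary.PropositionalEquality
  using (_≡_; sym; trans; cong; cong₂; subst; setoid)
open import Relation.Nullary.Negation using (¬_)

-- With hexagons of unit side (two sides horizontal), the cell (i , j) is the
-- one centred at the point (3/2 · i , √3 · (j + i/2)).  Hence i numbers the
-- vertical stacks from left to right, j numbers the cells of a stack from
-- bottom to top, and the translations preserving the tiling are exactly
-- (i , j) ↦ (i + a , j + b) with a, b integers.
Cell : Set
Cell = ℤ × ℤ

neighbours : Cell → List Cell
neighbours (i , j) =
  (i , ℤ.suc j)          ∷ (i , ℤ.pred j)          ∷
  (ℤ.suc i , j)          ∷ (ℤ.suc i , ℤ.pred j)    ∷
  (ℤ.pred i , j)         ∷ (ℤ.pred i , ℤ.suc j)    ∷ []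

ShareEdge : Cell → Cell → Set
ShareEdge c d = d ∈ neighbours c

translate : ℤ × ℤ → Cell → Cell
translate (a , b) (i , j) = i ℤ.+ a , j ℤ.+ b

record Polyomino : Set where
  field
    cells     : List Cell
    unique    : Unique cells
    nonempty  : ∃[ c ] c ∈ cells
    connected : ∀ {c d} → c ∈ cells → d ∈ cells →
                Star (λ x y → x ∈ cells × y ∈ cells × ShareEdge x y) c d

open Polyomino public

area : Polyomino → ℕ
area P = length (cells P)

infix 4 _≈_

-- Only the set of cells matters, not the order in which `cells` lists them.
_≈_ : Polyomino → Polyomino → Set
P ≈ Q = ∃[ t ] ∀ c → c ∈ cells P ⇔ translate t c ∈ cells Q

private
  translate-0 : ∀ c → translate (0ℤ , 0ℤ) c ≡ c
  translate-0 (i , j) = cong₂ _,_ (ℤ.+-identityʳ i) (ℤ.+-identityʳ j)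

  translate-+ : ∀ s t c → translate t (translate s c) ≡ translate (translate t s) c
  translate-+ (a , b) (a′ , b′) (i , j) = cong₂ _,_ (ℤ.+-assoc i a a′) (ℤ.+-assoc j b b′)

  neg : ℤ × ℤ → ℤ × ℤ
  neg (a , b) = ℤ.- a , ℤ.- b

  translate-neg : ∀ t → translate t (neg t) ≡ (0ℤ , 0ℤ)
  translate-neg (a , b) = cong₂ _,_ (ℤ.+-inverseˡ a) (ℤ.+-inverseˡ b)

  ≈-refl : ∀ {P} → P ≈ P
  ≈-refl {P} = (0ℤ , 0ℤ) , λ c →
    mk⇔ (subst (_∈ cells P) (sym (translate-0 c))) (subst (_∈ cells P) (translate-0 c))

  ≈-sym : ∀ {P Q} → P ≈ Q → Q ≈ P
  ≈-sym {P} {Q} (t , e) = neg t , λ c →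
    mk⇔ (λ c∈Q → Equivalence.from (e _) (subst (_∈ cells Q) (sym (undo c)) c∈Q))
        (λ c∈P → subst (_∈ cells Q) (undo c) (Equivalence.to (e _) c∈P))
    where
    undo : ∀ c → translate t (translate (neg t) c) ≡ c
    undo c = trans (translate-+ (neg t) t c)
               (trans (cong (λ u → translate u c) (translate-neg t)) (translate-0 c))

  ≈-trans : ∀ {P Q R} → P ≈ Q → Q ≈ R → P ≈ R
  ≈-trans {P} {Q} {R} (s , e) (t , f) = translate t s , λ c →
    mk⇔ (λ c∈P → subst (_∈ cells R) (translate-+ s t c)
                   (Equivalence.to (f _) (Equivalence.to (e c) c∈P)))
        (λ c∈R → Equivalence.from (e c) (Equivalence.from (f _)
                   (subst (_∈ cells R) (sym (translate-+ s t c)) c∈R)))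

Polyominoes : Setoid 0ℓ 0ℓ
Polyominoes = record
  { Carrier       = Polyomino
  ; _≈_           = _≈_
  ; isEquivalence = record
    { refl  = λ {P} → ≈-refl {P}
    ; sym   = λ {P} {Q} → ≈-sym {P} {Q}
    ; trans = λ {P} {Q} {R} → ≈-trans {P} {Q} {R}
    }
  }

-- A column of P is named by the index i of the stack containing it.
module _ (P : Polyomino) where

  IsColumn : ℤ → Set
  IsColumn i = ∃[ j ] (i , j) ∈ cells P

  IsFirstColumn : ℤ → Set
  IsFirstColumn i = IsColumn i × (∀ i′ → IsColumn i′ → i ℤ.≤ i′)

  -- i′ is the next column to the right of i.
  AdjacentColumns : ℤ → ℤ → Set
  AdjacentColumns i i′ =
    IsColumn i × IsColumn i′ × i ℤ.< i′ ×
    (∀ k → IsColumn k → ¬ (i ℤ.< k × k ℤ.< i′))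

-- The vertically consecutive positions bot, bot + 1, …, top of a stack.
record Run : Set where
  constructor run
  field
    bot top : ℤ

open Run public

infix 4 _∈ʳ_

_∈ʳ_ : ℤ → Run → Set
j ∈ʳ r = bot r ℤ.≤ j × j ℤ.≤ top r

module _ (P : Polyomino) where

  -- r is a connected component of the column i: a maximal nonempty run.
  record IsComponent (i : ℤ) (r : Run) : Set where
    field
      nonempty-run : bot r ℤ.≤ top r
      contained    : ∀ j → j ∈ʳ r → (i , j) ∈ cells P
      maximal-bot  : ¬ ((i , ℤ.pred (bot r)) ∈ cells P)
      maximal-top  : ¬ ((i , ℤ.suc (top r)) ∈ cells P)

  NoGap : ℤ → Set
  NoGap i = ∀ r s → IsComponent i r → IsComponent i s → r ≡ s

  AtMostTwoComponents : ℤ → Set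
  AtMostTwoComponents i = ∀ r s t →
    IsComponent i r → IsComponent i s → IsComponent i t → r ≡ s ⊎ r ≡ t ⊎ s ≡ t

  record IsRightwardSemiDirected : Set where
    field
      first-column : ∀ i → IsFirstColumn P i → NoGap i
      supported    : ∀ i i′ → AdjacentColumns P i i′ →
                     ∀ r → IsComponent i′ r →
                     ∃[ j ] ∃[ k ] j ∈ʳ r × (i , k) ∈ cells P × ShareEdge (i , k) (i′ , j)

-- The number of cells strictly between r and s, when r lies below s.
gapSize : Run → Run → ℤ
gapSize r s = bot s ℤ.- ℤ.suc (top r)

record IsCheesy (m : ℕ) (P : Polyomino) : Set where
  field
    semi-directed  : IsRightwardSemiDirected P
    two-components : ∀ i → AtMostTwoComponents P i
    small-gaps     : ∀ i r s → IsComponent P i r → IsComponent P i s →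
                     top r ℤ.< bot s → gapSize r s ℤ.≤ + m

-- Level m cheesy polyominoes of area n, up to translation.
CheesyPolyominoes : ℕ → ℕ → Setoid 0ℓ 0ℓ
CheesyPolyominoes m n =
  On.setoid {B = Σ Polyomino λ P → IsCheesy m P × area P ≡ n} Polyominoes proj₁

PowerSeries : Set
PowerSeries = ℕ → ℤ

infixl 7 _⊛_

_⊛_ : PowerSeries → PowerSeries → PowerSeries
(f ⊛ g) n = foldr ℤ._+_ 0ℤ (map (λ k → f k ℤ.* g (n ∸ k)) (upTo (suc n)))

polynomial : List ℤ → PowerSeries
polynomial []       _       = 0ℤ
polynomial (c ∷ cs) zero    = c
polynomial (c ∷ cs) (suc n) = polynomial cs n

infix 4 _≐_/_

-- f = g / h, where h is invertible because its constant coefficient is 1.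
_≐_/_ : PowerSeries → PowerSeries → PowerSeries → Set
f ≐ g / h = h zero ≡ 1ℤ × (∀ n → (h ⊛ f) n ≡ g n)

-- L = Σ q^(area P), over all level m cheesy polyominoes P up to translation.
IsCheesyGF : ℕ → PowerSeries → Set
IsCheesyGF m L = ∀ n → ∃[ a ] Bijection (setoid (Fin a)) (CheesyPolyominoes m n) × L n ≡ + a

module _ where
  private instance
    ℤ-number : Number ℤ
    ℤ-number = ℤ-Literals.number

    ℤ-negative : Negative ℤ
    ℤ-negative = ℤ-Literals.negative

  M : PowerSeries
  M = polynomial (0 ∷   -- the factor q
    1 ∷ -11 ∷ 49 ∷ -114 ∷ 146 ∷ -94 ∷ 5 ∷ 71 ∷ -143 ∷
    176 ∷ -154 ∷ 100 ∷ 24 ∷ -121 ∷ 90 ∷ -61 ∷ 19 ∷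
    58 ∷ -32 ∷ -31 ∷ 37 ∷ 14 ∷ -43 ∷ -4 ∷ 21 ∷
    -1 ∷ -5 ∷ [])

  N : PowerSeries
  N = polynomial (
    1 ∷ -14 ∷ 80 ∷ -243 ∷ 423 ∷ -413 ∷ 174 ∷ 106 ∷ -350 ∷
    533 ∷ -546 ∷ 427 ∷ -148 ∷ -261 ∷ 383 ∷ -253 ∷
    158 ∷ 57 ∷ -181 ∷ 10 ∷ 115 ∷ -49 ∷ -96 ∷
    93 ∷ 49 ∷ -54 ∷ -12 ∷ 12 ∷ 1 ∷ [])

-- A cheesy polyomino is read from left to right as a list of columns, each
-- placed relative to its left neighbour, and is determined up to translation
-- by these data.  The number of ways of placing one column next to another is
-- linear in the heights of their components, apart from corrections that
-- count the placements in which a component falls into the gap of the left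
-- column; for gaps of at most three cells these corrections only involve
-- components of at most two cells.  Summing over all heights therefore gives
-- finitely many power series (34 are used) whose n-th coefficients form a
-- vector satisfying a first-order linear recurrence x (n + 1) = R x n.  Writing
-- L n = e · R ^ n x₀, the coefficients of N L are computed by Horner's rule on
-- row vectors, and after 28 steps the row vector Σ N k · e R ^ (28 - k) is zero.

module Submission where

open import Defs
open import Data.Product.Base using (∃-syntax; _×_; _,_)

-- A component of `k + 1` cells is adjacent to `k + 2` consecutive cells of the stack on its left,
-- and it is lost in a gap exactly when all of these belong to the gap. Hence a gap of one cell
-- behaves like a filled one. Two components and the gap between them span at least three cells, so
-- they are adjacent to a stretch of at least four; a gap of at most three cells never swallows
-- both, and inclusion-exclusion stops at single losses. When one component is lost, the other lies
-- beside one particular component of the left column, and the correction depends on the height of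
-- that component alone. The series of a two-component column is thus a constant plus a function of
-- the lower height plus a function of the upper height, both affine from three cells on. This makes
-- the double sum over heights elementary. The two functions involve different series, for lost
-- upper and lost lower components; the system closes because the sums over heights contain both
-- functions symmetrically, so that only the sum of these series enters.

module LinearArithmetic where

  open import Data.Bool.Base using (Bool; T; _∧_)
  open import Data.Bool.Properties using (T-∧)
  open import Data.Fin.Base using (Fin; zero; suc)
  open import Data.Integer.Base as ℤ using (ℤ; 0ℤ; 1ℤ; -1ℤ)
  import Data.Integer.Properties as ℤ
  open import Data.Integer.Tactic.RingSolver using (solve-∀)
  open import Data.List.Base using (List; []; _∷_)
  open import Data.Nat.Base using (ℕ)
  open import Data.Vec.Base as Vec using (Vec; []; _∷_; lookup)
  open import Data.Vec.N-ary using (N-ary; _$ⁿ_)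
  open import Data.Vec.Properties using (≡-dec)
  open import Function.Bundles using (Equivalence)
  open import Relation.Binary.PropositionalEquality using (_≡_; refl; sym; trans; cong; cong₂; subst)
  open import Relation.Nullary.Decidable using (⌊_⌋; toWitness)

  -- Linear inequalities over the integers, proved by reflection

  infixl 6 _⊕_ _⊖_
  infixl 7 _⊙_

  data Lin (n : ℕ) : Set where
    var     : Fin n → Lin n
    con     : ℤ → Lin n
    _⊕_ _⊖_ : Lin n → Lin n → Lin n
    _⊙_     : ℤ → Lin n → Lin n

  ⟦_⟧ : ∀ {n} → Lin n → Vec ℤ n → ℤ
  ⟦ var i ⟧ ρ = lookup ρ i
  ⟦ con c ⟧ ρ = c
  ⟦ l ⊕ r ⟧ ρ = ⟦ l ⟧ ρ ℤ.+ ⟦ r ⟧ ρ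
  ⟦ l ⊖ r ⟧ ρ = ⟦ l ⟧ ρ ℤ.- ⟦ r ⟧ ρ
  ⟦ c ⊙ l ⟧ ρ = c ℤ.* ⟦ l ⟧ ρ

  infix 8 _∙_
  _∙_ : ∀ {n} → Vec ℤ n → Vec ℤ n → ℤ
  []       ∙ []       = 0ℤ
  (x ∷ xs) ∙ (y ∷ ys) = x ℤ.* y ℤ.+ xs ∙ ys

  0̂ : ∀ {n} → Vec ℤ n
  0̂ = Vec.replicate _ 0ℤ

  unit : ∀ {n} → Fin n → Vec ℤ n
  unit zero    = 1ℤ ∷ 0̂
  unit (suc i) = 0ℤ ∷ unit i

  ∙-zeroˡ : ∀ {n} (ρ : Vec ℤ n) → 0̂ ∙ ρ ≡ 0ℤ
  ∙-zeroˡ []      = refl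
  ∙-zeroˡ (x ∷ ρ) = cong₂ ℤ._+_ (ℤ.*-zeroˡ x) (∙-zeroˡ ρ)

  ∙-unit : ∀ {n} i (ρ : Vec ℤ n) → unit i ∙ ρ ≡ lookup ρ i
  ∙-unit zero    (x ∷ ρ) = trans (cong₂ ℤ._+_ (ℤ.*-identityˡ x) (∙-zeroˡ ρ)) (ℤ.+-identityʳ x)
  ∙-unit (suc i) (x ∷ ρ) = trans (cong₂ ℤ._+_ (ℤ.*-zeroˡ x) (∙-unit i ρ)) (ℤ.+-identityˡ _)

  ∙-+ : ∀ {n} (u v ρ : Vec ℤ n) → Vec.zipWith ℤ._+_ u v ∙ ρ ≡ u ∙ ρ ℤ.+ v ∙ ρ
  ∙-+ []      []      []      = refl
  ∙-+ (x ∷ u) (y ∷ v) (z ∷ ρ) rewrite ∙-+ u v ρ = lemma x y z (u ∙ ρ) (v ∙ ρ)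
    where
    lemma : ∀ x y z p q → (x ℤ.+ y) ℤ.* z ℤ.+ (p ℤ.+ q) ≡ x ℤ.* z ℤ.+ p ℤ.+ (y ℤ.* z ℤ.+ q)
    lemma = solve-∀

  ∙-* : ∀ {n} c (u ρ : Vec ℤ n) → Vec.map (c ℤ.*_) u ∙ ρ ≡ c ℤ.* u ∙ ρ
  ∙-* c []      []      = sym (ℤ.*-zeroʳ c)
  ∙-* c (x ∷ u) (z ∷ ρ) rewrite ∙-* c u ρ = lemma c x z (u ∙ ρ)
    where
    lemma : ∀ c x z p → c ℤ.* x ℤ.* z ℤ.+ c ℤ.* p ≡ c ℤ.* (x ℤ.* z ℤ.+ p)
    lemma = solve-∀

  coefficients : ∀ {n} → Lin n → Vec ℤ n
  coefficients (var i) = unit i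
  coefficients (con c) = 0̂
  coefficients (l ⊕ r) = Vec.zipWith ℤ._+_ (coefficients l) (coefficients r)
  coefficients (l ⊖ r) = Vec.zipWith ℤ._+_ (coefficients l) (Vec.map (-1ℤ ℤ.*_) (coefficients r))
  coefficients (c ⊙ l) = Vec.map (c ℤ.*_) (coefficients l)

  constant : ∀ {n} → Lin n → ℤ
  constant (var i) = 0ℤ
  constant (con c) = c
  constant (l ⊕ r) = constant l ℤ.+ constant r
  constant (l ⊖ r) = constant l ℤ.- constant r
  constant (c ⊙ l) = c ℤ.* constant l

  ⟦⟧-normal : ∀ {n} (l : Lin n) ρ → ⟦ l ⟧ ρ ≡ constant l ℤ.+ coefficients l ∙ ρ
  ⟦⟧-normal (var i) ρ = sym (trans (ℤ.+-identityˡ _) (∙-unit i ρ))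
  ⟦⟧-normal (con c) ρ = sym (trans (cong (ℤ._+_ c) (∙-zeroˡ ρ)) (ℤ.+-identityʳ c))
  ⟦⟧-normal (l ⊕ r) ρ
    rewrite ⟦⟧-normal l ρ | ⟦⟧-normal r ρ | ∙-+ (coefficients l) (coefficients r) ρ
    = lemma (constant l) (coefficients l ∙ ρ) (constant r) (coefficients r ∙ ρ)
    where
    lemma : ∀ a b c d → a ℤ.+ b ℤ.+ (c ℤ.+ d) ≡ a ℤ.+ c ℤ.+ (b ℤ.+ d)
    lemma = solve-∀
  ⟦⟧-normal (l ⊖ r) ρ
    rewrite ⟦⟧-normal l ρ | ⟦⟧-normal r ρ
          | ∙-+ (coefficients l) (Vec.map (-1ℤ ℤ.*_) (coefficients r)) ρ
          | ∙-* -1ℤ (coefficients r) ρ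
    = lemma (constant l) (coefficients l ∙ ρ) (constant r) (coefficients r ∙ ρ)
    where
    lemma : ∀ a b c d → a ℤ.+ b ℤ.- (c ℤ.+ d) ≡ a ℤ.- c ℤ.+ (b ℤ.+ -1ℤ ℤ.* d)
    lemma = solve-∀
  ⟦⟧-normal (c ⊙ l) ρ
    rewrite ⟦⟧-normal l ρ | ∙-* c (coefficients l) ρ
    = ℤ.*-distribˡ-+ c (constant l) (coefficients l ∙ ρ)

  infix 5.5 _≼_
  infix 3 _⊢_

  record Inequality (n : ℕ) : Set where
    constructor _≼_
    field
      lesser greater : Lin n

  record Sequent (n : ℕ) : Set where
    constructor _⊢_
    field
      hypotheses : List (Inequality n)
      conclusion : Inequality n

  Holds : ∀ {n} → Vec ℤ n → Inequality n → Set
  Holds ρ (l ≼ r) = ⟦ l ⟧ ρ ℤ.≤ ⟦ r ⟧ ρ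

  Valid : ∀ {n} → Vec ℤ n → Sequent n → Set
  Valid ρ ([]     ⊢ g) = Holds ρ g
  Valid ρ (h ∷ hs ⊢ g) = Holds ρ h → Valid ρ (hs ⊢ g)

  -- The slack of the conclusion minus the slacks of the hypotheses. As these are nonnegative, it
  -- suffices that this form is nonnegative, which can be tested by evaluation once all variables
  -- cancel.
  margin : ∀ {n} → Inequality n → List (Inequality n) → Lin n
  margin (l ≼ r) []              = r ⊖ l
  margin g       ((l ≼ r) ∷ hs) = margin g hs ⊖ (r ⊖ l)

  entails : ∀ {n} → Sequent n → Bool
  entails (hs ⊢ g) =
    ⌊ ≡-dec ℤ._≟_ (coefficients e) 0̂ ⌋ ∧ (0ℤ ℤ.≤ᵇ constant e)
    where
    e = margin g hs

  module _ {n} (ρ : Vec ℤ n) where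

    margin-sound : ∀ hs g → 0ℤ ℤ.≤ ⟦ margin g hs ⟧ ρ → Valid ρ (hs ⊢ g)
    margin-sound []              g 0≤   = ℤ.0≤i-j⇒j≤i 0≤
    margin-sound ((l ≼ r) ∷ hs) g 0≤ h =
      margin-sound hs g (ℤ.≤-trans (ℤ.i≤j⇒0≤j-i h) (ℤ.0≤i-j⇒j≤i 0≤))

  -- Certifies the inequalities that are the sum of the hypotheses and of a
  -- nonnegative constant; a hypothesis with a larger multiplier is repeated.
  linear : ∀ n (f : N-ary n (Lin n) (Sequent n)) →
           let s = f $ⁿ Vec.map var (Vec.allFin n) in
           {T (entails s)} → (ρ : Vec ℤ n) → Valid ρ s
  linear n f {ok} ρ = go (f $ⁿ Vec.map var (Vec.allFin n)) ok
    where
    go : ∀ s → T (entails s) → Valid ρ s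
    go (hs ⊢ g) ok with Equivalence.to T-∧ ok
    ... | zeros , nonneg = margin-sound ρ hs g
      (subst (0ℤ ℤ.≤_) (sym eq) (ℤ.≤ᵇ⇒≤ nonneg))
      where
      eq : ⟦ margin g hs ⟧ ρ ≡ constant (margin g hs)
      eq = trans (⟦⟧-normal (margin g hs) ρ)
             (trans (cong (λ u → constant (margin g hs) ℤ.+ u ∙ ρ) (toWitness zeros))
               (trans (cong (ℤ._+_ (constant (margin g hs))) (∙-zeroˡ ρ)) (ℤ.+-identityʳ _)))

open LinearArithmetic

-- From cheesy polyominoes to finite codes

module Columns where

  open import Data.Empty using (⊥; ⊥-elim)
  open import Data.Fin.Base using (Fin; toℕ; fromℕ<; zero; suc)
  open import Data.Fin.Properties using (toℕ-injective; toℕ-fromℕ<; toℕ<n)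
  open import Data.Integer.Base as ℤ using (ℤ; +_; 0ℤ; 1ℤ; -1ℤ; +≤+)
  import Data.Integer.Properties as ℤ
  open import Data.Integer.Tactic.RingSolver using (solve-∀)
  open import Data.List.Base
    using (List; []; _∷_; _++_; map; concat; concatMap; filter; length; lookup; allFin; upTo)
  open import Data.List.Membership.Propositional using (_∈_; find; lose)
  open import Data.List.Membership.Propositional.Properties
    using ( ∈-++⁺ˡ; ∈-++⁺ʳ; ∈-++⁻; ∈-map⁺; ∈-map⁻; ∈-concatMap⁺; ∈-concatMap⁻
          ; ∈-filter⁺; ∈-filter⁻; ∈-upTo⁺; ∈-upTo⁻; ∈-allFin; ∈-lookup )
  open import Data.List.Membership.Propositional.Properties.WithK using (unique∧set⇒bag)
  open import Data.List.Properties
    using ( ++-identityʳ; ∷-injective; ∷-injectiveʳ; concatMap-cong; length-++; length-map; length-upTo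
          ; map-++; map-∘; map-concatMap; map-cong; map-cong-local )
  open import Data.List.Relation.Binary.BagAndSetEquality using (∼bag⇒↭)
  open import Data.List.Relation.Binary.Permutation.Propositional.Properties using (↭-length)
  open import Data.List.Relation.Unary.All as All using (All; []; _∷_)
  open import Data.List.Relation.Unary.AllPairs using ([]; _∷_)
  open import Data.List.Relation.Unary.Any as Any using (Any; here; there)
  import Data.List.Relation.Unary.Any.Properties as Any
  open import Data.List.Relation.Unary.Linked using (Linked; []; [-]; _∷_)
  open import Data.List.Relation.Unary.Unique.Propositional using (Unique)
  import Data.List.Relation.Unary.Unique.Propositional.Properties as Unique
  open import Data.Nat.Base as ℕ using (ℕ; zero; suc; _+_; _≤_; _<_; z≤n; s≤s)
  import Data.Nat.Properties as ℕ
  open import Data.Product.Base using (proj₁; proj₂)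
  open import Data.Product.Properties using (≡-dec; ,-injectiveʳ)
  open import Data.Sum.Base using (_⊎_; inj₁; inj₂)
  open import Data.Unit.Base using (⊤; tt)
  open import Data.Vec.Base using ([]; _∷_)
  open import Function.Base using (_∘_)
  open import Function.Bundles using (_⇔_; mk⇔; Equivalence; Bijection)
  open import Relation.Binary.Bundles using (Setoid)
  open import Relation.Binary.Construct.Closure.ReflexiveTransitive as Star using (Star; ε; _◅_; _◅◅_)
  open import Relation.Binary.PropositionalEquality
  open import Relation.Nullary.Decidable using (Dec; yes; no; ¬?; _×-dec_)
  open import Relation.Nullary.Negation using (¬_)
  open import Relation.Unary using (Decidable)

  import Data.List.Membership.DecPropositional (≡-dec ℤ._≟_ ℤ._≟_) as DecMembership

  -- Maximal runs

  -- The conditions of `IsComponent` for an arbitrary set of heights, so that a column of a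
  -- polyomino can be compared with a column given by its parameters.
  record Maximal (S : ℤ → Set) (r : Run) : Set where
    field
      nonempty-run : bot r ℤ.≤ top r
      contained    : ∀ j → j ∈ʳ r → S j
      maximal-bot  : ¬ S (ℤ.pred (bot r))
      maximal-top  : ¬ S (ℤ.suc (top r))

  open Maximal

  bot∈ʳ : ∀ {r} → bot r ℤ.≤ top r → bot r ∈ʳ r
  bot∈ʳ b≤t = ℤ.≤-refl , b≤t

  -- If one of two overlapping runs extended beyond the other, it would contain the position just
  -- past an end of the other, against maximality.
  maximal-≡ : ∀ {S r s j} → Maximal S r → Maximal S s → j ∈ʳ r → j ∈ʳ s → r ≡ s
  maximal-≡ {r = r} {s} mr ms j∈r j∈s = cong₂ run
    (ℤ.≤-antisym (bot-≤ ms mr j∈s j∈r) (bot-≤ mr ms j∈r j∈s))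
    (ℤ.≤-antisym (top-≤ mr ms j∈r j∈s) (top-≤ ms mr j∈s j∈r))
    where
    bot-≤ : ∀ {S r s j} → Maximal S r → Maximal S s → j ∈ʳ r → j ∈ʳ s → bot s ℤ.≤ bot r
    bot-≤ {r = r} {s} {j} mr ms (_ , j≤t) (b≤j , _) = ℤ.≮⇒≥ λ r<s →
      maximal-bot ms (contained mr _
        ( linear 2 (λ x y → con 1ℤ ⊕ x ≼ y ∷ [] ⊢ x ≼ con -1ℤ ⊕ y)
            (bot r ∷ bot s ∷ []) (ℤ.i<j⇒suc[i]≤j r<s)
        , linear 3 (λ x y z → x ≼ y ∷ y ≼ z ∷ [] ⊢ con -1ℤ ⊕ x ≼ z)
            (bot s ∷ j ∷ top r ∷ []) b≤j j≤t))

    top-≤ : ∀ {S r s j} → Maximal S r → Maximal S s → j ∈ʳ r → j ∈ʳ s → top r ℤ.≤ top s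
    top-≤ {r = r} {s} {j} mr ms (b≤j , _) (_ , j≤t) = ℤ.≮⇒≥ λ s<r →
      maximal-top ms (contained mr _
        ( linear 3 (λ x y z → x ≼ y ∷ y ≼ z ∷ [] ⊢ x ≼ con 1ℤ ⊕ z)
            (bot r ∷ j ∷ top s ∷ []) b≤j j≤t
        , ℤ.i<j⇒suc[i]≤j s<r))

  maximal-resp : ∀ {S S′ : ℤ → Set} {r} → (∀ j → S j ⇔ S′ j) → Maximal S r → Maximal S′ r
  maximal-resp e m = record
    { nonempty-run = nonempty-run m
    ; contained    = λ j j∈r → Equivalence.to (e j) (contained m j j∈r)
    ; maximal-bot  = λ s → maximal-bot m (Equivalence.from (e _) s)
    ; maximal-top  = λ s → maximal-top m (Equivalence.from (e _) s)
    }

  -- Columns with at most two components and a gap of at most m cells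

  data Column (m : ℕ) : Set where
    one : ℕ → Column m
    two : ℕ → Fin m → ℕ → Column m

  -- A pair (x , h) stands for the positions x, …, x + h; so `one a` has a + 1
  -- cells and `two a g b` has a + 1 cells below a gap of g + 1 cells below
  -- b + 1 cells.
  segments : ∀ {m} → Column m → List (ℕ × ℕ)
  segments (one a)     = (0 , a) ∷ []
  segments (two a g b) = (0 , a) ∷ (a + toℕ g + 2 , b) ∷ []

  segment : ℤ → ℕ × ℕ → Run
  segment β (x , h) = run (β ℤ.+ + x) (β ℤ.+ + (x + h))

  Placed : ℕ → Set
  Placed m = ℤ × Column m

  runs : ∀ {m} → Placed m → List Run
  runs (β , c) = map (segment β) (segments c)

  infix 4 _∈ᶜ_

  _∈ᶜ_ : ∀ {m} → ℤ → Placed m → Set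
  j ∈ᶜ p = Any (j ∈ʳ_) (runs p)

  segment-nonempty : ∀ β s → bot (segment β s) ℤ.≤ top (segment β s)
  segment-nonempty β (x , h) =
    linear 3 (λ β x h → con 0ℤ ≼ h ∷ [] ⊢ β ⊕ x ≼ β ⊕ (x ⊕ h)) (β ∷ + x ∷ + h ∷ []) (+≤+ z≤n)

  -- A gap is encoded by its number of cells minus one, so it is never empty; this keeps the two
  -- runs from merging into one component.
  runs-separated : ∀ {m} β a (g : Fin m) b →
    ℤ.suc (ℤ.suc (top (segment β (0 , a)))) ℤ.≤ bot (segment β (a + toℕ g + 2 , b))
  runs-separated β a g b =
    linear 3 (λ β a g → con 0ℤ ≼ g ∷ [] ⊢ con 1ℤ ⊕ (con 1ℤ ⊕ (β ⊕ a)) ≼ β ⊕ (a ⊕ g ⊕ con (+ 2)))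
      (β ∷ + a ∷ + toℕ g ∷ []) (+≤+ z≤n)

  i≰pred[i] : ∀ {i} → ¬ (i ℤ.≤ ℤ.pred i)
  i≰pred[i] {i} i≤ with linear 1 (λ i → i ≼ con -1ℤ ⊕ i ∷ [] ⊢ con 0ℤ ≼ con -1ℤ) (i ∷ []) i≤
  ... | ()

  suc[i]≰i : ∀ {i} → ¬ (ℤ.suc i ℤ.≤ i)
  suc[i]≰i {i} i≤ with linear 1 (λ i → con 1ℤ ⊕ i ≼ i ∷ [] ⊢ con 0ℤ ≼ con -1ℤ) (i ∷ []) i≤
  ... | ()

  runs-maximal : ∀ {m} (p : Placed m) {r} → r ∈ runs p → Maximal (_∈ᶜ p) r
  runs-maximal (β , one a) (here refl) = record
    { nonempty-run = segment-nonempty β (0 , a)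
    ; contained    = λ _ → here
    ; maximal-bot  = λ { (here (b , _)) → i≰pred[i] b }
    ; maximal-top  = λ { (here (_ , t)) → suc[i]≰i t }
    }
  runs-maximal (β , two a g b) (here refl) = record
    { nonempty-run = segment-nonempty β (0 , a)
    ; contained    = λ _ → here
    ; maximal-bot  = λ
      { (here (b , _))         → i≰pred[i] b
      ; (there (here (b′ , _))) → i≰pred[i] (ℤ.≤-trans lower<upper b′) }
    ; maximal-top  = λ
      { (here (_ , t))         → suc[i]≰i t
      ; (there (here (b′ , _))) → suc[i]≰i (ℤ.≤-trans (runs-separated β a g b) b′) }
    }
    where
    lower<upper : β ℤ.+ + 0 ℤ.≤ β ℤ.+ + (a + toℕ g + 2)
    lower<upper = ℤ.+-monoʳ-≤ β (+≤+ z≤n)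
  runs-maximal (β , two a g b) (there (here refl)) = record
    { nonempty-run = segment-nonempty β (a + toℕ g + 2 , b)
    ; contained    = λ _ j∈r → there (here j∈r)
    ; maximal-bot  = λ
      { (here (_ , t))         → suc[i]≰i (ℤ.≤-trans shifted t)
      ; (there (here (b , _))) → i≰pred[i] b }
    ; maximal-top  = λ
      { (here (_ , t))         → suc[i]≰i (ℤ.≤-trans upper>lower t)
      ; (there (here (_ , t))) → suc[i]≰i t }
    }
    where
    shifted : ℤ.suc (β ℤ.+ + a) ℤ.≤ ℤ.pred (β ℤ.+ + (a + toℕ g + 2))
    shifted = linear 2 (λ x y → con 1ℤ ⊕ (con 1ℤ ⊕ x) ≼ y ∷ [] ⊢ con 1ℤ ⊕ x ≼ con -1ℤ ⊕ y)
      (β ℤ.+ + a ∷ β ℤ.+ + (a + toℕ g + 2) ∷ []) (runs-separated β a g b)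

    upper>lower : ℤ.suc (β ℤ.+ + a) ℤ.≤ ℤ.suc (β ℤ.+ + (a + toℕ g + 2 + b))
    upper>lower = linear 4
      (λ β a g b → con 0ℤ ≼ g ∷ con 0ℤ ≼ b ∷ [] ⊢ con 1ℤ ⊕ (β ⊕ a) ≼ con 1ℤ ⊕ (β ⊕ (a ⊕ g ⊕ con (+ 2) ⊕ b)))
      (β ∷ + a ∷ + toℕ g ∷ + b ∷ []) (+≤+ z≤n) (+≤+ z≤n)

  ∈ᶜ-run : ∀ {m} (p : Placed m) {j} → j ∈ᶜ p → ∃[ r ] r ∈ runs p × j ∈ʳ r
  ∈ᶜ-run p = go (runs p)
    where
    go : ∀ rs {j} → Any (j ∈ʳ_) rs → ∃[ r ] r ∈ rs × j ∈ʳ r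
    go (r ∷ rs) (here j∈r) = r , here refl , j∈r
    go (r ∷ rs) (there j∈) with go rs j∈
    ... | s , s∈ , j∈s = s , there s∈ , j∈s

  maximal⇒runs : ∀ {m} (p : Placed m) {r} → Maximal (_∈ᶜ p) r → r ∈ runs p
  maximal⇒runs p mr with ∈ᶜ-run p (contained mr _ (bot∈ʳ (nonempty-run mr)))
  ... | s , s∈ , j∈s = subst (_∈ runs p) (maximal-≡ (runs-maximal p s∈) mr j∈s (bot∈ʳ (nonempty-run mr))) s∈

  -- A column is determined by its cells

  +-cancelˡ-≡ : ∀ i {j k} → i ℤ.+ j ≡ i ℤ.+ k → j ≡ k
  +-cancelˡ-≡ i {j} {k} eq = ℤ.≤-antisym (cancel (ℤ.≤-reflexive eq)) (cancel (ℤ.≤-reflexive (sym eq)))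
    where
    cancel : ∀ {j k} → i ℤ.+ j ℤ.≤ i ℤ.+ k → j ℤ.≤ k
    cancel {j} {k} = linear 3 (λ i j k → i ⊕ j ≼ i ⊕ k ∷ [] ⊢ j ≼ k) (i ∷ j ∷ k ∷ [])

  upper≢lower : ∀ {m} β a (g : Fin m) b → ¬ (segment β (a + toℕ g + 2 , b) ≡ segment β (0 , a))
  upper≢lower β a g b eq = suc[i]≰i (ℤ.≤-trans (runs-separated β a g b)
    (subst (λ r → bot r ℤ.≤ ℤ.suc (β ℤ.+ + a)) (sym eq)
      (linear 2 (λ β a → con 0ℤ ≼ a ∷ [] ⊢ β ⊕ con 0ℤ ≼ con 1ℤ ⊕ (β ⊕ a)) (β ∷ + a ∷ []) (+≤+ z≤n))))

  private
    segment-injective : ∀ β β′ {x x′ h h′} →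
      segment β (x , h) ≡ segment β′ (x′ , h′) →
      β ℤ.+ + x ≡ β′ ℤ.+ + x′ × h ≡ h′
    segment-injective β β′ {x} {x′} {h} {h′} eq = bots , ℤ.+-injective
      (+-cancelˡ-≡ (β ℤ.+ + x)
        (trans (ℤ.+-assoc β (+ x) (+ h))
          (trans (cong top eq)
            (trans (sym (ℤ.+-assoc β′ (+ x′) (+ h′))) (cong (ℤ._+ + h′) (sym bots))))))
      where
      bots : β ℤ.+ + x ≡ β′ ℤ.+ + x′
      bots = cong bot eq

  -- The runs are recovered from the cells as the maximal runs. It remains to match lower with lower
  -- and upper with upper, and to read the parameters off the runs.
  placed-≡ : ∀ {m} (p q : Placed m) → (∀ j → j ∈ᶜ p ⇔ j ∈ᶜ q) → p ≡ q
  placed-≡ {m} p q e = same p q (λ r∈ → transfer p q e r∈) (λ r∈ → transfer q p (λ j → flip (e j)) r∈)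
    where
    flip : ∀ {A B : Set} → A ⇔ B → B ⇔ A
    flip f = mk⇔ (Equivalence.from f) (Equivalence.to f)

    transfer : ∀ (p q : Placed m) → (∀ j → j ∈ᶜ p ⇔ j ∈ᶜ q) → ∀ {r} → r ∈ runs p → r ∈ runs q
    transfer p q e r∈ = maximal⇒runs q (maximal-resp e (runs-maximal p r∈))

    lower-≡ : ∀ β β′ {h h′} → segment β (0 , h) ≡ segment β′ (0 , h′) → β ≡ β′ × h ≡ h′
    lower-≡ β β′ eq with segment-injective β β′ eq
    ... | βs , hs = trans (sym (ℤ.+-identityʳ β)) (trans βs (ℤ.+-identityʳ β′)) , hs

    -- If the lower run of one column were the upper run of the other, the still lower run of the
    -- latter would have no counterpart in the former.
    crossed : ∀ β a (g : Fin m) b β′ a′ (g′ : Fin m) b′ →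
      segment β (0 , a) ≡ segment β′ (a′ + toℕ g′ + 2 , b′) →
      segment β′ (0 , a′) ∈ runs (β , two a g b) → ⊥
    crossed β a g b β′ a′ g′ b′ eq (here eq′) = ⊥-elim (upper≢lower β′ a′ g′ b′ (trans (sym eq) (sym eq′)))
    crossed β a g b β′ a′ g′ b′ eq (there (here eq′)) = ⊥-elim (suc[i]≰i (ℤ.≤-trans step₁ (ℤ.≤-trans step₂ step₃)))
      where
      step₁ : ℤ.suc (β ℤ.+ + 0) ℤ.≤ bot (segment β (a + toℕ g + 2 , b))
      step₁ = ℤ.≤-trans
        (linear 2 (λ β a → con 0ℤ ≼ a ∷ [] ⊢ con 1ℤ ⊕ (β ⊕ con 0ℤ) ≼ con 1ℤ ⊕ (con 1ℤ ⊕ (β ⊕ a))) (β ∷ + a ∷ []) (+≤+ z≤n))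
        (runs-separated β a g b)
      step₂ : bot (segment β (a + toℕ g + 2 , b)) ℤ.≤ bot (segment β′ (a′ + toℕ g′ + 2 , b′))
      step₂ = subst (λ r → bot r ℤ.≤ bot (segment β′ (a′ + toℕ g′ + 2 , b′))) eq′
        (ℤ.+-monoʳ-≤ β′ (+≤+ z≤n))
      step₃ : bot (segment β′ (a′ + toℕ g′ + 2 , b′)) ℤ.≤ β ℤ.+ + 0
      step₃ = ℤ.≤-reflexive (cong bot (sym eq))

    same : ∀ (p′ q′ : Placed m) → (∀ {r} → r ∈ runs p′ → r ∈ runs q′) → (∀ {r} → r ∈ runs q′ → r ∈ runs p′) → p′ ≡ q′
    same (β , one a) (β′ , one a′) f g with f (here refl)
    ... | here eq with lower-≡ β β′ eq
    ... | refl , refl = refl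
    same (β , one a) (β′ , two a′ g′ b′) f g with g (here refl) | g (there (here refl))
    ... | here eq | here eq′ = ⊥-elim (upper≢lower β′ a′ g′ b′ (trans eq′ (sym eq)))
    same (β , two a h b) (β′ , one a′) f g with f (here refl) | f (there (here refl))
    ... | here eq | here eq′ = ⊥-elim (upper≢lower β a h b (trans eq′ (sym eq)))
    same (β , two a h b) (β′ , two a′ h′ b′) f g with f (here refl)
    ... | there (here eq) = ⊥-elim (crossed β a h b β′ a′ h′ b′ eq (g (here refl)))
    ... | here eq with lower-≡ β β′ eq
    ... | refl , refl with f (there (here refl))
    ...   | here eq′ = ⊥-elim (upper≢lower β a h b eq′)
    ...   | there (here eq′) with segment-injective β β {a + toℕ h + 2} {a + toℕ h′ + 2} eq′
    ...   | bots , refl with toℕ-injective (ℕ.+-cancelˡ-≡ a (toℕ h) (toℕ h′) (ℕ.+-cancelʳ-≡ 2 _ _ (ℤ.+-injective (+-cancelˡ-≡ β bots))))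
    ...   | refl = refl

  -- Adjacent stacks

  -- The right-hand neighbours of a cell at height `k` have heights `k` and `k - 1`. With `s` on the
  -- left and `r` on the right, this is why the extra unit stands on one side only.
  Meets : Run → Run → Set
  Meets s r = bot s ℤ.≤ ℤ.suc (top r) × bot r ℤ.≤ top s

  Touches : ∀ {m} → Placed m → Run → Set
  Touches p r = Any (λ s → Meets s r) (runs p)

  Supports : ∀ {m} → Placed m → Placed m → Set
  Supports p q = All (Touches p) (runs q)

  private
    pred≤ : ∀ i → ℤ.pred i ℤ.≤ i
    pred≤ i = linear 1 (λ i → [] ⊢ con -1ℤ ⊕ i ≼ i) (i ∷ [])

    ≤suc : ∀ i → i ℤ.≤ ℤ.suc i
    ≤suc i = linear 1 (λ i → [] ⊢ i ≼ con 1ℤ ⊕ i) (i ∷ [])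

  shareEdge-right : ∀ {i j k} → ShareEdge (i , k) (ℤ.suc i , j) → j ≡ k ⊎ j ≡ ℤ.pred k
  shareEdge-right (here eq) = ⊥-elim (suc[i]≰i (ℤ.≤-reflexive (cong proj₁ eq)))
  shareEdge-right (there (here eq)) = ⊥-elim (suc[i]≰i (ℤ.≤-reflexive (cong proj₁ eq)))
  shareEdge-right (there (there (here eq))) = inj₁ (cong proj₂ eq)
  shareEdge-right (there (there (there (here eq)))) = inj₂ (cong proj₂ eq)
  shareEdge-right {i} (there (there (there (there (here eq))))) =
    ⊥-elim (suc[i]≰i (ℤ.≤-trans (ℤ.≤-reflexive (cong proj₁ eq)) (pred≤ i)))
  shareEdge-right {i} (there (there (there (there (there (here eq)))))) =
    ⊥-elim (suc[i]≰i (ℤ.≤-trans (ℤ.≤-reflexive (cong proj₁ eq)) (pred≤ i)))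

  shareEdge-stack : ∀ {i j i′ j′} → ShareEdge (i , j) (i′ , j′) → i′ ℤ.≤ ℤ.suc i
  shareEdge-stack {i} (here refl) = ≤suc i
  shareEdge-stack {i} (there (here refl)) = ≤suc i
  shareEdge-stack (there (there (here refl))) = ℤ.≤-refl
  shareEdge-stack (there (there (there (here refl)))) = ℤ.≤-refl
  shareEdge-stack {i} (there (there (there (there (here refl))))) = ℤ.≤-trans (pred≤ i) (≤suc i)
  shareEdge-stack {i} (there (there (there (there (there (here refl)))))) = ℤ.≤-trans (pred≤ i) (≤suc i)

  shareEdge-sym : ∀ {c d} → ShareEdge c d → ShareEdge d c
  shareEdge-sym (here refl) = there (here (cong (_ ,_) (sym (ℤ.pred-suc _))))
  shareEdge-sym (there (here refl)) = here (cong (_ ,_) (sym (ℤ.suc-pred _)))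
  shareEdge-sym (there (there (here refl))) =
    there (there (there (there (here (cong (_, _) (sym (ℤ.pred-suc _)))))))
  shareEdge-sym (there (there (there (here refl)))) =
    there (there (there (there (there (here (cong₂ _,_ (sym (ℤ.pred-suc _)) (sym (ℤ.suc-pred _))))))))
  shareEdge-sym (there (there (there (there (here refl))))) =
    there (there (here (cong (_, _) (sym (ℤ.suc-pred _)))))
  shareEdge-sym (there (there (there (there (there (here refl)))))) =
    there (there (there (here (cong₂ _,_ (sym (ℤ.suc-pred _)) (sym (ℤ.pred-suc _))))))

  shareEdge⇒meets : ∀ {i j k r s} → j ∈ʳ r → k ∈ʳ s → ShareEdge (i , k) (ℤ.suc i , j) → Meets s r
  shareEdge⇒meets {j = j} {k} {r} {s} (b≤j , j≤t) (b≤k , k≤t) e with shareEdge-right e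
  ... | inj₁ refl =
    linear 3 (λ x j y → x ≼ j ∷ j ≼ y ∷ [] ⊢ x ≼ con 1ℤ ⊕ y) (bot s ∷ j ∷ top r ∷ []) b≤k j≤t ,
    ℤ.≤-trans b≤j k≤t
  ... | inj₂ refl =
    linear 3 (λ x k y → x ≼ k ∷ con -1ℤ ⊕ k ≼ y ∷ [] ⊢ x ≼ con 1ℤ ⊕ y) (bot s ∷ k ∷ top r ∷ []) b≤k j≤t ,
    ℤ.≤-trans b≤j (ℤ.≤-trans (pred≤ _) k≤t)

  -- The edge is found at the bottom of the run that starts higher. If that is strictly `s`, its
  -- lowest cell is paired with the neighbour one position down.
  meets⇒shareEdge : ∀ {i r s} → bot r ℤ.≤ top r → bot s ℤ.≤ top s → Meets s r →
    ∃[ j ] ∃[ k ] j ∈ʳ r × k ∈ʳ s × ShareEdge (i , k) (ℤ.suc i , j)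
  meets⇒shareEdge {r = r} {s} r≤ s≤ (s≤r , r≤s) with bot s ℤ.≤? bot r
  ... | yes b≤b = bot r , bot r , bot∈ʳ r≤ , (b≤b , r≤s) , there (there (here refl))
  ... | no  b≰b = ℤ.pred (bot s) , bot s ,
    ( linear 2 (λ x y → con 1ℤ ⊕ x ≼ y ∷ [] ⊢ x ≼ con -1ℤ ⊕ y) (bot r ∷ bot s ∷ [])
        (ℤ.i<j⇒suc[i]≤j (ℤ.≰⇒> b≰b))
    , linear 2 (λ x y → x ≼ con 1ℤ ⊕ y ∷ [] ⊢ con -1ℤ ⊕ x ≼ y) (bot s ∷ top r ∷ []) s≤r) ,
    bot∈ʳ s≤ , there (there (there (here refl)))

  -- Lists of placed columns

  elements : ℤ → ℕ × ℕ → List ℤ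
  elements β (x , h) = map (λ k → β ℤ.+ + (x + k)) (upTo (suc h))

  module _ {m : ℕ} where

    stack : ℤ → Placed m → List Cell
    stack i (β , c) = map (i ,_) (concatMap (elements β) (segments c))

    cellsFrom : ℤ → List (Placed m) → List Cell
    cellsFrom i []       = []
    cellsFrom i (p ∷ ps) = stack i p ++ cellsFrom (ℤ.suc i) ps

    data At : ℤ → List (Placed m) → ℤ → Placed m → Set where
      here  : ∀ {i p ps} → At i (p ∷ ps) i p
      there : ∀ {i p ps k q} → At (ℤ.suc i) ps k q → At i (p ∷ ps) k q

  ≤⇒∃+ : ∀ {i j} → i ℤ.≤ j → ∃[ n ] j ≡ i ℤ.+ + n
  ≤⇒∃+ {i} {j} i≤j = ℤ.∣ j ℤ.- i ∣ , trans (lemma i j) (cong (ℤ._+_ i) (sym (ℤ.0≤i⇒+∣i∣≡i (ℤ.i≤j⇒0≤j-i i≤j))))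
    where
    lemma : ∀ i j → j ≡ i ℤ.+ (j ℤ.- i)
    lemma = solve-∀

  module _ {m : ℕ} where

    ∈-elements : ∀ β s {j} → j ∈ elements β s ⇔ j ∈ʳ segment β s
    ∈-elements β (x , h) {j} = mk⇔ to from
      where
      to : j ∈ elements β (x , h) → j ∈ʳ segment β (x , h)
      to j∈ with ∈-map⁻ _ j∈
      ... | k , k∈ , refl =
        ℤ.+-monoʳ-≤ β (+≤+ (ℕ.m≤m+n x k)) ,
        ℤ.+-monoʳ-≤ β (+≤+ (ℕ.+-monoʳ-≤ x (ℕ.s≤s⁻¹ (∈-upTo⁻ k∈))))

      from : j ∈ʳ segment β (x , h) → j ∈ elements β (x , h)
      from (b≤j , j≤t) with ≤⇒∃+ b≤j
      ... | k , refl = subst (_∈ elements β (x , h)) (sym (ℤ.+-assoc β (+ x) (+ k)))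
        (∈-map⁺ _ (∈-upTo⁺ (s≤s (ℤ.drop‿+≤+
          (linear 4 (λ β x k h → β ⊕ x ⊕ k ≼ β ⊕ (x ⊕ h) ∷ [] ⊢ k ≼ h) (β ∷ + x ∷ + k ∷ + h ∷ []) j≤t)))))

    ∈-stack : ∀ i p {c} → c ∈ stack {m} i p ⇔ (∃[ j ] c ≡ (i , j) × j ∈ᶜ p)
    ∈-stack i (β , c) = mk⇔ to from
      where
      to : ∀ {d} → d ∈ stack i (β , c) → ∃[ j ] d ≡ (i , j) × j ∈ᶜ (β , c)
      to d∈ with ∈-map⁻ _ d∈
      ... | j , j∈ , refl = j , refl ,
        Any.map⁺ (Any.map (λ {s} → Equivalence.to (∈-elements β s)) (∈-concatMap⁻ (elements β) {xs = segments c} j∈))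
      from : ∀ {d} → ∃[ j ] d ≡ (i , j) × j ∈ᶜ (β , c) → d ∈ stack i (β , c)
      from (j , refl , j∈) = ∈-map⁺ _
        (∈-concatMap⁺ (elements β) (Any.map (λ {s} → Equivalence.from (∈-elements β s)) (Any.map⁻ j∈)))

    ∈-cellsFrom : ∀ i ps {k j} → (k , j) ∈ cellsFrom {m} i ps ⇔ (∃[ p ] At i ps k p × j ∈ᶜ p)
    ∈-cellsFrom i ps = mk⇔ (to i ps) (λ (p , at , j∈) → from at j∈)
      where
      to : ∀ i ps {k j} → (k , j) ∈ cellsFrom {m} i ps → ∃[ p ] At i ps k p × j ∈ᶜ p
      to i (p ∷ ps) c∈ with ∈-++⁻ (stack i p) c∈
      ... | inj₁ c∈p with Equivalence.to (∈-stack i p) c∈p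
      ...   | j , refl , j∈ = p , here , j∈
      to i (p ∷ ps) c∈ | inj₂ c∈ps with to (ℤ.suc i) ps c∈ps
      ...   | q , at , j∈ = q , there at , j∈
      from : ∀ {i ps k p j} → At i ps k p → j ∈ᶜ p → (k , j) ∈ cellsFrom i ps
      from {i} {p ∷ ps} here j∈ = ∈-++⁺ˡ (Equivalence.from (∈-stack i p) (_ , refl , j∈))
      from {i} {p ∷ ps} (there at) j∈ = ∈-++⁺ʳ (stack i p) (from at j∈)

    at-≥ : ∀ {i ps k} {p : Placed m} → At i ps k p → i ℤ.≤ k
    at-≥ here       = ℤ.≤-refl
    at-≥ (there at) = ℤ.≤-trans (≤suc _) (at-≥ at)

    at-functional : ∀ {i ps k} {p q : Placed m} → At i ps k p → At i ps k q → p ≡ q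
    at-functional here       here        = refl
    at-functional here       (there at)  = ⊥-elim (suc[i]≰i (at-≥ at))
    at-functional (there at) here        = ⊥-elim (suc[i]≰i (at-≥ at))
    at-functional (there at) (there at′) = at-functional at at′

    -- A list of columns occupies consecutive stacks, so there is no empty stack between two of
    -- them.
    at-next : ∀ {i ps k k′} {p q : Placed m} → At i ps k p → At i ps k′ q → k ℤ.< k′ →
      ∃[ p′ ] At i ps (ℤ.suc k) p′
    at-next here here k<k = ⊥-elim (ℤ.<-irrefl refl k<k)
    at-next here (there {ps = p′ ∷ _} _) _ = p′ , there here
    at-next (there at) here k<k′ = ⊥-elim (suc[i]≰i (ℤ.≤-trans (at-≥ at) (ℤ.<⇒≤ k<k′)))
    at-next (there at) (there at′) k<k′ with at-next at at′ k<k′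
    ... | p′ , at″ = p′ , there at″

    at-linked : ∀ {R : Placed m → Placed m → Set} {i ps k k′ p q} → Linked R ps →
      At i ps k p → At i ps k′ q → k′ ≡ ℤ.suc k → R p q
    at-linked _        here       here               eq   = ⊥-elim (suc[i]≰i (ℤ.≤-reflexive (sym eq)))
    at-linked (r ∷ _)  here       (there here)       refl = r
    at-linked _        here       (there (there at)) refl = ⊥-elim (suc[i]≰i (at-≥ at))
    at-linked _        (there at) here               refl =
      ⊥-elim (suc[i]≰i (ℤ.≤-trans (at-≥ at) (≤suc _)))
    at-linked (_ ∷ rs) (there at) (there at′)        eq   = at-linked rs at at′ eq

    unique-stack : ∀ i p → Unique (stack {m} i p)
    unique-stack i (β , c) = Unique.map⁺ (cong proj₂) (unique-concat c)
      where
      unique-elements : ∀ s → Unique (elements β s)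
      unique-elements (x , h) = Unique.map⁺
        (λ eq → ℕ.+-cancelˡ-≡ x _ _ (ℤ.+-injective (+-cancelˡ-≡ β eq))) (Unique.upTo⁺ (suc h))
      unique-concat : ∀ c → Unique (concatMap (elements β) (segments {m} c))
      unique-concat (one a) = Unique.++⁺ (unique-elements (0 , a)) [] λ { (_ , ()) }
      unique-concat (two a g b) = Unique.++⁺ (unique-elements (0 , a))
        (Unique.++⁺ (unique-elements _) [] λ { (_ , ()) })
        λ {j} (j∈ , j∈′) → disjoint j∈ (subst (j ∈_) (++-identityʳ (elements β (a + toℕ g + 2 , b))) j∈′)
        where
        disjoint : ∀ {j} → j ∈ elements β (0 , a) → j ∈ elements β (a + toℕ g + 2 , b) → ⊥
        disjoint j∈ j∈′ with Equivalence.to (∈-elements β (0 , a)) j∈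
                           | Equivalence.to (∈-elements β (a + toℕ g + 2 , b)) j∈′
        ... | _ , j≤t | b≤j , _ = suc[i]≰i
          (ℤ.≤-trans (ℤ.≤-trans (≤suc _) (runs-separated β a g b)) (ℤ.≤-trans b≤j j≤t))

    unique-cellsFrom : ∀ i ps → Unique (cellsFrom {m} i ps)
    unique-cellsFrom i []       = []
    unique-cellsFrom i (p ∷ ps) = Unique.++⁺ (unique-stack i p) (unique-cellsFrom (ℤ.suc i) ps)
      λ { (c∈ , c∈′) → disjoint (Equivalence.to (∈-stack i p) c∈) c∈′ }
      where
      disjoint : ∀ {c} → (∃[ j ] c ≡ (i , j) × j ∈ᶜ p) → c ∈ cellsFrom (ℤ.suc i) ps → ⊥
      disjoint (j , refl , _) c∈ with Equivalence.to (∈-cellsFrom (ℤ.suc i) ps) c∈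
      ... | _ , at , _ = suc[i]≰i (at-≥ at)

  -- Connectedness of a list of supported columns

  Path : List Cell → Cell → Cell → Set
  Path xs = Star (λ c d → c ∈ xs × d ∈ xs × ShareEdge c d)

  path-sym : ∀ {xs c d} → Path xs c d → Path xs d c
  path-sym = Star.reverse (λ (c∈ , d∈ , e) → d∈ , c∈ , shareEdge-sym e)

  upward-path : ∀ {xs i} n j → (∀ j′ → j ℤ.≤ j′ → j′ ℤ.≤ j ℤ.+ + n → (i , j′) ∈ xs) →
    Path xs (i , j) (i , j ℤ.+ + n)
  upward-path {xs} {i} zero j _ = subst (λ j′ → Path xs (i , j) (i , j′)) (sym (ℤ.+-identityʳ j)) ε
  upward-path {xs} {i} (suc n) j f =
    ( f j ℤ.≤-refl (ℤ.i≤i+j j (+ suc n))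
    , f (ℤ.suc j) (ℤ.i≤suc[i] j) (linear 2 (λ j n → con 0ℤ ≼ n ∷ [] ⊢ con 1ℤ ⊕ j ≼ j ⊕ (con 1ℤ ⊕ n)) (j ∷ + n ∷ []) (+≤+ z≤n))
    , here refl) ◅
    subst (λ j′ → Path xs (i , ℤ.suc j) (i , j′)) regroup
      (upward-path n (ℤ.suc j) λ j′ j<j′ j′≤ → f j′ (ℤ.≤-trans (ℤ.i≤suc[i] j) j<j′) (subst (j′ ℤ.≤_) regroup j′≤))
    where
    regroup : ℤ.suc j ℤ.+ + n ≡ j ℤ.+ + suc n
    regroup = trans (cong (ℤ._+ + n) (ℤ.+-comm 1ℤ j)) (ℤ.+-assoc j 1ℤ (+ n))

  run-path : ∀ {xs i r j j′} → (∀ j → j ∈ʳ r → (i , j) ∈ xs) → j ∈ʳ r → j′ ∈ʳ r → Path xs (i , j) (i , j′)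
  run-path {xs} {i} {r} {j} {j′} f j∈ j′∈ = case (ℤ.≤-total j j′)
    where
    ordered : ∀ {j j′} → j ∈ʳ r → j′ ∈ʳ r → j ℤ.≤ j′ → Path xs (i , j) (i , j′)
    ordered {j} j∈ j′∈ j≤j′ with ≤⇒∃+ j≤j′
    ... | n , refl = upward-path n j λ k j≤k k≤j′ →
      f k (ℤ.≤-trans (proj₁ j∈) j≤k , ℤ.≤-trans k≤j′ (proj₂ j′∈))

    case : j ℤ.≤ j′ ⊎ j′ ℤ.≤ j → Path xs (i , j) (i , j′)
    case (inj₁ j≤j′) = ordered j∈ j′∈ j≤j′
    case (inj₂ j′≤j) = path-sym (ordered j′∈ j∈ j′≤j)

  run⊆ᶜ : ∀ {m} {p : Placed m} {r j} → r ∈ runs p → j ∈ʳ r → j ∈ᶜ p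
  run⊆ᶜ {p = p} r∈ j∈ = Maximal.contained (runs-maximal p r∈) _ j∈

  column-inhabited : ∀ {m} (p : Placed m) → ∃[ j ] j ∈ᶜ p
  column-inhabited p = let r , r∈ = first-run p in
    _ , run⊆ᶜ {p = p} r∈ (bot∈ʳ (Maximal.nonempty-run (runs-maximal p r∈)))
    where
    first-run : ∀ {m} (p : Placed m) → ∃[ r ] r ∈ runs p
    first-run (_ , one _)     = _ , here refl
    first-run (_ , two _ _ _) = _ , here refl

  -- Every column inherits its paths to b from the column on its left.
  connect : ∀ {m} {xs b i} {p : Placed m} {ps k q j} → Linked Supports (p ∷ ps) →
    (∀ {k q j} → At i (p ∷ ps) k q → j ∈ᶜ q → (k , j) ∈ xs) →
    (∀ {j} → j ∈ᶜ p → Path xs (i , j) b) →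
    At i (p ∷ ps) k q → j ∈ᶜ q → Path xs (k , j) b
  connect _ _ reach here j∈ = reach j∈
  connect {xs = xs} {b} {i} {p} {q ∷ _} (supp ∷ linked) ⊆xs reach (there at) j∈ =
    connect linked (λ at → ⊆xs (there at)) reach′ at j∈
    where
    reach′ : ∀ {j} → j ∈ᶜ q → Path xs (ℤ.suc i , j) b
    reach′ j∈q with ∈ᶜ-run q j∈q
    ... | r , r∈ , j∈r with find (All.lookup supp r∈)
    ... | s , s∈ , meets
      with meets⇒shareEdge {i} (Maximal.nonempty-run (runs-maximal q r∈)) (Maximal.nonempty-run (runs-maximal p s∈)) meets
    ... | j′ , k , j′∈r , k∈s , edge =
      -- The path runs along the component to the shared edge, crosses it, and continues with a path
      -- known for `p`.
      run-path (λ j j∈r → ⊆xs (there here) (run⊆ᶜ {p = q} r∈ j∈r)) j∈r j′∈r ◅◅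
      ( ⊆xs (there here) (run⊆ᶜ {p = q} r∈ j′∈r)
      , ⊆xs here (run⊆ᶜ {p = p} s∈ k∈s)
      , shareEdge-sym edge) ◅ reach (run⊆ᶜ {p = p} s∈ k∈s)

  base∈ : ∀ {m} β a → β ∈ᶜ (β , one {m} a)
  base∈ β a = here (ℤ.≤-reflexive (ℤ.+-identityʳ β) , ℤ.i≤i+j β (+ a))

  toPolyomino : ∀ {m} β a (ps : List (Placed m)) → Linked Supports ((β , one a) ∷ ps) → Polyomino
  toPolyomino {m} β a ps linked = record
    { cells     = xs
    ; unique    = unique-cellsFrom 0ℤ ((β , one a) ∷ ps)
    ; nonempty  = (0ℤ , β) , ⊆xs here (base∈ {m} β a)
    ; connected = λ c∈ d∈ → to-base c∈ ◅◅ path-sym (to-base d∈)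
    }
    where
    xs : List Cell
    xs = cellsFrom 0ℤ ((β , one a) ∷ ps)

    ⊆xs : ∀ {k q j} → At 0ℤ ((β , one a) ∷ ps) k q → j ∈ᶜ q → (k , j) ∈ xs
    ⊆xs at j∈ = Equivalence.from (∈-cellsFrom 0ℤ ((β , one a) ∷ ps)) (_ , at , j∈)

    to-base : ∀ {c} → c ∈ xs → Path xs c (0ℤ , β)
    to-base c∈ with Equivalence.to (∈-cellsFrom 0ℤ ((β , one a) ∷ ps)) c∈
    ... | _ , at , j∈ = connect linked ⊆xs
      (λ { (here j∈r) → run-path (λ j j∈r → ⊆xs here (here j∈r)) j∈r (Any.head (λ ()) (base∈ {m} β a)) })
      at j∈

  -- The components of a column

  Describes : ∀ {m} → Polyomino → ℤ → Placed m → Set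
  Describes P i p = ∀ j → (i , j) ∈ cells P ⇔ j ∈ᶜ p

  module _ {m} {P : Polyomino} {i : ℤ} (p : Placed m) (desc : Describes P i p) where

    component⇒runs : ∀ {r} → IsComponent P i r → r ∈ runs p
    component⇒runs comp = maximal⇒runs p (maximal-resp desc record { IsComponent comp })

    runs⇒component : ∀ {r} → r ∈ runs p → IsComponent P i r
    runs⇒component r∈ = record { Maximal (maximal-resp (λ j → mk⇔ (Equivalence.from (desc j)) (Equivalence.to (desc j))) (runs-maximal p r∈)) }

  two-runs : ∀ {m} (p : Placed m) {r s t} → r ∈ runs p → s ∈ runs p → t ∈ runs p → r ≡ s ⊎ r ≡ t ⊎ s ≡ t
  two-runs (β , one _) (here r) (here s) _ = inj₁ (trans r (sym s))
  two-runs (β , two _ _ _) (here r) (here s) _ = inj₁ (trans r (sym s))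
  two-runs (β , two _ _ _) (here r) _ (here t) = inj₂ (inj₁ (trans r (sym t)))
  two-runs (β , two _ _ _) _ (here s) (here t) = inj₂ (inj₂ (trans s (sym t)))
  two-runs (β , two _ _ _) (there (here r)) (there (here s)) _ = inj₁ (trans r (sym s))
  two-runs (β , two _ _ _) (there (here r)) _ (there (here t)) = inj₂ (inj₁ (trans r (sym t)))
  two-runs (β , two _ _ _) _ (there (here s)) (there (here t)) = inj₂ (inj₂ (trans s (sym t)))

  runs-gap : ∀ {m} (p : Placed m) {r s} → r ∈ runs p → s ∈ runs p → top r ℤ.< bot s → gapSize r s ℤ.≤ + m
  runs-gap p r∈ s∈ r<s = go p r∈ s∈ r<s
    where
    irrefl : ∀ {m} (p : Placed m) {r} → r ∈ runs p → ¬ (top r ℤ.< bot r)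
    irrefl p r∈ t<b = ℤ.<-irrefl refl (ℤ.<-≤-trans t<b (Maximal.nonempty-run (runs-maximal p r∈)))
    go : ∀ {m} (p : Placed m) {r s} → r ∈ runs p → s ∈ runs p → top r ℤ.< bot s → gapSize r s ℤ.≤ + m
    go p@(_ , one _)     (here refl)         (here refl)         r<s = ⊥-elim (irrefl p (here refl) r<s)
    go p@(_ , two _ _ _) (here refl)         (here refl)         r<s = ⊥-elim (irrefl p (here refl) r<s)
    go p@(_ , two _ _ _) (there (here refl)) (there (here refl)) r<s = ⊥-elim (irrefl p (there (here refl)) r<s)
    go {m} (β , two a g b) (here refl) (there (here refl)) _ =
      linear 4 (λ β a g m → con 1ℤ ⊕ g ≼ m ∷ [] ⊢ β ⊕ (a ⊕ g ⊕ con (+ 2)) ⊖ (con 1ℤ ⊕ (β ⊕ a)) ≼ m)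
        (β ∷ + a ∷ + toℕ g ∷ + m ∷ []) (+≤+ (toℕ<n g))
    go (β , two a g b) (there (here refl)) (here refl) r<s = ⊥-elim (suc[i]≰i
      (linear 4 (λ β a g b → con 1ℤ ⊕ (β ⊕ (a ⊕ g ⊕ con (+ 2) ⊕ b)) ≼ β ⊕ con 0ℤ ∷ con 0ℤ ≼ a ∷ con 0ℤ ≼ g ∷ con 0ℤ ≼ b ∷ [] ⊢ con 1ℤ ⊕ β ≼ β)
        (β ∷ + a ∷ + toℕ g ∷ + b ∷ []) (ℤ.i<j⇒suc[i]≤j r<s) (+≤+ z≤n) (+≤+ z≤n) (+≤+ z≤n)))

  module _ {m} (P : Polyomino) (β : ℤ) (a : ℕ) (ps : List (Placed m))
    (linked : Linked Supports ((β , one a) ∷ ps))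
    (∈-cells : ∀ {k j} → (k , j) ∈ cells P ⇔ (∃[ p ] At 0ℤ ((β , one a) ∷ ps) k p × j ∈ᶜ p))
    where

    private
      ps⁺ : List (Placed m)
      ps⁺ = (β , one a) ∷ ps

      describes : ∀ {k q} → At 0ℤ ps⁺ k q → Describes P k q
      describes at j = mk⇔
        (λ c∈ → let _ , at′ , j∈ = Equivalence.to ∈-cells c∈
                in subst (j ∈ᶜ_) (at-functional at′ at) j∈)
        (λ j∈ → Equivalence.from ∈-cells (_ , at , j∈))

      isColumn⇒at : ∀ {k} → IsColumn P k → ∃[ q ] At 0ℤ ps⁺ k q
      isColumn⇒at (_ , c∈) with Equivalence.to ∈-cells c∈
      ... | q , at , _ = q , at

      at⇒isColumn : ∀ {k q} → At 0ℤ ps⁺ k q → IsColumn P k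
      at⇒isColumn {q = q} at = _ , Equivalence.from (describes at _) (proj₂ (column-inhabited q))

      column : ∀ {k r} → IsComponent P k r → ∃[ q ] At 0ℤ ps⁺ k q
      column comp = isColumn⇒at (_ , IsComponent.contained comp _ (bot∈ʳ (IsComponent.nonempty-run comp)))

      first-run : ∀ {k q r} → At 0ℤ ps⁺ k q → k ≡ 0ℤ → IsComponent P k r → r ≡ segment β (0 , a)
      first-run {q = q} {r} at refl rc =
        single (subst (λ p → r ∈ runs p) (at-functional at here) (component⇒runs q (describes at) rc))
        where
        single : r ∈ segment β (0 , a) ∷ [] → r ≡ segment β (0 , a)
        single (here eq) = eq

      first-column : ∀ i → IsFirstColumn P i → ∀ {r s} → IsComponent P i r → IsComponent P i s → r ≡ s
      first-column i (col , least) rc sc = trans (first rc) (sym (first sc))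
        where
        at : At 0ℤ ps⁺ i _
        at = proj₂ (isColumn⇒at col)
        first : ∀ {r} → IsComponent P i r → r ≡ segment β (0 , a)
        first = first-run at (ℤ.≤-antisym (least 0ℤ (at⇒isColumn here)) (at-≥ at))

      supported-next : ∀ {i i′ p q r} → At 0ℤ ps⁺ i p → At 0ℤ ps⁺ i′ q → i′ ≡ ℤ.suc i → IsComponent P i′ r →
        ∃[ j ] ∃[ k ] j ∈ʳ r × (i , k) ∈ cells P × ShareEdge (i , k) (i′ , j)
      supported-next {i} {p = p} {q} {r} at at′ refl rc =
        let
          s , s∈ , meets = find (All.lookup (at-linked linked at at′ refl) (component⇒runs q (describes at′) rc))
          j , k , j∈ , k∈ , edge = meets⇒shareEdge {i} {r} {s} (IsComponent.nonempty-run rc)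
            (Maximal.nonempty-run (runs-maximal p s∈)) meets
        in j , k , j∈ , Equivalence.from (describes at k) (run⊆ᶜ {p = p} s∈ k∈) , edge

      supported : ∀ i i′ → AdjacentColumns P i i′ → ∀ r → IsComponent P i′ r →
        ∃[ j ] ∃[ k ] j ∈ʳ r × (i , k) ∈ cells P × ShareEdge (i , k) (i′ , j)
      supported i i′ (col , col′ , i<i′ , between) r rc = supported-next at at′ consecutive rc
        where
        at : At 0ℤ ps⁺ i _
        at = proj₂ (isColumn⇒at col)
        at′ : At 0ℤ ps⁺ i′ _
        at′ = proj₂ (isColumn⇒at col′)
        -- If `i′` were farther right, the stack `i + 1` would hold a column strictly between the
        -- two.
        consecutive : i′ ≡ ℤ.suc i
        consecutive = sym (ℤ.≤-antisym (ℤ.i<j⇒suc[i]≤j i<i′) (ℤ.≮⇒≥ λ lt → between (ℤ.suc i)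
          (at⇒isColumn (proj₂ (at-next at at′ i<i′))) (ℤ.suc[i]≤j⇒i<j ℤ.≤-refl , lt)))

    columns⇒cheesy : IsCheesy m P
    columns⇒cheesy = record
      { semi-directed = record
        { first-column = λ i first r s rc sc → first-column i first rc sc
        ; supported    = supported
        }
      ; two-components = λ i r s t rc sc tc →
          let p , at = column rc in
          two-runs p (component⇒runs p (describes at) rc) (component⇒runs p (describes at) sc) (component⇒runs p (describes at) tc)
      ; small-gaps = λ i r s rc sc →
          let p , at = column rc in
          runs-gap p (component⇒runs p (describes at) rc) (component⇒runs p (describes at) sc)
      }

  toPolyomino-cheesy : ∀ {m} β a (ps : List (Placed m)) linked → IsCheesy m (toPolyomino β a ps linked)
  toPolyomino-cheesy β a ps linked =
    columns⇒cheesy (toPolyomino β a ps linked) β a ps linked (∈-cellsFrom 0ℤ ((β , one a) ∷ ps))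

  translate-injective : ∀ t {c d} → translate t c ≡ translate t d → c ≡ d
  translate-injective (a , b) eq = cong₂ _,_ (cancel (cong proj₁ eq)) (cancel (cong proj₂ eq))
    where
    cancel : ∀ {i j k} → i ℤ.+ k ≡ j ℤ.+ k → i ≡ j
    cancel {i} {j} {k} e = +-cancelˡ-≡ k (trans (ℤ.+-comm k i) (trans e (ℤ.+-comm j k)))

  untranslate : ℤ × ℤ → Cell → Cell
  untranslate (a , b) (i , j) = i ℤ.- a , j ℤ.- b

  translate-untranslate : ∀ t c → translate t (untranslate t c) ≡ c
  translate-untranslate (a , b) (i , j) = cong₂ _,_ (lemma i a) (lemma j b)
    where
    lemma : ∀ x y → x ℤ.- y ℤ.+ y ≡ x
    lemma = solve-∀

  -- Positions of columns relative to their left neighbours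

  module _ {m : ℕ} where

    lower : Column m → ℕ
    lower (one a)     = a
    lower (two a _ _) = a

    -- A step (t , d) puts the column d to the right of the column c, where t is
    -- the height of the top of the lower component of d above the lowest cell
    -- of that stack that is adjacent to c.
    Step : Set
    Step = ℕ × Column m

    -- The lowest cell adjacent to a column with bottom `β` has height `β - 1`. So the lower
    -- component of `d` has its top at `β + t - 1` and its bottom `lower d` positions below that.
    place : Placed m → Step → Placed m
    place (β , _) (t , d) = β ℤ.+ + t ℤ.- + suc (lower d) , d

    decode : Placed m → List Step → List (Placed m)
    decode p []       = []
    decode p (s ∷ ss) = place p s ∷ decode (place p s) ss

    -- The components of the column d, as pairs (τ , h) of a top in the above
    -- sense and a number of cells h + 1.
    tops : ℕ → Column m → List (ℕ × ℕ)
    tops t (one a)     = (t , a) ∷ []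
    tops t (two a g b) = (t , a) ∷ (t + toℕ g + b + 2 , b) ∷ []

    -- This is `Meets` relative to the bottom `β` of the left column: the right run has its top at
    -- `β + τ - 1` and its bottom at `β + τ - 1 - h`.
    Overlap : ℕ × ℕ → ℕ × ℕ → Set
    Overlap (τ , h) (x , k) = x ℕ.≤ τ × τ ℕ.≤ suc (x + k) + h

    Fits : Column m → Step → Set
    Fits c (t , d) = All (λ r → Any (Overlap r) (segments c)) (tops t d)

    ValidSteps : Column m → List Step → Set
    ValidSteps c []             = ⊤
    ValidSteps c ((t , d) ∷ ss) = Fits c (t , d) × ValidSteps d ss

    private
      meets⇔overlap : ∀ β {r} τ h x k → ℤ.suc (top r) ≡ β ℤ.+ + τ → bot r ℤ.+ + h ≡ top r →
        Meets (segment β (x , k)) r ⇔ Overlap (τ , h) (x , k)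
      meets⇔overlap β {r} τ h x k eq eq′ = mk⇔
        (λ (p , q) →
          ℤ.drop‿+≤+ (linear 4 (λ β x τ t → β ⊕ x ≼ con 1ℤ ⊕ t ∷ con 1ℤ ⊕ t ≼ β ⊕ τ ∷ [] ⊢ x ≼ τ)
            (β ∷ + x ∷ + τ ∷ top r ∷ []) p (ℤ.≤-reflexive eq)) ,
          ℤ.drop‿+≤+ (linear 7
            (λ β x τ t k h b → b ≼ β ⊕ (x ⊕ k) ∷ β ⊕ τ ≼ con 1ℤ ⊕ t ∷ t ≼ b ⊕ h ∷ [] ⊢ τ ≼ con 1ℤ ⊕ (x ⊕ k) ⊕ h)
            (β ∷ + x ∷ + τ ∷ top r ∷ + k ∷ + h ∷ bot r ∷ []) q (ℤ.≤-reflexive (sym eq)) (ℤ.≤-reflexive (sym eq′))))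
        (λ (p , q) →
          linear 4 (λ β x τ t → x ≼ τ ∷ β ⊕ τ ≼ con 1ℤ ⊕ t ∷ [] ⊢ β ⊕ x ≼ con 1ℤ ⊕ t)
            (β ∷ + x ∷ + τ ∷ top r ∷ []) (+≤+ p) (ℤ.≤-reflexive (sym eq)) ,
          linear 7
            (λ β x τ t k h b → τ ≼ con 1ℤ ⊕ (x ⊕ k) ⊕ h ∷ con 1ℤ ⊕ t ≼ β ⊕ τ ∷ b ⊕ h ≼ t ∷ [] ⊢ b ≼ β ⊕ (x ⊕ k))
            (β ∷ + x ∷ + τ ∷ top r ∷ + k ∷ + h ∷ bot r ∷ []) (+≤+ q) (ℤ.≤-reflexive eq) (ℤ.≤-reflexive eq′))

      touches⇔ : ∀ {β} c {r} τ h → ℤ.suc (top r) ≡ β ℤ.+ + τ → bot r ℤ.+ + h ≡ top r →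
        Touches {m} (β , c) r ⇔ Any (Overlap (τ , h)) (segments c)
      touches⇔ {β} c τ h eq eq′ = mk⇔
        (λ p → Any.map (λ {(x , k)} → Equivalence.to (meets⇔overlap β τ h x k eq eq′)) (Any.map⁻ p))
        (λ p → Any.map⁺ (Any.map (λ {(x , k)} → Equivalence.from (meets⇔overlap β τ h x k eq eq′)) p))

      bottom-eq : ∀ β x h → β ℤ.+ x ℤ.+ h ≡ β ℤ.+ (x ℤ.+ h)
      bottom-eq = solve-∀

      lower-eq : ∀ β t a → 1ℤ ℤ.+ (β ℤ.+ t ℤ.- (1ℤ ℤ.+ a) ℤ.+ a) ≡ β ℤ.+ t
      lower-eq = solve-∀

      upper-eq : ∀ β t a g b →
        1ℤ ℤ.+ (β ℤ.+ t ℤ.- (1ℤ ℤ.+ a) ℤ.+ (a ℤ.+ g ℤ.+ + 2 ℤ.+ b)) ≡ β ℤ.+ (t ℤ.+ g ℤ.+ b ℤ.+ + 2)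
      upper-eq = solve-∀

    supports⇔fits : ∀ p s → Supports {m} p (place p s) ⇔ Fits (proj₂ p) s
    supports⇔fits (β , c) (t , one a) = mk⇔
      (λ { (u ∷ []) → Equivalence.to lower-touches u ∷ [] })
      (λ { (u ∷ []) → Equivalence.from lower-touches u ∷ [] })
      where
      lower-touches = touches⇔ {β} c t a (lower-eq β (+ t) (+ a)) (bottom-eq (β ℤ.+ + t ℤ.- + suc a) (+ 0) (+ a))
    supports⇔fits (β , c) (t , two a g b) = mk⇔
      (λ { (u ∷ v ∷ []) → Equivalence.to lower-touches u ∷ Equivalence.to upper-touches v ∷ [] })
      (λ { (u ∷ v ∷ []) → Equivalence.from lower-touches u ∷ Equivalence.from upper-touches v ∷ [] })
      where
      lower-touches = touches⇔ {β} c t a (lower-eq β (+ t) (+ a)) (bottom-eq (β ℤ.+ + t ℤ.- + suc a) (+ 0) (+ a))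
      upper-touches = touches⇔ {β} c (t + toℕ g + b + 2) b (upper-eq β (+ t) (+ a) (+ toℕ g) (+ b))
        (bottom-eq (β ℤ.+ + t ℤ.- + suc a) (+ (a + toℕ g + 2)) (+ b))

    -- The lower component of `q` meets some run of `p`, so its top has height at least `β - 1`;
    -- hence its offset is a natural number.
    supports⇒place : ∀ p q → Supports {m} p q → ∃[ t ] q ≡ place p (t , proj₂ q)
    supports⇒place (β , c) (β′ , d) supp = t , cong (_, d) bottom
      where
      lower∈ : ∀ d → segment β′ (0 , lower d) ∈ runs (β′ , d)
      lower∈ (one _)     = here refl
      lower∈ (two _ _ _) = here refl

      β≤runs : ∀ {s} → s ∈ runs (β , c) → β ℤ.≤ bot s
      β≤runs s∈ with ∈-map⁻ (segment β) s∈
      ... | (x , k) , _ , refl = ℤ.i≤i+j β (+ x)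

      reachable : β ℤ.≤ β′ ℤ.+ + suc (lower d)
      reachable with find (All.lookup supp (lower∈ d))
      ... | s , s∈ , (s≤ , _) = linear 4 (λ β s β′ a → β ≼ s ∷ s ≼ con 1ℤ ⊕ (β′ ⊕ a) ∷ [] ⊢ β ≼ β′ ⊕ (con 1ℤ ⊕ a))
        (β ∷ bot s ∷ β′ ∷ + lower d ∷ []) (β≤runs s∈) s≤

      t : ℕ
      t = proj₁ (≤⇒∃+ reachable)

      bottom : β′ ≡ β ℤ.+ + t ℤ.- + suc (lower d)
      bottom = trans (lemma β′ (+ suc (lower d))) (cong (ℤ._- + suc (lower d)) (proj₂ (≤⇒∃+ reachable)))
        where
        lemma : ∀ x y → x ≡ x ℤ.+ y ℤ.- y
        lemma = solve-∀

    decode-linked : ∀ p ss → ValidSteps (proj₂ p) ss → Linked Supports (p ∷ decode p ss)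
    decode-linked p []       _       = [-]
    decode-linked p (s ∷ ss) (f , v) = Equivalence.from (supports⇔fits p s) f ∷ decode-linked (place p s) ss v

    encode : ∀ p ps → Linked Supports (p ∷ ps) → ∃[ ss ] ValidSteps (proj₂ p) ss × ps ≡ decode p ss
    encode p []       [-]        = [] , tt , refl
    encode p (q ∷ qs) (r ∷ link) with supports⇒place p q r | encode q qs link
    ... | t , eq | ss , v , eqs = (t , proj₂ q) ∷ ss ,
      (Equivalence.to (supports⇔fits p (t , proj₂ q)) (subst (Supports p) eq r) , v) ,
      cong₂ _∷_ eq (trans eqs (cong (λ q → decode q ss) eq))

    place-injective : ∀ p s s′ → place p s ≡ place p s′ → s ≡ s′
    place-injective (β , _) (t , d) (t′ , d′) eq with cong proj₂ eq
    ... | refl = cong (_, d) (ℤ.+-injective (+-cancelˡ-≡ β (+-cancelʳ-≡ (cong proj₁ eq))))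
      where
      +-cancelʳ-≡ : ∀ {i j} → i ℤ.- + suc (lower d) ≡ j ℤ.- + suc (lower d) → i ≡ j
      +-cancelʳ-≡ {i} {j} e = +-cancelˡ-≡ (ℤ.- + suc (lower d))
        (trans (ℤ.+-comm _ i) (trans e (ℤ.+-comm j _)))

    decode-injective : ∀ p ss ss′ → decode p ss ≡ decode p ss′ → ss ≡ ss′
    decode-injective p []       []         eq = refl
    decode-injective p (s ∷ ss) (s′ ∷ ss′) eq with ∷-injective eq
    ... | eq₁ , eq₂ with place-injective p s s′ eq₁
    ... | refl = cong (s ∷_) (decode-injective (place p s) ss ss′ eq₂)

    -- Translations

    shift : ℤ → Placed m → Placed m
    shift b (β , c) = β ℤ.+ b , c

    decode-shift : ∀ b p ss → map (shift b) (decode p ss) ≡ decode (shift b p) ss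
    decode-shift b p []       = refl
    decode-shift b p (s ∷ ss) = cong₂ _∷_ head (trans (decode-shift b (place p s) ss) (cong (λ q → decode q ss) head))
      where
      lemma : ∀ β t u b → β ℤ.+ t ℤ.- u ℤ.+ b ≡ β ℤ.+ b ℤ.+ t ℤ.- u
      lemma = solve-∀
      head : shift b (place p s) ≡ place (shift b p) s
      head = cong (_, _) (lemma (proj₁ p) (+ proj₁ s) (+ suc (lower (proj₂ s))) b)

    stack-translate : ∀ i p a b → stack (i ℤ.+ a) (shift b p) ≡ map (translate (a , b)) (stack i p)
    stack-translate i (β , c) a b = begin
      map (i ℤ.+ a ,_) (concatMap (elements (β ℤ.+ b)) (segments c))
        ≡⟨ cong (map (i ℤ.+ a ,_)) (concatMap-cong elements-shift (segments c)) ⟩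
      map (i ℤ.+ a ,_) (concatMap (map (ℤ._+ b) ∘ elements β) (segments c))
        ≡⟨ cong (map (i ℤ.+ a ,_)) (sym (map-concatMap (ℤ._+ b) (elements β) (segments c))) ⟩
      map (i ℤ.+ a ,_) (map (ℤ._+ b) (concatMap (elements β) (segments c)))
        ≡⟨ sym (map-∘ (concatMap (elements β) (segments c))) ⟩
      map (λ j → i ℤ.+ a , j ℤ.+ b) (concatMap (elements β) (segments c))
        ≡⟨ map-∘ (concatMap (elements β) (segments c)) ⟩
      map (translate (a , b)) (stack i (β , c)) ∎
      where
      open ≡-Reasoning
      lemma : ∀ β b x → β ℤ.+ b ℤ.+ x ≡ β ℤ.+ x ℤ.+ b
      lemma = solve-∀
      elements-shift : ∀ s → elements (β ℤ.+ b) s ≡ map (ℤ._+ b) (elements β s)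
      elements-shift (x , h) = trans (map-cong (λ k → lemma β b (+ (x + k))) (upTo (suc h))) (map-∘ (upTo (suc h)))

    cellsFrom-translate : ∀ i ps a b → cellsFrom (i ℤ.+ a) (map (shift b) ps) ≡ map (translate (a , b)) (cellsFrom i ps)
    cellsFrom-translate i []       a b = refl
    cellsFrom-translate i (p ∷ ps) a b = trans
      (cong₂ _++_ (stack-translate i p a b)
        (trans (cong (λ k → cellsFrom k (map (shift b) ps)) (sym (ℤ.+-assoc 1ℤ i a))) (cellsFrom-translate (ℤ.suc i) ps a b)))
      (sym (map-++ (translate (a , b)) (stack i p) (cellsFrom (ℤ.suc i) ps)))

    ∈-translate : ∀ i ps a b c →
      c ∈ cellsFrom i ps ⇔ translate (a , b) c ∈ cellsFrom (i ℤ.+ a) (map (shift b) ps)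
    ∈-translate i ps a b c = mk⇔
      (λ c∈ → subst (translate (a , b) c ∈_) (sym (cellsFrom-translate i ps a b)) (∈-map⁺ _ c∈))
      (λ c∈ → let d , d∈ , eq = ∈-map⁻ _ (subst (translate (a , b) c ∈_) (cellsFrom-translate i ps a b) c∈)
              in subst (_∈ cellsFrom i ps) (sym (translate-injective (a , b) eq)) d∈)

    -- The cells determine the columns

    private
      SameCells : ℤ → List (Placed m) → ℤ → List (Placed m) → Set
      SameCells i ps i′ qs = ∀ c → c ∈ cellsFrom i ps → c ∈ cellsFrom i′ qs

      head∈ : ∀ i p ps → ∃[ j ] (i , j) ∈ cellsFrom {m} i (p ∷ ps)
      head∈ i p ps = let j , j∈ = column-inhabited p in j , Equivalence.from (∈-cellsFrom i (p ∷ ps)) (p , here , j∈)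

      first-≤ : ∀ i i′ p ps qs → SameCells i (p ∷ ps) i′ qs → i′ ℤ.≤ i
      first-≤ i i′ p ps qs f with head∈ i p ps
      ... | j , c∈ = at-≥ (proj₁ (proj₂ (Equivalence.to (∈-cellsFrom i′ qs) (f _ c∈))))

      first-⊆ : ∀ i p q ps qs → SameCells i (p ∷ ps) i (q ∷ qs) → ∀ {j} → j ∈ᶜ p → j ∈ᶜ q
      first-⊆ i p q ps qs f {j} j∈
        with Equivalence.to (∈-cellsFrom i (q ∷ qs)) (f _ (Equivalence.from (∈-cellsFrom i (p ∷ ps)) (p , here , j∈)))
      ... | _ , at , j∈q = subst (j ∈ᶜ_) (at-functional at here) j∈q

      tail-⊆ : ∀ i p q ps qs → SameCells i (p ∷ ps) i (q ∷ qs) → SameCells (ℤ.suc i) ps (ℤ.suc i) qs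
      tail-⊆ i p q ps qs f c c∈ with ∈-++⁻ (stack i q) (f c (∈-++⁺ʳ (stack i p) c∈))
      ... | inj₂ c∈′ = c∈′
      ... | inj₁ c∈′ with Equivalence.to (∈-stack i q) c∈′
      ... | j , refl , _ = ⊥-elim (suc[i]≰i (at-≥ (proj₁ (proj₂ (Equivalence.to (∈-cellsFrom (ℤ.suc i) ps) c∈)))))

      columns-≡′ : ∀ i ps qs → SameCells i ps i qs → SameCells i qs i ps → ps ≡ qs
      columns-≡′ i []       []       f g = refl
      columns-≡′ i (p ∷ ps) []       f g with head∈ i p ps
      ... | j , c∈ with f _ c∈
      ... | ()
      columns-≡′ i []       (q ∷ qs) f g with head∈ i q qs
      ... | j , c∈ with g _ c∈
      ... | ()
      columns-≡′ i (p ∷ ps) (q ∷ qs) f g = cong₂ _∷_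
        (placed-≡ p q λ j → mk⇔ (first-⊆ i p q ps qs f) (first-⊆ i q p qs ps g))
        (columns-≡′ (ℤ.suc i) ps qs (tail-⊆ i p q ps qs f) (tail-⊆ i q p qs ps g))

    -- Columns are nonempty, so the cells determine the leftmost stack; `placed-≡` then settles the
    -- stacks one by one.
    columns-≡ : ∀ {i i′ p q ps qs} → (∀ c → c ∈ cellsFrom i (p ∷ ps) ⇔ c ∈ cellsFrom i′ (q ∷ qs)) →
      i ≡ i′ × p ∷ ps ≡ q ∷ qs
    columns-≡ {i} {i′} {p} {q} {ps} {qs} e = i≡i′ , go i≡i′
      where
      f : SameCells i (p ∷ ps) i′ (q ∷ qs)
      f c = Equivalence.to (e c)
      g : SameCells i′ (q ∷ qs) i (p ∷ ps)
      g c = Equivalence.from (e c)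
      i≡i′ : i ≡ i′
      i≡i′ = ℤ.≤-antisym (first-≤ i′ i q qs (p ∷ ps) g) (first-≤ i i′ p ps (q ∷ qs) f)
      go : i ≡ i′ → p ∷ ps ≡ q ∷ qs
      go refl = columns-≡′ i _ _ f g

  -- Reading the columns off a cheesy polyomino

  maximum : ∀ {A : Set} (f : A → ℤ) {x} (xs : List A) → x ∈ xs → ∃[ y ] y ∈ xs × (∀ z → z ∈ xs → f z ℤ.≤ f y)
  maximum f (x ∷ []) _ = x , here refl , λ { z (here refl) → ℤ.≤-refl }
  maximum f (x ∷ xs@(_ ∷ _)) _ with maximum f xs (here refl)
  ... | y , y∈ , max with ℤ.≤-total (f x) (f y)
  ...   | inj₁ x≤y = y , there y∈ , λ { z (here refl) → x≤y ; z (there z∈) → max z z∈ }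
  ...   | inj₂ y≤x = x , here refl , λ { z (here refl) → ℤ.≤-refl ; z (there z∈) → ℤ.≤-trans (max z z∈) y≤x }

  module _ {S : ℤ → Set} (S? : Decidable S) where

    -- The search climbs one position at a time, and `n` bounds the number of positions still ahead.
    extend-top : ∀ n j → S j → (∀ k → S k → k ℤ.≤ j ℤ.+ + n) →
      ∃[ t ] j ℤ.≤ t × (∀ k → j ℤ.≤ k → k ℤ.≤ t → S k) × ¬ S (ℤ.suc t)
    extend-top n j s bound with S? (ℤ.suc j)
    ... | no ¬s = j , ℤ.≤-refl , (λ k j≤k k≤j → subst S (ℤ.≤-antisym j≤k k≤j) s) , ¬s
    extend-top zero j s bound | yes s′ = ⊥-elim (suc[i]≰i (subst (ℤ.suc j ℤ.≤_) (ℤ.+-identityʳ j) (bound _ s′)))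
    extend-top (suc n) j s bound | yes s′
      with extend-top n (ℤ.suc j) s′ (λ k sk → linear 3 (λ k j n → k ≼ j ⊕ (con 1ℤ ⊕ n) ∷ [] ⊢ k ≼ con 1ℤ ⊕ j ⊕ n) (k ∷ j ∷ + n ∷ []) (bound k sk))
    ... | t , j≤t , all , ¬s = t , ℤ.≤-trans (ℤ.i≤suc[i] j) j≤t , all′ , ¬s
      where
      all′ : ∀ k → j ℤ.≤ k → k ℤ.≤ t → S k
      all′ k j≤k k≤t with j ℤ.≟ k
      ... | yes refl = s
      ... | no j≢k   = all k (ℤ.i<j⇒suc[i]≤j (ℤ.≤∧≢⇒< j≤k j≢k)) k≤t

    extend-bot : ∀ n j → S j → (∀ k → S k → j ℤ.≤ k ℤ.+ + n) →
      ∃[ b ] b ℤ.≤ j × (∀ k → b ℤ.≤ k → k ℤ.≤ j → S k) × ¬ S (ℤ.pred b)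
    extend-bot n j s bound with S? (ℤ.pred j)
    ... | no ¬s = j , ℤ.≤-refl , (λ k j≤k k≤j → subst S (ℤ.≤-antisym j≤k k≤j) s) , ¬s
    extend-bot zero j s bound | yes s′ = ⊥-elim (suc[i]≰i
      (linear 1 (λ j → j ≼ con -1ℤ ⊕ j ⊕ con 0ℤ ∷ [] ⊢ con 1ℤ ⊕ j ≼ j) (j ∷ []) (bound _ s′)))
    extend-bot (suc n) j s bound | yes s′
      with extend-bot n (ℤ.pred j) s′ (λ k sk → linear 3 (λ k j n → j ≼ k ⊕ (con 1ℤ ⊕ n) ∷ [] ⊢ con -1ℤ ⊕ j ≼ k ⊕ n) (k ∷ j ∷ + n ∷ []) (bound k sk))
    ... | b , b≤j , all , ¬s = b , ℤ.≤-trans b≤j (linear 1 (λ j → [] ⊢ con -1ℤ ⊕ j ≼ j) (j ∷ [])) , all′ , ¬s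
      where
      all′ : ∀ k → b ℤ.≤ k → k ℤ.≤ j → S k
      all′ k b≤k k≤j with j ℤ.≟ k
      ... | yes refl = s
      ... | no j≢k   = all k b≤k
        (linear 2 (λ k j → con 1ℤ ⊕ k ≼ j ∷ [] ⊢ k ≼ con -1ℤ ⊕ j) (k ∷ j ∷ []) (ℤ.i<j⇒suc[i]≤j (ℤ.≤∧≢⇒< k≤j (j≢k ∘ sym))))

    maximal-run : ∀ {lo hi} → (∀ k → S k → lo ℤ.≤ k × k ℤ.≤ hi) → ∀ j → S j → ∃[ r ] Maximal S r × j ∈ʳ r
    maximal-run {lo} {hi} bound j s with ≤⇒∃+ (proj₁ (bound j s)) | ≤⇒∃+ (proj₂ (bound j s))
    ... | m , refl | n , refl with extend-top n j s (λ k sk → proj₂ (bound k sk))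
       | extend-bot m j s (λ k sk → ℤ.+-monoˡ-≤ (+ m) (proj₁ (bound k sk)))
    ... | t , j≤t , above , ¬t | b , b≤j , below , ¬b = run b t , record
      { nonempty-run = ℤ.≤-trans b≤j j≤t
      ; contained    = λ k (b≤k , k≤t) → between k b≤k k≤t
      ; maximal-bot  = ¬b
      ; maximal-top  = ¬t
      } , b≤j , j≤t
      where
      between : ∀ k → b ℤ.≤ k → k ℤ.≤ t → S k
      between k b≤k k≤t with ℤ.≤-total k j
      ... | inj₁ k≤j = below k b≤k k≤j
      ... | inj₂ j≤k = above k j≤k k≤t

  maximal-gap : ∀ {S r s} → Maximal S r → Maximal S s → r ≢ s → bot r ℤ.≤ bot s → ℤ.suc (ℤ.suc (top r)) ℤ.≤ bot s
  maximal-gap {r = r} {s} mr ms r≢s r≤s = ℤ.i<j⇒suc[i]≤j (ℤ.≤∧≢⇒< (ℤ.i<j⇒suc[i]≤j (ℤ.≰⇒> beyond))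
    λ eq → Maximal.maximal-top mr (subst _ (sym eq) (Maximal.contained ms (bot s) (bot∈ʳ (Maximal.nonempty-run ms)))))
    where
    beyond : ¬ (bot s ℤ.≤ top r)
    beyond s≤r = r≢s (maximal-≡ mr ms (r≤s , s≤r) (bot∈ʳ (Maximal.nonempty-run ms)))

  module _ {m} (P : Polyomino) (cheesy : IsCheesy m P) where
    open IsCheesy cheesy
    open IsRightwardSemiDirected semi-directed
    open DecMembership using (_∈?_)

    isColumn? : ∀ i → Dec (IsColumn P i)
    isColumn? i with Any.any? (λ c → proj₁ c ℤ.≟ i) (cells P)
    ... | yes c with find c
    ...   | (_ , j) , c∈ , refl = yes (j , c∈)
    isColumn? i | no ¬c = no λ (j , c∈) → ¬c (lose c∈ refl)

    private
      bounds : ∃[ lo ] ∃[ hi ] ∀ {i} k → (i , k) ∈ cells P → lo ℤ.≤ k × k ℤ.≤ hi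
      bounds with maximum proj₂ (cells P) (proj₂ (nonempty P)) | maximum (ℤ.-_ ∘ proj₂) (cells P) (proj₂ (nonempty P))
      ... | (_ , hi) , _ , ≤hi | (_ , lo) , _ , lo≤ = lo , hi , λ k c∈ → ℤ.neg-cancel-≤ (lo≤ _ c∈) , ≤hi _ c∈

    component : ∀ {i} j → (i , j) ∈ cells P → ∃[ r ] IsComponent P i r × j ∈ʳ r
    component {i} j c∈ with maximal-run (λ k → (i , k) ∈? cells P) (proj₂ (proj₂ bounds)) j c∈
    ... | r , mr , j∈ = r , record { Maximal mr } , j∈

    private
      maximal : ∀ {i r} → IsComponent P i r → Maximal (λ j → (i , j) ∈ cells P) r
      maximal c = record { IsComponent c }

      describe-one : ∀ {i r} → IsComponent P i r → (∀ j → (i , j) ∈ cells P → j ∈ʳ r) → ∃[ p ] Describes {m} P i p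
      describe-one {i} {r} rc all with ≤⇒∃+ (IsComponent.nonempty-run rc)
      ... | a , top≡ = (bot r , one a) , λ j → mk⇔
        (λ c∈ → here (subst (j ∈ʳ_) r≡ (all j c∈)))
        (λ { (here j∈) → IsComponent.contained rc j (subst (j ∈ʳ_) (sym r≡) j∈) ; (there ()) })
        where
        r≡ : r ≡ segment (bot r) (0 , a)
        r≡ = cong₂ run (sym (ℤ.+-identityʳ (bot r))) top≡

      describe-two : ∀ {i r s} → IsComponent P i r → IsComponent P i s → r ≢ s → bot r ℤ.≤ bot s →
        (∀ j → (i , j) ∈ cells P → j ∈ʳ r ⊎ j ∈ʳ s) → ∃[ p ] Describes {m} P i p
      describe-two {i} {r} {s} rc sc r≢s r≤s all
        with ≤⇒∃+ (IsComponent.nonempty-run rc) | ≤⇒∃+ (IsComponent.nonempty-run sc)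
           | ≤⇒∃+ (maximal-gap (maximal rc) (maximal sc) r≢s r≤s)
      ... | a , r-top | b , s-top | g , s-bot = (bot r , two a (fromℕ< g<m) b) , λ j → mk⇔
        (λ c∈ → to j (all j c∈))
        (λ { (here j∈)         → IsComponent.contained rc j (subst (j ∈ʳ_) (sym r≡) j∈)
           ; (there (here j∈)) → IsComponent.contained sc j (subst (j ∈ʳ_) (sym s≡) j∈) })
        where
        r<s : top r ℤ.< bot s
        r<s = ℤ.suc[i]≤j⇒i<j (ℤ.≤-trans (ℤ.i≤suc[i] _) (maximal-gap (maximal rc) (maximal sc) r≢s r≤s))

        g<m : g ℕ.< m
        g<m = ℤ.drop‿+≤+ (linear 4
          (λ g m t b → b ⊖ (con 1ℤ ⊕ t) ≼ m ∷ con 1ℤ ⊕ (con 1ℤ ⊕ t) ⊕ g ≼ b ∷ [] ⊢ con 1ℤ ⊕ g ≼ m)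
          (+ g ∷ + m ∷ top r ∷ bot s ∷ []) (small-gaps i r s rc sc r<s) (ℤ.≤-reflexive (sym s-bot)))

        r≡ : r ≡ segment (bot r) (0 , a)
        r≡ = cong₂ run (sym (ℤ.+-identityʳ (bot r))) r-top

        upper-bottom : bot s ≡ bot r ℤ.+ + (a + toℕ (fromℕ< g<m) + 2)
        upper-bottom rewrite toℕ-fromℕ< g<m = trans s-bot
          (trans (cong (λ t → ℤ.suc (ℤ.suc t) ℤ.+ + g) r-top) (lemma (bot r) (+ a) (+ g)))
          where
          lemma : ∀ β a g → 1ℤ ℤ.+ (1ℤ ℤ.+ (β ℤ.+ a)) ℤ.+ g ≡ β ℤ.+ (a ℤ.+ g ℤ.+ + 2)
          lemma = solve-∀

        s≡ : s ≡ segment (bot r) (a + toℕ (fromℕ< g<m) + 2 , b)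
        s≡ = cong₂ run upper-bottom
          (trans s-top (trans (cong (ℤ._+ + b) upper-bottom) (ℤ.+-assoc (bot r) _ (+ b))))

        to : ∀ j → j ∈ʳ r ⊎ j ∈ʳ s → j ∈ᶜ (bot r , two a (fromℕ< g<m) b)
        to j (inj₁ j∈) = here (subst (j ∈ʳ_) r≡ j∈)
        to j (inj₂ j∈) = there (here (subst (j ∈ʳ_) s≡ j∈))

      inside : ∀ {i r s} → IsComponent P i r → IsComponent P i s → r ≢ s →
        ∀ j → (i , j) ∈ cells P → j ∈ʳ r ⊎ j ∈ʳ s
      inside {i} {r} {s} rc sc r≢s j c∈ with component j c∈
      ... | t , tc , j∈t with two-components i r s t rc sc tc
      ... | inj₁ r≡s         = ⊥-elim (r≢s r≡s)
      ... | inj₂ (inj₁ refl) = inj₁ j∈t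
      ... | inj₂ (inj₂ refl) = inj₂ j∈t

    describe : ∀ {i} → IsColumn P i → ∃[ p ] Describes {m} P i p
    describe {i} (j , c∈) with component j c∈
    -- A cell of this stack outside `r` yields a second component, after which `two-components`
    -- excludes a third.
    ... | r , rc , _ with Any.any? (λ c → proj₁ c ℤ.≟ i ×-dec ¬? (bot r ℤ.≤? proj₂ c ×-dec proj₂ c ℤ.≤? top r)) (cells P)
    ...   | no ¬outside = describe-one rc λ k k∈ → case-inside k k∈
      where
      case-inside : ∀ k → (i , k) ∈ cells P → k ∈ʳ r
      case-inside k k∈ with bot r ℤ.≤? k ×-dec k ℤ.≤? top r
      ... | yes k∈r = k∈r
      ... | no k∉r  = ⊥-elim (¬outside (lose k∈ (refl , k∉r)))
    ...   | yes outside with find outside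
    ...     | (_ , k) , k∈ , refl , k∉r with component k k∈
    ...       | s , sc , k∈s with ℤ.≤-total (bot r) (bot s)
    ...         | inj₁ r≤s = describe-two rc sc (λ { refl → k∉r k∈s }) r≤s (inside rc sc λ { refl → k∉r k∈s })
    ...         | inj₂ s≤r = describe-two sc rc (λ { refl → k∉r k∈s }) s≤r (inside sc rc λ { refl → k∉r k∈s })

    -- An edge raises the stack number by at most one, so a path cannot jump over the stack `i + 1`.
    crossing : ∀ i {c d} → Star (λ x y → x ∈ cells P × y ∈ cells P × ShareEdge x y) c d →
      proj₁ c ℤ.≤ i → i ℤ.< proj₁ d → IsColumn P (ℤ.suc i)
    crossing i ε c≤i i<d = ⊥-elim (ℤ.<-irrefl refl (ℤ.<-≤-trans i<d c≤i))
    crossing i (_◅_ {j = i′ , _} (_ , y∈ , edge) path) c≤i i<d with i′ ℤ.≤? i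
    ... | yes y≤i = crossing i path y≤i i<d
    ... | no  y≰i = _ , subst (λ k → (k , _) ∈ cells P)
      (ℤ.≤-antisym (ℤ.≤-trans (shareEdge-stack edge) (ℤ.suc-mono c≤i)) (ℤ.i<j⇒suc[i]≤j (ℤ.≰⇒> y≰i))) y∈

    describes-supports : ∀ {i} p q → Describes P i p → Describes P (ℤ.suc i) q → IsColumn P i → IsColumn P (ℤ.suc i) →
      Supports {m} p q
    describes-supports {i} p q dp dq ci cq = All.tabulate touches
      where
      touches : ∀ {r} → r ∈ runs q → Touches p r
      touches {r} r∈
        with supported i (ℤ.suc i) (ci , cq , ℤ.suc[i]≤j⇒i<j ℤ.≤-refl , λ k _ (i<k , k<i+1) →
               ℤ.<-irrefl refl (ℤ.<-≤-trans k<i+1 (ℤ.i<j⇒suc[i]≤j i<k))) r (runs⇒component q dq r∈)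
      ... | j , k , j∈r , k∈ , edge with ∈ᶜ-run p (Equivalence.to (dp k) k∈)
      ... | s , s∈ , k∈s = lose s∈ (shareEdge⇒meets j∈r k∈s edge)

    -- Columns are read off until a stack is empty; by `crossing`, connectedness then excludes cells
    -- farther right. The number `n` bounds the stacks that remain.
    columns-from : ∀ n i p → IsColumn P i → Describes P i p → (∀ k → IsColumn P k → k ℤ.≤ i ℤ.+ + n) →
      ∃[ ps ] Linked Supports (p ∷ ps) ×
        (∀ k j → i ℤ.≤ k → (k , j) ∈ cells P ⇔ (∃[ q ] At i (p ∷ ps) k q × j ∈ᶜ q))
    columns-from n i p ci dp bound with isColumn? (ℤ.suc i)
    ... | no ¬c = [] , [-] , λ k j i≤k → mk⇔ (to k j i≤k) λ { (_ , here , j∈) → Equivalence.from (dp j) j∈ }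
      where
      to : ∀ k j → i ℤ.≤ k → (k , j) ∈ cells P → ∃[ q ] At i (p ∷ []) k q × j ∈ᶜ q
      to k j i≤k c∈ with i ℤ.≟ k
      ... | yes refl = p , here , Equivalence.to (dp j) c∈
      ... | no i≢k   = ⊥-elim (¬c (crossing i (connected P (proj₂ ci) c∈) ℤ.≤-refl (ℤ.≤∧≢⇒< i≤k i≢k)))
    columns-from zero i p ci dp bound | yes c =
      ⊥-elim (suc[i]≰i (subst (ℤ.suc i ℤ.≤_) (ℤ.+-identityʳ i) (bound _ c)))
    columns-from (suc n) i p ci dp bound | yes c with describe c
    ... | q , dq with columns-from n (ℤ.suc i) q c dq
            (λ k ck → linear 3 (λ k i n → k ≼ i ⊕ (con 1ℤ ⊕ n) ∷ [] ⊢ k ≼ con 1ℤ ⊕ i ⊕ n) (k ∷ i ∷ + n ∷ []) (bound k ck))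
    ... | qs , linked , e = q ∷ qs , describes-supports p q dp dq ci c ∷ linked , λ k j i≤k → mk⇔ (to k j i≤k) (from k j)
      where
      to : ∀ k j → i ℤ.≤ k → (k , j) ∈ cells P → ∃[ q′ ] At i (p ∷ q ∷ qs) k q′ × j ∈ᶜ q′
      to k j i≤k c∈ with i ℤ.≟ k
      ... | yes refl = p , here , Equivalence.to (dp j) c∈
      ... | no i≢k with Equivalence.to (e k j (ℤ.i<j⇒suc[i]≤j (ℤ.≤∧≢⇒< i≤k i≢k))) c∈
      ...   | q′ , at , j∈ = q′ , there at , j∈
      from : ∀ k j → ∃[ q′ ] At i (p ∷ q ∷ qs) k q′ × j ∈ᶜ q′ → (k , j) ∈ cells P
      from k j (_ , here , j∈)     = Equivalence.from (dp j) j∈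
      from k j (q′ , there at , j∈) = Equivalence.from (e k j (at-≥ at)) (q′ , at , j∈)

    cheesy-columns : ∃[ i ] ∃[ β ] ∃[ a ] ∃[ ps ] Linked Supports ((β , one {m} a) ∷ ps) ×
      (∀ c → c ∈ cells P ⇔ c ∈ cellsFrom i ((β , one a) ∷ ps))
    cheesy-columns with maximum (ℤ.-_ ∘ proj₁) (cells P) (proj₂ (nonempty P)) | maximum proj₁ (cells P) (proj₂ (nonempty P))
    ... | (i , j) , c∈ , least | (k , l) , _ , greatest with describe (j , c∈)
    ... | p , dp with ≤⇒∃+ (greatest _ c∈)
    ... | n , refl with columns-from n i p (j , c∈) dp (λ k (_ , k∈) → greatest _ k∈)
    ... | ps , linked , e = i , result p dp linked e
      where
      leftmost : ∀ {k j} → (k , j) ∈ cells P → i ℤ.≤ k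
      leftmost k∈ = ℤ.neg-cancel-≤ (least _ k∈)
      result : ∀ p → Describes P i p → Linked Supports (p ∷ ps) →
        (∀ k j → i ℤ.≤ k → (k , j) ∈ cells P ⇔ (∃[ q ] At i (p ∷ ps) k q × j ∈ᶜ q)) →
        ∃[ β ] ∃[ a ] ∃[ ps ] Linked Supports ((β , one {m} a) ∷ ps) × (∀ c → c ∈ cells P ⇔ c ∈ cellsFrom i ((β , one a) ∷ ps))
      -- The stack `i` is leftmost, so two runs here contradict `first-column`.
      result p@(β , two a g b) dp _ _ = ⊥-elim (upper≢lower β a g b
        (first-column i ((j , c∈) , λ k (_ , k∈) → leftmost k∈) _ _
          (runs⇒component p dp (there (here refl))) (runs⇒component p dp (here refl))))
      result p@(β , one a) dp linked e = β , a , ps , linked , λ (k , l) → mk⇔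
        (λ k∈ → Equivalence.from (∈-cellsFrom i (p ∷ ps)) (Equivalence.to (e k l (leftmost k∈)) k∈))
        (λ k∈ → let q , at , l∈ = Equivalence.to (∈-cellsFrom i (p ∷ ps)) k∈
                in Equivalence.from (e k l (at-≥ at)) (q , at , l∈))

  -- Codes and their bijection with translation classes

  size : ∀ {m} → Column m → ℕ
  size (one a)     = suc a
  size (two a _ b) = suc a + suc b

  steps-size : ∀ {m} → List (Step {m}) → ℕ
  steps-size []             = 0
  steps-size ((_ , d) ∷ ss) = size d + steps-size ss

  Code : ℕ → Set
  Code m = ℕ × List (Step {m})

  ValidCode : ∀ {m} → Code m → Set
  ValidCode (a , ss) = ValidSteps (one a) ss

  code-size : ∀ {m} → Code m → ℕ
  code-size (a , ss) = suc a + steps-size ss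

  columnsAt : ∀ {m} → ℤ → Code m → List (Placed m)
  columnsAt β (a , ss) = (β , one a) ∷ decode (β , one a) ss

  fromCode : ∀ {m} (c : Code m) → ValidCode c → Polyomino
  fromCode (a , ss) v = toPolyomino 0ℤ a (decode (0ℤ , one a) ss) (decode-linked (0ℤ , one a) ss v)

  fromCode-cheesy : ∀ {m} (c : Code m) (v : ValidCode c) → IsCheesy m (fromCode c v)
  fromCode-cheesy (a , ss) v = toPolyomino-cheesy 0ℤ a (decode (0ℤ , one a) ss) (decode-linked (0ℤ , one a) ss v)

  length-stack : ∀ {m} i (p : Placed m) → length (stack i p) ≡ size (proj₂ p)
  length-stack i (β , c) = trans (length-map (i ,_) (concatMap (elements β) (segments c))) (go c)
    where
    length-elements : ∀ s → length (elements β s) ≡ suc (proj₂ s)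
    length-elements (x , h) = trans (length-map _ (upTo (suc h))) (length-upTo (suc h))
    go : ∀ c → length (concatMap (elements β) (segments c)) ≡ size c
    go (one a) = trans (length-++ (elements β (0 , a))) (trans (ℕ.+-identityʳ _) (length-elements (0 , a)))
    go (two a g b) = trans (length-++ (elements β (0 , a)))
      (cong₂ _+_ (length-elements (0 , a))
        (trans (length-++ (elements β (a + toℕ g + 2 , b))) (trans (ℕ.+-identityʳ _) (length-elements (a + toℕ g + 2 , b)))))

  length-cells : ∀ {m} i (p : Placed m) ss → length (cellsFrom i (p ∷ decode p ss)) ≡ size (proj₂ p) + steps-size ss
  length-cells i p ss = trans (length-++ (stack i p)) (cong₂ _+_ (length-stack i p) (go ss))
    where
    go : ∀ ss → length (cellsFrom (ℤ.suc i) (decode p ss)) ≡ steps-size ss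
    go []       = refl
    go (s ∷ ss) = length-cells (ℤ.suc i) (place p s) ss

  fromCode-area : ∀ {m} (c : Code m) (v : ValidCode c) → area (fromCode c v) ≡ code-size c
  fromCode-area (a , ss) v = length-cells 0ℤ (0ℤ , one a) ss

  columnsAt-shift : ∀ {m} β (c : Code m) → map (shift β) (columnsAt 0ℤ c) ≡ columnsAt β c
  columnsAt-shift β (a , ss) = cong₂ _∷_ head
    (trans (decode-shift β (0ℤ , one a) ss) (cong (λ p → decode p ss) head))
    where
    head : shift β (0ℤ , one a) ≡ (β , one a)
    head = cong (_, one a) (ℤ.+-identityˡ β)

  ∈-code-translate : ∀ {m} i β (c : Code m) d →
    d ∈ cellsFrom 0ℤ (columnsAt 0ℤ c) ⇔ translate (i , β) d ∈ cellsFrom i (columnsAt β c)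
  ∈-code-translate i β c d = mk⇔ (subst₂-∈ eq₁ eq₂ ∘ Equivalence.to e) (Equivalence.from e ∘ subst₂-∈ (sym eq₁) (sym eq₂))
    where
    e  = ∈-translate 0ℤ (columnsAt 0ℤ c) i β d
    eq₁ : 0ℤ ℤ.+ i ≡ i
    eq₁ = ℤ.+-identityˡ i
    eq₂ : map (shift β) (columnsAt 0ℤ c) ≡ columnsAt β c
    eq₂ = columnsAt-shift β c
    subst₂-∈ : ∀ {k k′ ps ps′ d} → k ≡ k′ → ps ≡ ps′ → d ∈ cellsFrom k ps → d ∈ cellsFrom k′ ps′
    subst₂-∈ refl refl d∈ = d∈

  columnsAt-injective : ∀ {m} β β′ (c c′ : Code m) → columnsAt β c ≡ columnsAt β′ c′ → c ≡ c′
  columnsAt-injective β β′ (a , ss) (a′ , ss′) eq with ∷-injective eq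
  ... | refl , eq′ = cong (a ,_) (decode-injective (β , one a) ss ss′ eq′)

  -- Translating the polyomino of `c` gives the columns of the same code at another base. Cells
  -- determine columns, and columns determine the code whatever the base.
  fromCode-injective : ∀ {m} (c c′ : Code m) v v′ → fromCode c v ≈ fromCode c′ v′ → c ≡ c′
  fromCode-injective c c′ v v′ ((i , β) , e) =
    columnsAt-injective β 0ℤ c c′ (proj₂ (columns-≡ λ d → mk⇔ (to d) (from d)))
    where
    to : ∀ d → d ∈ cellsFrom i (columnsAt β c) → d ∈ cellsFrom 0ℤ (columnsAt 0ℤ c′)
    to d d∈ = subst (_∈ cellsFrom 0ℤ (columnsAt 0ℤ c′)) (translate-untranslate (i , β) d)
      (Equivalence.to (e (untranslate (i , β) d)) (Equivalence.from (∈-code-translate i β c (untranslate (i , β) d))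
        (subst (_∈ cellsFrom i (columnsAt β c)) (sym (translate-untranslate (i , β) d)) d∈)))

    from : ∀ d → d ∈ cellsFrom 0ℤ (columnsAt 0ℤ c′) → d ∈ cellsFrom i (columnsAt β c)
    from d d∈ = subst (_∈ cellsFrom i (columnsAt β c)) (translate-untranslate (i , β) d)
      (Equivalence.to (∈-code-translate i β c (untranslate (i , β) d)) (Equivalence.from (e (untranslate (i , β) d))
        (subst (_∈ cellsFrom 0ℤ (columnsAt 0ℤ c′)) (sym (translate-untranslate (i , β) d)) d∈)))

  fromCode-surjective : ∀ {m} P → IsCheesy m P → ∃[ c ] ∃[ v ] fromCode {m} c v ≈ P
  fromCode-surjective {m} P cheesy =
    let i , β , a , ps , linked , e = cheesy-columns P cheesy
        ss , v , eq = encode (β , one a) ps linked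
    in (a , ss) , v , (i , β) , λ d → mk⇔
         (λ d∈ → Equivalence.from (e _) (subst (λ ps → translate (i , β) d ∈ cellsFrom i ((β , one a) ∷ ps)) (sym eq)
           (Equivalence.to (∈-code-translate i β (a , ss) d) d∈)))
         (λ d∈ → Equivalence.from (∈-code-translate i β (a , ss) d)
           (subst (λ ps → translate (i , β) d ∈ cellsFrom i ((β , one a) ∷ ps)) eq (Equivalence.to (e _) d∈)))

  -- After translation both lists have the same elements without repetition, so one is a permutation
  -- of the other.
  ≈⇒area-≡ : ∀ P Q → P ≈ Q → area P ≡ area Q
  ≈⇒area-≡ P Q (t , e) = trans (sym (length-map (translate t) (cells P)))
    (↭-length (∼bag⇒↭ (unique∧set⇒bag
      (Unique.map⁺ (translate-injective t) (unique P)) (unique Q) (λ {d} → mk⇔ (to d) (from d)))))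
    where
    to : ∀ d → d ∈ map (translate t) (cells P) → d ∈ cells Q
    to d d∈ with ∈-map⁻ (translate t) d∈
    ... | c , c∈ , refl = Equivalence.to (e c) c∈

    from : ∀ d → d ∈ cells Q → d ∈ map (translate t) (cells P)
    from d d∈ = subst (_∈ map (translate t) (cells P)) (translate-untranslate t d)
      (∈-map⁺ (translate t) (Equivalence.from (e (untranslate t d)) (subst (_∈ cells Q) (sym (translate-untranslate t d)) d∈)))

  lookup-injective : ∀ {A : Set} {xs : List A} → Unique xs → ∀ {i j} → lookup xs i ≡ lookup xs j → i ≡ j
  lookup-injective (_ ∷ _)  {zero}  {zero}  _  = refl
  lookup-injective {xs = x ∷ xs} (x∉ ∷ _)  {zero}  {suc j} eq = ⊥-elim (All.lookup x∉ (∈-lookup j) eq)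
  lookup-injective {xs = x ∷ xs} (x∉ ∷ _)  {suc i} {zero}  eq = ⊥-elim (All.lookup x∉ (∈-lookup i) (sym eq))
  lookup-injective (_ ∷ un) {suc i} {suc j} eq = cong suc (lookup-injective un eq)

  cheesy-bijection : ∀ {m n} (cs : List (Code m)) → Unique cs →
    (∀ c → c ∈ cs ⇔ (ValidCode c × code-size c ≡ n)) →
    Bijection (setoid (Fin (length cs))) (CheesyPolyominoes m n)
  cheesy-bijection {m} {n} cs un e = record
    { to        = λ i → to (lookup cs i) (∈-lookup i)
    ; cong      = λ eq → Setoid.reflexive (CheesyPolyominoes m n) (cong (λ i → to (lookup cs i) (∈-lookup i)) eq)
    ; bijective = (λ {i} {j} eq → lookup-injective un (fromCode-injective (lookup cs i) (lookup cs j) (valid (∈-lookup i)) (valid (∈-lookup j)) eq)) ,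
                  λ (P , cheesy , area≡n) → surjective P cheesy area≡n
    }
    where
    Target : Set
    Target = Setoid.Carrier (CheesyPolyominoes m n)

    valid : ∀ {c} → c ∈ cs → ValidCode c
    valid c∈ = proj₁ (Equivalence.to (e _) c∈)

    to : ∀ c → c ∈ cs → Target
    to c c∈ = fromCode c (valid c∈) , fromCode-cheesy c (valid c∈) ,
      trans (fromCode-area c (valid c∈)) (proj₂ (Equivalence.to (e c) c∈))

    surjective : ∀ P → IsCheesy m P → area P ≡ n →
      ∃[ i ] (∀ {j} → j ≡ i → proj₁ (to (lookup cs j) (∈-lookup j)) ≈ P)
    surjective P cheesy area≡n =
      let c , v , c≈P = fromCode-surjective P cheesy
          c∈ = Equivalence.from (e c) (v , trans (sym (fromCode-area c v)) (trans (≈⇒area-≡ (fromCode c v) P c≈P) area≡n))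
      in Any.index c∈ , λ { refl → transport (Any.lookup-index c∈) v c≈P (∈-lookup (Any.index c∈)) }
      where
      -- The cells of `fromCode c v` are the same for every proof `v`, so the two validity proofs
      -- are interchangeable here.
      transport : ∀ {c d} → c ≡ d → ∀ v → fromCode c v ≈ P → (d∈ : d ∈ cs) → proj₁ (to d d∈) ≈ P
      transport refl v c≈P d∈ = c≈P

  -- Listing the codes of a given size without repetition

  module _ {X : Set} where

    -- If `G a` enumerates by size, then `weighted G` enumerates the members of
    -- all the families `G a`, the size of those of `G a` being increased by a + 1.
    weighted : (ℕ → ℕ → List X) → ℕ → List X
    weighted G zero    = []
    weighted G (suc n) = G 0 n ++ weighted (G ∘ suc) n

    ∈-weighted⁺ : ∀ G a k {x} → x ∈ G a k → x ∈ weighted G (suc a + k)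
    ∈-weighted⁺ G zero    k x∈ = ∈-++⁺ˡ x∈
    ∈-weighted⁺ G (suc a) k x∈ = ∈-++⁺ʳ (G 0 (suc a + k)) (∈-weighted⁺ (G ∘ suc) a k x∈)

    ∈-weighted⁻ : ∀ G n {x} → x ∈ weighted G n → ∃[ a ] ∃[ k ] suc a + k ≡ n × x ∈ G a k
    ∈-weighted⁻ G (suc n) x∈ with ∈-++⁻ (G 0 n) x∈
    ... | inj₁ x∈G = 0 , n , refl , x∈G
    ... | inj₂ x∈W with ∈-weighted⁻ (G ∘ suc) n x∈W
    ... | a , k , refl , x∈G = suc a , k , refl , x∈G

    unique-weighted : ∀ G → (∀ a k → Unique (G a k)) →
      (∀ {a a′ k k′ x} → x ∈ G a k → x ∈ G a′ k′ → a ≡ a′) → ∀ n → Unique (weighted G n)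
    unique-weighted G uniq index zero    = []
    unique-weighted G uniq index (suc n) = Unique.++⁺ (uniq 0 n)
      (unique-weighted (G ∘ suc) (uniq ∘ suc) (λ x∈ x∈′ → ℕ.suc-injective (index x∈ x∈′)) n)
      λ (x∈ , x∈′) → disjoint x∈ (∈-weighted⁻ (G ∘ suc) n x∈′)
      where
      disjoint : ∀ {x} → x ∈ G 0 n → (∃[ a ] ∃[ k ] suc a + k ≡ n × x ∈ G (suc a) k) → ⊥
      disjoint x∈ (_ , _ , _ , x∈′) with index x∈ x∈′
      ... | ()

  unique-concatMap : ∀ {X Y : Set} (f : X → List Y) → (∀ x → Unique (f x)) →
    (∀ {x x′ y} → y ∈ f x → y ∈ f x′ → x ≡ x′) → ∀ {xs} → Unique xs → Unique (concatMap f xs)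
  unique-concatMap f uniq index []                  = []
  unique-concatMap f uniq index {x ∷ xs} (x∉ ∷ un) = Unique.++⁺ (uniq x) (unique-concatMap f uniq index un)
    λ (y∈ , y∈′) → disjoint y∈ (find (∈-concatMap⁻ f {xs = xs} y∈′))
    where
    disjoint : ∀ {y} → y ∈ f x → (∃[ x′ ] x′ ∈ xs × y ∈ f x′) → ⊥
    disjoint y∈ (x′ , x′∈ , y∈′) = All.lookup x∉ x′∈ (index y∈ y∈′)

  module _ {m : ℕ} where

    single : Column m → ℕ → List (Column m × ℕ)
    single d k = (d , k) ∷ []

    splits-one : ℕ → List (Column m × ℕ)
    splits-one = weighted λ a → single (one a)

    splits-two : Fin m → ℕ → List (Column m × ℕ)
    splits-two g = weighted λ a → weighted λ b → single (two a g b)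

    -- A pair `(d , k)` is a choice of the next column together with the number of cells left after
    -- it.
    splits : ℕ → List (Column m × ℕ)
    splits n = splits-one n ++ concatMap (λ g → splits-two g n) (allFin m)

    private
      ∈-splits-one⁻ : ∀ n {x} → x ∈ splits-one n → ∃[ a ] ∃[ k ] x ≡ (one a , k) × suc a + k ≡ n
      ∈-splits-one⁻ n x∈ with ∈-weighted⁻ (λ a → single (one a)) n x∈
      ... | a , k , eq , here refl = a , k , refl , eq

      ∈-weighted-two⁻ : ∀ g a n {x} → x ∈ weighted (λ b → single (two a g b)) n →
        ∃[ b ] ∃[ k ] x ≡ (two a g b , k) × suc b + k ≡ n
      ∈-weighted-two⁻ g a n x∈ with ∈-weighted⁻ (λ b → single (two a g b)) n x∈
      ... | b , k , eq , here refl = b , k , refl , eq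

      ∈-splits-two⁻ : ∀ g n {x} → x ∈ splits-two g n →
        ∃[ a ] ∃[ b ] ∃[ k ] x ≡ (two a g b , k) × suc a + suc b + k ≡ n
      ∈-splits-two⁻ g n x∈ with ∈-weighted⁻ (λ a → weighted λ b → single (two a g b)) n x∈
      ... | a , k′ , refl , x∈a with ∈-weighted-two⁻ g a k′ x∈a
      ... | b , k , refl , refl = a , b , k , refl , cong suc (ℕ.+-assoc a (suc b) k)

    ∈-splits : ∀ {n} d k → (d , k) ∈ splits n ⇔ (size d + k ≡ n)
    ∈-splits {n} d k = mk⇔ to (from d)
      where
      to : (d , k) ∈ splits n → size d + k ≡ n
      to d∈ with ∈-++⁻ (splits-one n) d∈
      ... | inj₁ d∈₁ with ∈-splits-one⁻ n d∈₁
      ...   | _ , _ , refl , eq = eq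
      to d∈ | inj₂ d∈₂ with find (∈-concatMap⁻ (λ g → splits-two g n) {xs = allFin m} d∈₂)
      ...   | g , _ , d∈g with ∈-splits-two⁻ g n d∈g
      ...   | _ , _ , _ , refl , eq = eq
      from : ∀ d → size d + k ≡ n → (d , k) ∈ splits n
      from (one a) refl = ∈-++⁺ˡ (∈-weighted⁺ (λ a → single (one a)) a k (here refl))
      from (two a g b) refl = ∈-++⁺ʳ (splits-one n) (∈-concatMap⁺ (λ g → splits-two g n) (lose (∈-allFin g)
        (subst (λ n → (two a g b , k) ∈ splits-two g n) (cong suc (sym (ℕ.+-assoc a (suc b) k)))
          (∈-weighted⁺ (λ a → weighted λ b → single (two a g b)) a (suc b + k)
            (∈-weighted⁺ (λ b → single (two a g b)) b k (here refl))))))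

    unique-splits : ∀ n → Unique (splits n)
    unique-splits n = Unique.++⁺
      (unique-weighted (λ a → single (one a)) (λ _ _ → [] ∷ []) (λ { (here refl) (here refl) → refl }) n)
      (unique-concatMap (λ g → splits-two g n)
        (λ g → unique-weighted (λ a → weighted λ b → single (two a g b))
          (λ a → unique-weighted (λ b → single (two a g b)) (λ _ _ → [] ∷ []) λ { (here refl) (here refl) → refl })
          (λ {a} {a′} {k} {k′} → same-height g a a′ k k′) n)
        (λ {g} {g′} → same-gap g g′)
        (Unique.allFin⁺ m))
      λ (x∈ , x∈′) → disjoint x∈ (find (∈-concatMap⁻ (λ g → splits-two g n) {xs = allFin m} x∈′))
      where
      same-height : ∀ g a a′ k k′ {x} → x ∈ weighted (λ b → single (two a g b)) k →
        x ∈ weighted (λ b → single (two a′ g b)) k′ → a ≡ a′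
      same-height g a a′ k k′ x∈ x∈′ with ∈-weighted-two⁻ g a k x∈ | ∈-weighted-two⁻ g a′ k′ x∈′
      ... | _ , _ , refl , _ | _ , _ , refl , _ = refl
      same-gap : ∀ g g′ {x} → x ∈ splits-two g n → x ∈ splits-two g′ n → g ≡ g′
      same-gap g g′ x∈ x∈′ with ∈-splits-two⁻ g n x∈ | ∈-splits-two⁻ g′ n x∈′
      ... | _ , _ , _ , refl , _ | _ , _ , _ , refl , _ = refl
      disjoint : ∀ {x} → x ∈ splits-one n → (∃[ g ] g ∈ allFin m × x ∈ splits-two g n) → ⊥
      disjoint x∈ (g , _ , x∈′) with ∈-splits-one⁻ n x∈ | ∈-splits-two⁻ g n x∈′
      ... | _ , _ , refl , _ | _ , _ , _ , () , _

    overlap? : ∀ r s → Dec (Overlap {m} r s)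
    overlap? (τ , h) (x , k) = x ℕ.≤? τ ×-dec τ ℕ.≤? suc (x + k) + h

    fits? : ∀ c s → Dec (Fits {m} c s)
    fits? c (t , d) = All.all? (λ r → Any.any? (overlap? r) (segments c)) (tops t d)

    extent : Column m → ℕ
    extent (one a)     = a
    extent (two a g b) = a + toℕ g + 2 + b

    -- A strict bound for `t`, from the second inequality of `Overlap` for the lower component of
    -- `d`, where `x + k` is at most `extent c`.
    offset-bound : Column m → Column m → ℕ
    offset-bound c d = suc (suc (extent c) + lower d)

    fits⇒< : ∀ c t d → Fits c (t , d) → t < offset-bound c d
    fits⇒< c t d f with find (lower-overlap d f)
      where
      lower-overlap : ∀ d → Fits c (t , d) → Any (Overlap {m} (t , lower d)) (segments c)
      lower-overlap (one _)     (o ∷ _) = o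
      lower-overlap (two _ _ _) (o ∷ _) = o
    ... | (x , k) , s∈ , (_ , t≤) = s≤s (ℕ.≤-trans t≤ (ℕ.+-monoˡ-≤ (lower d) (s≤s (inside c s∈))))
      where
      inside : ∀ c {x k} → (x , k) ∈ segments c → x + k ≤ extent c
      inside (one _)     (here refl)         = ℕ.≤-refl
      inside (two a g b) (here refl)         = ℕ.≤-trans (ℕ.m≤m+n a (toℕ g)) (ℕ.≤-trans (ℕ.m≤m+n _ 2) (ℕ.m≤m+n _ b))
      inside (two a g b) (there (here refl)) = ℕ.≤-refl

    offsets : Column m → Column m → List ℕ
    offsets c d = filter (λ t → fits? c (t , d)) (upTo (offset-bound c d))

    ∈-offsets : ∀ c d t → t ∈ offsets c d ⇔ Fits c (t , d)
    ∈-offsets c d t = mk⇔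
      (λ t∈ → proj₂ (∈-filter⁻ (λ t → fits? c (t , d)) {xs = upTo (offset-bound c d)} t∈))
      (λ f → ∈-filter⁺ (λ t → fits? c (t , d)) (∈-upTo⁺ (fits⇒< c t d f)) f)

    -- `tails f c n` lists the ways of continuing to the right of the column c
    -- with n further cells, provided that the fuel f is at least n.
    tails : ℕ → Column m → ℕ → List (List (Step {m}))

    extensions : ℕ → Column m → Column m × ℕ → List (List (Step {m}))
    extensions f c (d , k) = concatMap (λ t → map ((t , d) ∷_) (tails f d k)) (offsets c d)

    tails _       c zero    = [] ∷ []
    tails zero    c (suc n) = []
    tails (suc f) c (suc n) = concatMap (extensions f c) (splits (suc n))

    positive : ∀ (d : Column m) → 1 ≤ size d
    positive (one _)     = s≤s z≤n
    positive (two _ _ _) = s≤s z≤n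

    private
      split-< : ∀ {f n} d k → size d + k ≡ suc n → n ≤ f → k ≤ f
      split-< {f} {n} d k eq n≤f = ℕ.≤-trans (ℕ.s≤s⁻¹ (ℕ.≤-trans (ℕ.+-monoˡ-≤ k (positive d)) (ℕ.≤-reflexive eq))) n≤f

    ∈-extensions⁻ : ∀ f c x {ss} → ss ∈ extensions f c x →
      ∃[ t ] ∃[ ss′ ] ss ≡ (t , proj₁ x) ∷ ss′ × t ∈ offsets c (proj₁ x) × ss′ ∈ tails f (proj₁ x) (proj₂ x)
    ∈-extensions⁻ f c (d , k) ss∈ with find (∈-concatMap⁻ _ {xs = offsets c d} ss∈)
    ... | t , t∈ , ss∈t with ∈-map⁻ ((t , d) ∷_) ss∈t
    ... | ss′ , ss′∈ , refl = t , ss′ , refl , t∈ , ss′∈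

    ∈-tails⁻ : ∀ f c n {ss} → ss ∈ tails f c n → ValidSteps c ss × steps-size ss ≡ n
    ∈-tails⁻ f       c zero    (here refl) = tt , refl
    ∈-tails⁻ (suc f) c (suc n) ss∈ with find (∈-concatMap⁻ (extensions f c) {xs = splits (suc n)} ss∈)
    ... | (d , k) , x∈ , ss∈x with ∈-extensions⁻ f c (d , k) ss∈x
    ... | t , ss′ , refl , t∈ , ss′∈ with ∈-tails⁻ f d k ss′∈
    ... | v , refl = (Equivalence.to (∈-offsets c d t) t∈ , v) , Equivalence.to (∈-splits d k) x∈

    ∈-tails⁺ : ∀ f c n → n ≤ f → ∀ ss → ValidSteps c ss → steps-size ss ≡ n → ss ∈ tails f c n
    ∈-tails⁺ f c zero n≤f [] v eq = here refl
    ∈-tails⁺ f c zero n≤f ((t , one _) ∷ ss)     v ()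
    ∈-tails⁺ f c zero n≤f ((t , two _ _ _) ∷ ss) v ()
    ∈-tails⁺ (suc f) c (suc n) (s≤s n≤f) ((t , d) ∷ ss) (fit , v) eq =
      ∈-concatMap⁺ (extensions f c) (lose (Equivalence.from (∈-splits d (steps-size ss)) eq)
        (∈-concatMap⁺ _ (lose (Equivalence.from (∈-offsets c d t) fit)
          (∈-map⁺ ((t , d) ∷_) (∈-tails⁺ f d (steps-size ss) (split-< d (steps-size ss) eq n≤f) ss v refl)))))

    unique-tails : ∀ f c n → Unique (tails f c n)
    unique-tails f       c zero    = [] ∷ []
    unique-tails zero    c (suc n) = []
    unique-tails (suc f) c (suc n) = unique-concatMap (extensions f c)
      (λ (d , k) → unique-concatMap _ (λ t → Unique.map⁺ ∷-injectiveʳ (unique-tails f d k))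
        (λ {t} {t′} → same-offset d k t t′)
        (Unique.filter⁺ (λ t → fits? c (t , d)) (Unique.upTo⁺ (offset-bound c d))))
      (λ {x} {x′} → same-split x x′)
      (unique-splits (suc n))
      where
      same-offset : ∀ d k t t′ {ss} → ss ∈ map ((t , d) ∷_) (tails f d k) → ss ∈ map ((t′ , d) ∷_) (tails f d k) → t ≡ t′
      same-offset d k t t′ ss∈ ss∈′ with ∈-map⁻ _ ss∈ | ∈-map⁻ _ ss∈′
      ... | _ , _ , refl | _ , _ , refl = refl
      -- The first step shows `d`, and `k` is recovered as the total size of the later steps.
      same-split : ∀ x x′ {ss} → ss ∈ extensions f c x → ss ∈ extensions f c x′ → x ≡ x′
      same-split (d , k) (d′ , k′) ss∈ ss∈′ with ∈-extensions⁻ f c (d , k) ss∈ | ∈-extensions⁻ f c (d′ , k′) ss∈′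
      ... | _ , ss , refl , _ , ss′∈ | _ , ss , refl , _ , ss′∈′ =
        cong (d ,_) (trans (sym (proj₂ (∈-tails⁻ f d k ss′∈))) (proj₂ (∈-tails⁻ f d k′ ss′∈′)))

    -- Fuel limits the number of further columns; each of them has a cell, so `n` units are as good
    -- as any larger supply.
    tails-fuel : ∀ f f′ c n → n ≤ f → n ≤ f′ → tails f c n ≡ tails f′ c n
    tails-fuel f       f′       c zero    _         _          = refl
    tails-fuel (suc f) (suc f′) c (suc n) (s≤s n≤f) (s≤s n≤f′) =
      cong concat (map-cong-local {f = extensions f c} {g = extensions f′ c} {xs = splits (suc n)} (All.tabulate λ {(d , k)} x∈ →
        let eq = Equivalence.to (∈-splits d k) x∈ in
        cong (λ ts → concatMap (λ t → map ((t , d) ∷_) ts) (offsets c d))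
          (tails-fuel f f′ d k (split-< d k eq n≤f) (split-< d k eq n≤f′))))

    codes : ℕ → List (Code m)
    codes n = weighted (λ a k → map (a ,_) (tails k (one a) k)) n

    unique-codes : ∀ n → Unique (codes n)
    unique-codes n = unique-weighted _ (λ a k → Unique.map⁺ ,-injectiveʳ (unique-tails k (one a) k))
      (λ {a} {a′} {k} {k′} → same-first a a′ k k′) n
      where
      same-first : ∀ a a′ k k′ {c} → c ∈ map (a ,_) (tails k (one a) k) → c ∈ map (a′ ,_) (tails k′ (one a′) k′) → a ≡ a′
      same-first a a′ k k′ c∈ c∈′ with ∈-map⁻ _ c∈ | ∈-map⁻ _ c∈′
      ... | _ , _ , refl | _ , _ , refl = refl

    ∈-codes : ∀ n c → c ∈ codes n ⇔ (ValidCode c × code-size c ≡ n)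
    ∈-codes n (a , ss) = mk⇔ to from
      where
      to : (a , ss) ∈ codes n → ValidCode (a , ss) × code-size (a , ss) ≡ n
      to c∈ with ∈-weighted⁻ _ n c∈
      ... | a′ , k , refl , c∈a with ∈-map⁻ _ c∈a
      ... | _ , ss∈ , refl with ∈-tails⁻ k (one a′) k ss∈
      ... | v , refl = v , refl
      from : ValidCode (a , ss) × code-size (a , ss) ≡ n → (a , ss) ∈ codes n
      from (v , refl) = ∈-weighted⁺ (λ a k → map (a ,_) (tails k (one a) k)) a (steps-size ss)
        (∈-map⁺ (a ,_) (∈-tails⁺ (steps-size ss) (one a) (steps-size ss) ℕ.≤-refl ss v refl))

open Columns

-- Counting the placements of one column next to another

module Counting where

  open import Data.Bool.Base using (if_then_else_; true; false)
  open import Data.Empty using (⊥-elim)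
  open import Data.Fin.Base using (toℕ)
  open import Data.Integer.Base as ℤ using (+_; 0ℤ; 1ℤ; +≤+)
  import Data.Integer.Properties as ℤ
  open import Data.List.Base using ([]; _∷_; _∷ʳ_; _++_; length; filter; upTo)
  open import Data.List.Properties using (length-++; filter-++; upTo-∷ʳ)
  open import Data.List.Relation.Unary.All using ([]; _∷_)
  open import Data.List.Relation.Unary.Any using (Any; here; there)
  open import Data.Nat.Base using (ℕ; zero; suc; _+_; _∸_; _⊓_; _≤_; _<_; z≤n; s≤s; s≤s⁻¹)
  open import Data.Nat.Properties
  open import Data.Nat.Tactic.RingSolver using (solve-∀)
  open import Data.Product.Base using (proj₁; proj₂)
  open import Data.Sum.Base using (_⊎_; inj₁; inj₂)
  open import Data.Vec.Base using ([]; _∷_)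
  open import Function.Base using (_∘_)
  open import Level using (0ℓ)
  open import Relation.Binary.PropositionalEquality
  open import Relation.Nullary.Decidable using (Dec; yes; no; does; _×-dec_)
  open import Relation.Nullary.Negation using (¬_)
  open import Relation.Unary using (Pred; Decidable)

  indicator : ∀ {P : Set} → Dec P → ℕ
  indicator p? = if does p? then 1 else 0

  indicator-yes : ∀ {P : Set} (p? : Dec P) → P → indicator p? ≡ 1
  indicator-yes (yes _) _ = refl
  indicator-yes (no ¬p) p = ⊥-elim (¬p p)

  indicator-no : ∀ {P : Set} (p? : Dec P) → ¬ P → indicator p? ≡ 0
  indicator-no (yes p) ¬p = ⊥-elim (¬p p)
  indicator-no (no _)  _  = refl

  sumTo : (ℕ → ℕ) → ℕ → ℕ
  sumTo f zero    = 0
  sumTo f (suc n) = sumTo f n + f n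

  sumTo-cong : ∀ {f g} n → (∀ t → t < n → f t ≡ g t) → sumTo f n ≡ sumTo g n
  sumTo-cong zero    f≡g = refl
  sumTo-cong (suc n) f≡g = cong₂ _+_ (sumTo-cong n λ t t<n → f≡g t (m<n⇒m<1+n t<n)) (f≡g n ≤-refl)

  sumTo-+ : ∀ f g n → sumTo (λ t → f t + g t) n ≡ sumTo f n + sumTo g n
  sumTo-+ f g zero    = refl
  sumTo-+ f g (suc n) rewrite sumTo-+ f g n = lemma (sumTo f n) (sumTo g n) (f n) (g n)
    where
    lemma : ∀ a b c d → a + b + (c + d) ≡ a + c + (b + d)
    lemma = solve-∀

  -- Sums of indicators reduce a count to an identity at each single offset, where successful and
  -- lost placements add up to an interval.
  length-filter-upTo : ∀ {P : Pred ℕ 0ℓ} (P? : Decidable P) n →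
    length (filter P? (upTo n)) ≡ sumTo (indicator ∘ P?) n
  length-filter-upTo P? zero    = refl
  length-filter-upTo P? (suc n) = begin
    length (filter P? (upTo (suc n)))                      ≡⟨ cong (length ∘ filter P?) (upTo-∷ʳ n) ⟨
    length (filter P? (upTo n ∷ʳ n))                       ≡⟨ cong length (filter-++ P? (upTo n) (n ∷ [])) ⟩
    length (filter P? (upTo n) ++ filter P? (n ∷ []))      ≡⟨ length-++ (filter P? (upTo n)) ⟩
    length (filter P? (upTo n)) + length (filter P? (n ∷ [])) ≡⟨ cong₂ _+_ (length-filter-upTo P? n) last ⟩
    sumTo (indicator ∘ P?) n + indicator (P? n)            ∎
    where
    open ≡-Reasoning
    last : length (filter P? (n ∷ [])) ≡ indicator (P? n)
    last with does (P? n)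
    ... | true  = refl
    ... | false = refl

  interval : ℕ → ℕ → ℕ → ℕ
  interval lo hi t = indicator (lo ≤? t ×-dec t <? hi)

  sumTo-interval : ∀ lo hi n → hi ≤ n → sumTo (interval lo hi) n ≡ hi ∸ lo
  sumTo-interval lo hi n hi≤n with m≤n⇒∃[o]m+o≡n hi≤n
  ... | k , refl = trans (beyond k) (within hi ≤-refl)
    where
    within : ∀ n → n ≤ hi → sumTo (interval lo hi) n ≡ n ∸ lo
    within zero    _    = sym (0∸n≡0 lo)
    within (suc n) n<hi with lo ≤? n
    ... | yes lo≤n = trans (cong₂ _+_ (within n (<⇒≤ n<hi)) (indicator-yes (lo ≤? n ×-dec n <? hi) (lo≤n , n<hi)))
                       (trans (+-comm (n ∸ lo) 1) (sym (+-∸-assoc 1 lo≤n)))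
    ... | no lo≰n  = trans (cong₂ _+_ (within n (<⇒≤ n<hi)) (indicator-no (lo ≤? n ×-dec n <? hi) (lo≰n ∘ proj₁)))
                       (trans (+-identityʳ (n ∸ lo)) (trans (m≤n⇒m∸n≡0 (<⇒≤ (≰⇒> lo≰n))) (sym (m≤n⇒m∸n≡0 (≰⇒> lo≰n)))))
    beyond : ∀ k → sumTo (interval lo hi) (hi + k) ≡ sumTo (interval lo hi) hi
    beyond zero    = cong (sumTo (interval lo hi)) (+-identityʳ hi)
    beyond (suc k) rewrite +-suc hi k = trans (cong₂ _+_ (beyond k)
      (indicator-no (lo ≤? hi + k ×-dec hi + k <? hi) (λ (_ , lt) → <-irrefl refl (<-≤-trans lt (m≤m+n hi k)))))
      (+-identityʳ _)

  <∸⇒+< : ∀ {t} n o → t < n ∸ o → t + o < n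
  <∸⇒+< {t} n       zero    lt = subst (_< n) (sym (+-identityʳ t)) lt
  <∸⇒+< {t} (suc n) (suc o) lt = subst (_< suc n) (sym (+-suc t o)) (s≤s (<∸⇒+< n o lt))

  +<⇒<∸ : ∀ t n o → t + o < n → t < n ∸ o
  +<⇒<∸ t n o = m+n≤o⇒m≤o∸n (suc t)

  -- Of the ways to place a column with a gap of h + 1 cells to the right of one
  -- with a gap of g + 1 cells, η x g h k counts those where a component of k + 1
  -- cells touches nothing because it lies inside the left gap, while the other
  -- component is on the side of a left component of x + 1 cells.
  η : ℕ → ℕ → ℕ → ℕ → ℕ
  η x g h k = (g ∸ k) ⊓ ((g + x) ∸ (k + h))

  -- A left component with at least as many cells as the right gap is always within reach of the
  -- other component. What remains is to fit `k + 2` adjacent cells into a gap of `g + 1`.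
  η-large : ∀ x g h k → h ≤ x → η x g h k ≡ g ∸ k
  η-large x g h k h≤x with m≤n⇒∃[o]m+o≡n h≤x
  ... | y , refl = m≤n⇒m⊓n≡m (≤-trans (∸-monoˡ-≤ k (m≤m+n g y)) (≤-reflexive (sym
    (trans (cong₂ _∸_ (lemma g h y) (+-comm k h)) ([m+n]∸[m+o]≡n∸o h (g + y) k)))))
    where
    lemma : ∀ g h y → g + (h + y) ≡ h + (g + y)
    lemma = solve-∀

  -- This is the length of the interval of offsets that put the upper component into the gap. Its
  -- truncation at offset zero, the lowest at which the lower component still touches, gives the
  -- second term of the minimum.
  η-below : ∀ x g h k → ((g + x) ∸ (h + k)) ∸ (x ∸ h) ≡ η x g h k
  η-below x g h k with ≤-total x h
  ... | inj₁ x≤h = begin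
    ((g + x) ∸ (h + k)) ∸ (x ∸ h) ≡⟨ cong (((g + x) ∸ (h + k)) ∸_) (m≤n⇒m∸n≡0 x≤h) ⟩
    (g + x) ∸ (h + k)             ≡⟨ cong ((g + x) ∸_) (+-comm h k) ⟩
    (g + x) ∸ (k + h)             ≡⟨ m≥n⇒m⊓n≡n small ⟨
    η x g h k                     ∎
    where
    open ≡-Reasoning
    small : (g + x) ∸ (k + h) ≤ g ∸ k
    small = ≤-trans (∸-monoˡ-≤ (k + h) (+-monoʳ-≤ g x≤h)) (≤-reflexive ([m+o]∸[n+o]≡m∸n g k h))
      where
      [m+o]∸[n+o]≡m∸n : ∀ m n o → (m + o) ∸ (n + o) ≡ m ∸ n
      [m+o]∸[n+o]≡m∸n m n o = trans (cong₂ _∸_ (+-comm m o) (+-comm n o)) ([m+n]∸[m+o]≡n∸o o m n)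
  ... | inj₂ h≤x with m≤n⇒∃[o]m+o≡n h≤x
  ... | y , refl = begin
    ((g + (h + y)) ∸ (h + k)) ∸ ((h + y) ∸ h) ≡⟨ cong (((g + (h + y)) ∸ (h + k)) ∸_) (m+n∸m≡n h y) ⟩
    ((g + (h + y)) ∸ (h + k)) ∸ y             ≡⟨ cong (λ z → (z ∸ (h + k)) ∸ y) (lemma₁ g h y) ⟩
    ((h + (g + y)) ∸ (h + k)) ∸ y             ≡⟨ cong (_∸ y) ([m+n]∸[m+o]≡n∸o h (g + y) k) ⟩
    ((g + y) ∸ k) ∸ y                         ≡⟨ ∸-+-assoc (g + y) k y ⟩
    (g + y) ∸ (k + y)                         ≡⟨ cong₂ _∸_ (+-comm g y) (+-comm k y) ⟩
    (y + g) ∸ (y + k)                         ≡⟨ [m+n]∸[m+o]≡n∸o y g k ⟩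
    g ∸ k                                     ≡⟨ η-large (h + y) g h k h≤x ⟨
    η (h + y) g h k                           ∎
    where
    open ≡-Reasoning
    lemma₁ : ∀ g h y → g + (h + y) ≡ h + (g + y)
    lemma₁ = solve-∀

  -- Here the lower component lies in the gap. The minimum at the upper end of the interval says
  -- that the upper component must still start low enough to touch the left column.
  η-above : ∀ s x g h k → (((s + g) ⊓ ((s + g + x) ∸ h)) ∸ (s + k)) ≡ η x g h k
  η-above s x g h k = begin
    ((s + g) ⊓ ((s + g + x) ∸ h)) ∸ (s + k)                    ≡⟨ ∸-distribʳ-⊓ (s + k) (s + g) ((s + g + x) ∸ h) ⟩
    ((s + g) ∸ (s + k)) ⊓ (((s + g + x) ∸ h) ∸ (s + k))        ≡⟨ cong₂ _⊓_ ([m+n]∸[m+o]≡n∸o s g k) upper ⟩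
    η x g h k                                                  ∎
    where
    open ≡-Reasoning
    upper : ((s + g + x) ∸ h) ∸ (s + k) ≡ (g + x) ∸ (k + h)
    upper = begin
      ((s + g + x) ∸ h) ∸ (s + k)   ≡⟨ ∸-+-assoc (s + g + x) h (s + k) ⟩
      (s + g + x) ∸ (h + (s + k))   ≡⟨ cong₂ _∸_ (+-assoc s g x) (lemma h s k) ⟩
      (s + (g + x)) ∸ (s + (k + h)) ≡⟨ [m+n]∸[m+o]≡n∸o s (g + x) (k + h) ⟩
      (g + x) ∸ (k + h)             ∎
      where
      lemma : ∀ h s k → h + (s + k) ≡ s + (k + h)
      lemma = solve-∀

  module _ {m : ℕ} where

    offset-count : Column m → Column m → ℕ
    offset-count c d = length (offsets c d)

    private
      as-sum : ∀ c d → offset-count c d ≡ sumTo (λ t → indicator (fits? c (t , d))) (offset-bound c d)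
      as-sum c d = length-filter-upTo (λ t → fits? c (t , d)) (offset-bound c d)

    one-one : ∀ a a′ → offset-count (one a) (one a′) ≡ suc (suc a + a′)
    one-one a a′ = trans (as-sum (one a) (one a′)) (trans (sumTo-cong K λ t t<K →
        trans (indicator-yes (fits? {m} (one a) (t , one a′)) (here (z≤n , s≤s⁻¹ t<K) ∷ []))
          (sym (indicator-yes (0 ≤? t ×-dec t <? K) (z≤n , t<K))))
      (sumTo-interval 0 K K ≤-refl))
      where
      K = suc (suc a + a′)

    -- The upper component must start low enough, that is, `t + g < a`, and this already keeps the
    -- lower one from lying too high; neither can be too low, since `t` is a natural number.
    one-two : ∀ a a′ g b′ → offset-count (one a) (two a′ g b′) ≡ a ∸ toℕ g
    one-two a a′ g′ b′ = trans (as-sum (one a) (two a′ g′ b′)) (trans (sumTo-cong K λ t _ → pointwise t)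
      (sumTo-interval 0 (a ∸ g) K (≤-trans (m∸n≤m a g) (≤-trans (m≤m+n a a′) (≤-trans (n≤1+n _) (n≤1+n _))))))
      where
      K = suc (suc a + a′)
      g = toℕ g′
      pointwise : ∀ t → indicator (fits? (one a) (t , two a′ g′ b′)) ≡ interval 0 (a ∸ g) t
      pointwise t with t + g <? a
      ... | yes u = trans
        (indicator-yes (fits? (one a) (t , two a′ g′ b′))
          ( here (z≤n , ℤ.drop‿+≤+ (linear 4 (λ t g a a′ → con 1ℤ ⊕ (t ⊕ g) ≼ a ∷ con 0ℤ ≼ g ∷ con 0ℤ ≼ a′ ∷ [] ⊢ t ≼ con 1ℤ ⊕ (con 0ℤ ⊕ a) ⊕ a′)
              (+ t ∷ + g ∷ + a ∷ + a′ ∷ []) (+≤+ u) (+≤+ z≤n) (+≤+ z≤n)))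
          ∷ here (z≤n , ℤ.drop‿+≤+ (linear 4 (λ t g a b′ → con 1ℤ ⊕ (t ⊕ g) ≼ a ∷ [] ⊢ t ⊕ g ⊕ b′ ⊕ con (+ 2) ≼ con 1ℤ ⊕ (con 0ℤ ⊕ a) ⊕ b′)
              (+ t ∷ + g ∷ + a ∷ + b′ ∷ []) (+≤+ u)))
          ∷ []))
        (sym (indicator-yes (0 ≤? t ×-dec t <? (a ∸ g)) (z≤n , +<⇒<∸ t a g u)))
      ... | no ¬u = trans
        (indicator-no (fits? (one a) (t , two a′ g′ b′)) λ { (_ ∷ here (_ , τ≤) ∷ []) →
          ¬u (ℤ.drop‿+≤+ (linear 4 (λ t g a b′ → t ⊕ g ⊕ b′ ⊕ con (+ 2) ≼ con 1ℤ ⊕ (con 0ℤ ⊕ a) ⊕ b′ ∷ [] ⊢ con 1ℤ ⊕ (t ⊕ g) ≼ a)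
              (+ t ∷ + g ∷ + a ∷ + b′ ∷ []) (+≤+ τ≤))) })
        (sym (indicator-no (0 ≤? t ×-dec t <? (a ∸ g)) (λ (_ , lt) → ¬u (<∸⇒+< a g lt))))

    -- At each offset below `K` the component is within reach of `c` with its gap filled, so it
    -- touches `c` or lies in the gap. Adding the losses on the left avoids a truncated subtraction.
    two-one : ∀ a g b a′ →
      offset-count (two a g b) (one a′) + (toℕ g ∸ a′) ≡ suc (suc (a + toℕ g + 2 + b) + a′)
    two-one a g′ b a′ = begin
      offset-count c d + (g ∸ a′)                            ≡⟨ cong₂ _+_ (as-sum c d) hole ⟩
      sumTo fit K + sumTo (interval (a + a′ + 2) s) K        ≡⟨ sumTo-+ fit (interval (a + a′ + 2) s) K ⟨
      sumTo (λ t → fit t + interval (a + a′ + 2) s t) K      ≡⟨ sumTo-cong K pointwise ⟩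
      sumTo (interval 0 K) K                                 ≡⟨ sumTo-interval 0 K K ≤-refl ⟩
      K                                                      ∎
      where
      open ≡-Reasoning
      c = two a g′ b
      d = one a′
      g = toℕ g′
      s = a + g + 2
      K = suc (suc (s + b) + a′)
      fit : ℕ → ℕ
      fit t = indicator (fits? c (t , d))
      hole : g ∸ a′ ≡ sumTo (interval (a + a′ + 2) s) K
      hole = sym (trans (sumTo-interval (a + a′ + 2) s K
          (≤-trans (m≤m+n s b) (≤-trans (m≤m+n (s + b) a′) (≤-trans (n≤1+n _) (n≤1+n _)))))
        (trans (cong₂ _∸_ (lemma a g) (lemma a a′)) ([m+n]∸[m+o]≡n∸o (a + 2) g a′)))
        where
        lemma : ∀ a g → a + g + 2 ≡ a + 2 + g
        lemma = solve-∀
      pointwise : ∀ t → t < K → fit t + interval (a + a′ + 2) s t ≡ interval 0 K t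
      pointwise t t<K = trans (go (t ≤? suc a + a′) (s ≤? t)) (sym (indicator-yes (0 ≤? t ×-dec t <? K) (z≤n , t<K)))
        where
        hole? = a + a′ + 2 ≤? t ×-dec t <? s
        go : Dec (t ≤ suc a + a′) → Dec (s ≤ t) → fit t + interval (a + a′ + 2) s t ≡ 1
        go (yes l₁) _ = cong₂ _+_
          (indicator-yes (fits? c (t , d)) (here (z≤n , l₁) ∷ []))
          (indicator-no hole? λ (≤t , _) → <-irrefl refl (ℤ.drop‿+≤+
            (linear 3 (λ a a′ t → a ⊕ a′ ⊕ con (+ 2) ≼ t ∷ t ≼ con 1ℤ ⊕ a ⊕ a′ ∷ [] ⊢ con 1ℤ ⊕ t ≼ t)
              (+ a ∷ + a′ ∷ + t ∷ []) (+≤+ ≤t) (+≤+ l₁))))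
        go (no _) (yes l₂) = cong₂ _+_
          (indicator-yes (fits? c (t , d)) (there (here (l₂ , s≤s⁻¹ t<K)) ∷ []))
          (indicator-no hole? λ (_ , t<s) → <-irrefl refl (<-≤-trans t<s l₂))
        go (no ¬l₁) (no ¬l₂) = cong₂ _+_
          (indicator-no (fits? c (t , d)) λ { (here (_ , l₁) ∷ []) → ¬l₁ l₁ ; (there (here (l₂ , _)) ∷ []) → ¬l₂ l₂ })
          (indicator-yes hole? (≤-trans (≤-reflexive (lemma a a′)) (≰⇒> ¬l₁) , ≰⇒> ¬l₂))
          where
          lemma : ∀ a a′ → a + a′ + 2 ≡ suc (suc a + a′)
          lemma = solve-∀

    -- The right side counts the offsets at which the lower component is not too low and the upper
    -- one not too high. Such a placement fails only if the upper (`hole₁`) or the lower component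
    -- (`hole₂`) lies in the gap, and the bound on `g` makes these failures exclusive.
    two-two : ∀ a g b a′ g′ b′ → toℕ g ≤ 2 →
      offset-count (two a g b) (two a′ g′ b′) + (η a (toℕ g) (toℕ g′) b′ + η b (toℕ g) (toℕ g′) a′)
        ≡ (a + toℕ g + 2 + b) ∸ toℕ g′
    two-two a gᶠ b a′ hᶠ b′ g≤2 = begin
      offset-count c d + (η a g h b′ + η b g h a′)
        ≡⟨ cong₂ _+_ (as-sum c d) (cong₂ _+_ hole₁ hole₂) ⟩
      sumTo fit K + (sumTo in₁ K + sumTo in₂ K)
        ≡⟨ cong (λ n → sumTo fit K + n) (sumTo-+ in₁ in₂ K) ⟨
      sumTo fit K + sumTo (λ t → in₁ t + in₂ t) K
        ≡⟨ sumTo-+ fit (λ t → in₁ t + in₂ t) K ⟨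
      sumTo (λ t → fit t + (in₁ t + in₂ t)) K
        ≡⟨ sumTo-cong K (λ t _ → pointwise t) ⟩
      sumTo (interval 0 ((s + b) ∸ h)) K
        ≡⟨ sumTo-interval 0 ((s + b) ∸ h) K (≤-trans (m∸n≤m (s + b) h) s+b≤K) ⟩
      (s + b) ∸ h ∎
      where
      open ≡-Reasoning
      c = two a gᶠ b
      d = two a′ hᶠ b′
      g = toℕ gᶠ
      h = toℕ hᶠ
      s = a + g + 2
      K = suc (suc (s + b) + a′)
      lo₁ = a ∸ h
      hi₁ = (g + a) ∸ (h + b′)
      lo₂ = a + 2 + a′
      hi₂ = (a + 2 + g) ⊓ ((a + 2 + g + b) ∸ h)
      fit in₁ in₂ : ℕ → ℕ
      fit t = indicator (fits? c (t , d))
      in₁ = interval lo₁ hi₁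
      in₂ = interval lo₂ hi₂

      s+b≤K : s + b ≤ K
      s+b≤K = ≤-trans (m≤m+n (s + b) a′) (≤-trans (n≤1+n _) (n≤1+n _))

      s≡ : ∀ a g → a + 2 + g ≡ a + g + 2
      s≡ = solve-∀

      g+a≤s : ∀ a g → g + a + 2 ≡ a + g + 2
      g+a≤s = solve-∀

      hole₁ : η a g h b′ ≡ sumTo in₁ K
      hole₁ = sym (trans (sumTo-interval lo₁ hi₁ K (≤-trans (m∸n≤m (g + a) (h + b′))
        (≤-trans (≤-trans (m≤m+n (g + a) 2) (≤-reflexive (g+a≤s a g))) (≤-trans (m≤m+n s b) s+b≤K))))
        (η-below a g h b′))

      hole₂ : η b g h a′ ≡ sumTo in₂ K
      hole₂ = sym (trans (sumTo-interval lo₂ hi₂ K (≤-trans (m⊓n≤m _ _)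
        (≤-trans (≤-reflexive (s≡ a g)) (≤-trans (m≤m+n s b) s+b≤K))))
        (η-above (a + 2) b g h a′))

      pointwise : ∀ t → fit t + (in₁ t + in₂ t) ≡ interval 0 ((s + b) ∸ h) t
      pointwise t = go (t + h <? a) (s ≤? t + h + b′ + 2) (t + h <? s + b) (t ≤? suc a + a′) (s ≤? t)
        where
        fits = fits? c (t , d)
        hole₁? = lo₁ ≤? t ×-dec t <? hi₁
        hole₂? = lo₂ ≤? t ×-dec t <? hi₂
        all? = 0 ≤? t ×-dec t <? (s + b) ∸ h

        overlaps : Fits c (t , d) → (t ≤ suc a + a′ ⊎ s ≤ t) × (t + h < a ⊎ (s ≤ t + h + b′ + 2 × t + h < s + b))
        overlaps (l ∷ u ∷ []) = below l , above u
          where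
          below : Any (Overlap {m} (t , a′)) (segments c) → t ≤ suc a + a′ ⊎ s ≤ t
          below (here (_ , t≤))          = inj₁ t≤
          below (there (here (s≤t , _))) = inj₂ s≤t
          above : Any (Overlap {m} (t + h + b′ + 2 , b′)) (segments c) → t + h < a ⊎ (s ≤ t + h + b′ + 2 × t + h < s + b)
          above (here (_ , τ≤)) = inj₁ (ℤ.drop‿+≤+ (linear 4
            (λ t h a b′ → t ⊕ h ⊕ b′ ⊕ con (+ 2) ≼ con 1ℤ ⊕ (con 0ℤ ⊕ a) ⊕ b′ ∷ [] ⊢ con 1ℤ ⊕ (t ⊕ h) ≼ a)
            (+ t ∷ + h ∷ + a ∷ + b′ ∷ []) (+≤+ τ≤)))
          above (there (here (s≤τ , τ≤))) = inj₂ (s≤τ , ℤ.drop‿+≤+ (linear 4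
            (λ t h x b′ → t ⊕ h ⊕ b′ ⊕ con (+ 2) ≼ con 1ℤ ⊕ x ⊕ b′ ∷ [] ⊢ con 1ℤ ⊕ (t ⊕ h) ≼ x)
            (+ t ∷ + h ∷ + (s + b) ∷ + b′ ∷ []) (+≤+ τ≤)))

        lower-upper : s ≤ t + h + b′ + 2 → t + h < s + b → Any (Overlap {m} (t + h + b′ + 2 , b′)) (segments c)
        lower-upper s≤τ x = there (here (s≤τ , ℤ.drop‿+≤+ (linear 4
            (λ t h x b′ → con 1ℤ ⊕ (t ⊕ h) ≼ x ∷ [] ⊢ t ⊕ h ⊕ b′ ⊕ con (+ 2) ≼ con 1ℤ ⊕ x ⊕ b′)
            (+ t ∷ + h ∷ + (s + b) ∷ + b′ ∷ []) (+≤+ x))))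

        in-hole₁ : lo₁ ≤ t × t < hi₁ → ¬ (t + h < a) × ¬ (s ≤ t + h + b′ + 2)
        in-hole₁ (≤t , t<) =
          (λ u₁ → <-irrefl refl (<-≤-trans u₁ (subst (a ≤_) (+-comm h t) (≤-trans (m≤n+m∸n a h) (+-monoʳ-≤ h ≤t))))) ,
          (λ u₂ → <-irrefl refl (<-≤-trans (<∸⇒+< (g + a) (h + b′) t<) (ℤ.drop‿+≤+ (linear 5
            (λ t h a b′ g → a ⊕ g ⊕ con (+ 2) ≼ t ⊕ h ⊕ b′ ⊕ con (+ 2) ∷ [] ⊢ g ⊕ a ≼ t ⊕ (h ⊕ b′))
            (+ t ∷ + h ∷ + a ∷ + b′ ∷ + g ∷ []) (+≤+ u₂)))))

        in-hole₂ : lo₂ ≤ t × t < hi₂ → ¬ (t ≤ suc a + a′) × ¬ (s ≤ t) × t + h < s + b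
        in-hole₂ (≤t , t<) =
          (λ l₁ → <-irrefl refl (ℤ.drop‿+≤+ (linear 3
            (λ t a a′ → a ⊕ con (+ 2) ⊕ a′ ≼ t ∷ t ≼ con 1ℤ ⊕ a ⊕ a′ ∷ [] ⊢ con 1ℤ ⊕ t ≼ t)
            (+ t ∷ + a ∷ + a′ ∷ []) (+≤+ ≤t) (+≤+ l₁)))) ,
          (λ l₂ → <-irrefl refl (<-≤-trans t< (≤-trans (m⊓n≤m _ _) (≤-trans (≤-reflexive (s≡ a g)) l₂)))) ,
          subst (λ x → t + h < x + b) (s≡ a g) (<∸⇒+< (a + 2 + g + b) h (<-≤-trans t< (m⊓n≤n (a + 2 + g) _)))

        -- The gaps are so small that the two components of d cannot both lie in
        -- the gap of c.
        disjoint : ¬ (s ≤ t + h + b′ + 2) → ¬ (lo₂ ≤ t × t < hi₂)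
        disjoint ¬u₂ (≤t , _) = ¬u₂ (ℤ.drop‿+≤+ (linear 6
            (λ t h a b′ g a′ → a ⊕ con (+ 2) ⊕ a′ ≼ t ∷ g ≼ con (+ 2) ∷ con 0ℤ ≼ h ∷ con 0ℤ ≼ b′ ∷ con 0ℤ ≼ a′ ∷ [] ⊢
              a ⊕ g ⊕ con (+ 2) ≼ t ⊕ h ⊕ b′ ⊕ con (+ 2))
            (+ t ∷ + h ∷ + a ∷ + b′ ∷ + g ∷ + a′ ∷ []) (+≤+ ≤t) (+≤+ g≤2) (+≤+ z≤n) (+≤+ z≤n) (+≤+ z≤n)))

        all-yes : t + h < s + b → indicator all? ≡ 1
        all-yes x = indicator-yes all? (z≤n , +<⇒<∸ t (s + b) h x)

        -- The tests ask whether the upper component touches the lower left one, whether it reaches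
        -- up to the upper left one, whether it starts low enough, and then which left component the
        -- lower one touches. Failing both of the first two is `hole₁`; failing both of the last two
        -- after passing the second and third is `hole₂`.
        go : Dec (t + h < a) → Dec (s ≤ t + h + b′ + 2) → Dec (t + h < s + b) → Dec (t ≤ suc a + a′) → Dec (s ≤ t) →
          indicator fits + (indicator hole₁? + indicator hole₂?) ≡ indicator all?
        go (yes u₁) _ _ _ _ = trans
          (cong₂ _+_
            (indicator-yes fits
              ( here (z≤n , t≤)
              ∷ here (z≤n , ℤ.drop‿+≤+ (linear 4
                  (λ t h a b′ → con 1ℤ ⊕ (t ⊕ h) ≼ a ∷ [] ⊢ t ⊕ h ⊕ b′ ⊕ con (+ 2) ≼ con 1ℤ ⊕ (con 0ℤ ⊕ a) ⊕ b′)
                  (+ t ∷ + h ∷ + a ∷ + b′ ∷ []) (+≤+ u₁)))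
              ∷ []))
            (cong₂ _+_ (indicator-no hole₁? λ i → proj₁ (in-hole₁ i) u₁) (indicator-no hole₂? λ i → proj₁ (in-hole₂ i) t≤)))
          (sym (all-yes (ℤ.drop‿+≤+ (linear 5
            (λ t h a g b → con 1ℤ ⊕ (t ⊕ h) ≼ a ∷ con 0ℤ ≼ g ∷ con 0ℤ ≼ b ∷ [] ⊢ con 1ℤ ⊕ (t ⊕ h) ≼ a ⊕ g ⊕ con (+ 2) ⊕ b)
            (+ t ∷ + h ∷ + a ∷ + g ∷ + b ∷ []) (+≤+ u₁) (+≤+ z≤n) (+≤+ z≤n)))))
          where
          t≤ : t ≤ suc a + a′
          t≤ = ℤ.drop‿+≤+ (linear 4 (λ t h a a′ → con 1ℤ ⊕ (t ⊕ h) ≼ a ∷ con 0ℤ ≼ h ∷ con 0ℤ ≼ a′ ∷ [] ⊢ t ≼ con 1ℤ ⊕ a ⊕ a′)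
            (+ t ∷ + h ∷ + a ∷ + a′ ∷ []) (+≤+ u₁) (+≤+ z≤n) (+≤+ z≤n))
        go (no ¬u₁) (no ¬u₂) _ _ _ = trans
          (cong₂ _+_
            (indicator-no fits λ f → case-upper (proj₂ (overlaps f)))
            (cong₂ _+_
              (indicator-yes hole₁?
                ( m≤n+o⇒m∸n≤o a h (subst (a ≤_) (+-comm t h) (≮⇒≥ ¬u₁))
                , +<⇒<∸ t (g + a) (h + b′) (ℤ.drop‿+≤+ (linear 5
                    (λ t h a b′ g → con 1ℤ ⊕ (t ⊕ h ⊕ b′ ⊕ con (+ 2)) ≼ a ⊕ g ⊕ con (+ 2) ∷ [] ⊢ con 1ℤ ⊕ (t ⊕ (h ⊕ b′)) ≼ g ⊕ a)
                    (+ t ∷ + h ∷ + a ∷ + b′ ∷ + g ∷ []) (+≤+ (≰⇒> ¬u₂))))))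
              (indicator-no hole₂? (disjoint ¬u₂))))
          (sym (all-yes (ℤ.drop‿+≤+ (linear 5
            (λ t h s b b′ → con 1ℤ ⊕ (t ⊕ h ⊕ b′ ⊕ con (+ 2)) ≼ s ∷ con 0ℤ ≼ b ∷ con 0ℤ ≼ b′ ∷ [] ⊢ con 1ℤ ⊕ (t ⊕ h) ≼ s ⊕ b)
            (+ t ∷ + h ∷ + s ∷ + b ∷ + b′ ∷ []) (+≤+ (≰⇒> ¬u₂)) (+≤+ z≤n) (+≤+ z≤n)))))
          where
          case-upper : ¬ (t + h < a ⊎ (s ≤ t + h + b′ + 2 × t + h < s + b))
          case-upper (inj₁ u₁)       = ¬u₁ u₁
          case-upper (inj₂ (u₂ , _)) = ¬u₂ u₂
        go (no ¬u₁) (yes u₂) (no ¬x) _ _ = trans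
          (cong₂ _+_
            (indicator-no fits λ f → case-upper (proj₂ (overlaps f)))
            (cong₂ _+_ (indicator-no hole₁? λ i → proj₂ (in-hole₁ i) u₂)
                       (indicator-no hole₂? λ i → ¬x (proj₂ (proj₂ (in-hole₂ i))))))
          (sym (indicator-no all? λ (_ , t<) → ¬x (<∸⇒+< (s + b) h t<)))
          where
          case-upper : ¬ (t + h < a ⊎ (s ≤ t + h + b′ + 2 × t + h < s + b))
          case-upper (inj₁ u₁)      = ¬u₁ u₁
          case-upper (inj₂ (_ , x)) = ¬x x
        go (no ¬u₁) (yes u₂) (yes x) (yes l₁) _ = trans
          (cong₂ _+_
            (indicator-yes fits (here (z≤n , l₁) ∷ lower-upper u₂ x ∷ []))
            (cong₂ _+_ (indicator-no hole₁? λ i → proj₂ (in-hole₁ i) u₂)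
                       (indicator-no hole₂? λ i → proj₁ (in-hole₂ i) l₁)))
          (sym (all-yes x))
        go (no ¬u₁) (yes u₂) (yes x) (no ¬l₁) (yes l₂) = trans
          (cong₂ _+_
            (indicator-yes fits (there (here (l₂ , ℤ.drop‿+≤+ (linear 4
                (λ t h x a′ → con 1ℤ ⊕ (t ⊕ h) ≼ x ∷ con 0ℤ ≼ h ∷ con 0ℤ ≼ a′ ∷ [] ⊢ t ≼ con 1ℤ ⊕ x ⊕ a′)
                (+ t ∷ + h ∷ + (s + b) ∷ + a′ ∷ []) (+≤+ x) (+≤+ z≤n) (+≤+ z≤n)))) ∷ lower-upper u₂ x ∷ []))
            (cong₂ _+_ (indicator-no hole₁? λ i → proj₂ (in-hole₁ i) u₂)
                       (indicator-no hole₂? λ i → proj₁ (proj₂ (in-hole₂ i)) l₂)))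
          (sym (all-yes x))
        go (no ¬u₁) (yes u₂) (yes x) (no ¬l₁) (no ¬l₂) = trans
          (cong₂ _+_
            (indicator-no fits λ f → case-lower (proj₁ (overlaps f)))
            (cong₂ _+_ (indicator-no hole₁? λ i → proj₂ (in-hole₁ i) u₂)
              (indicator-yes hole₂?
                ( subst (_≤ t) (lemma a a′) (≰⇒> ¬l₁)
                , ⊓-glb (subst (t <_) (sym (s≡ a g)) (≰⇒> ¬l₂))
                        (+<⇒<∸ t (a + 2 + g + b) h (subst (λ y → t + h < y + b) (sym (s≡ a g)) x))))))
          (sym (all-yes x))
          where
          lemma : ∀ a a′ → suc (suc a + a′) ≡ a + 2 + a′
          lemma = solve-∀
          case-lower : ¬ (t ≤ suc a + a′ ⊎ s ≤ t)
          case-lower (inj₁ l₁) = ¬l₁ l₁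
          case-lower (inj₂ l₂) = ¬l₂ l₂

open Counting

-- Power series and the transfer equations

module GeneratingFunction where

  open import Data.Bool.Base using (Bool; _∧_) renaming (T to IsTrue)
  open import Data.Bool.Properties using (T-∧)
  open import Data.Fin.Base using (Fin; toℕ; zero; suc; _↑ˡ_; _↑ʳ_; combine)
  open import Data.Fin.Patterns using (0F; 1F; 2F; 3F; 4F)
  open import Data.Fin.Properties using (toℕ<n)
  open import Data.Integer.Base using (ℤ; +_; 0ℤ; 1ℤ; _+_; _*_; _-_)
  open import Data.Integer.Properties as ℤ
    using (+-identityʳ; +-identityˡ; +-assoc; *-zeroʳ; *-zeroˡ; *-identityˡ; *-distribˡ-+; *-distribʳ-+)
  open import Data.Integer.Tactic.RingSolver using (solve-∀)
  open import Data.List.Base as List using (List; []; _∷_; _∷ʳ_; _++_; concatMap; foldr; length; allFin; upTo)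
  open import Data.List.Membership.Propositional using (_∈_)
  open import Data.List.Membership.Propositional.Properties using (∈-upTo⁻)
  open import Data.List.Properties using (length-map; length-++; map-cong; upTo-∷ʳ)
  open import Data.List.Relation.Unary.Any using (here; there)
  open import Data.Nat.Base as ℕ using (ℕ; zero; suc; _∸_; _≤_; _<_; s≤s)
  import Data.Nat.Properties as ℕ
  import Data.Nat.Tactic.RingSolver as ℕ-Solver
  open import Data.Product.Base using (proj₁; proj₂)
  open import Data.Vec.Base as Vec using (Vec; []; _∷_)
  import Data.Vec.Properties as Vec
  open import Function.Base using (_∘_)
  open import Function.Bundles using (Equivalence)
  open import Relation.Binary.PropositionalEquality
  open import Relation.Nullary.Decidable using (Dec; yes; no; ⌊_⌋; toWitness)

  private
    interchange : ∀ a b c d → a + b + (c + d) ≡ a + c + (b + d)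
    interchange = solve-∀

  total : ∀ {X : Set} → (X → ℤ) → List X → ℤ
  total f []       = 0ℤ
  total f (x ∷ xs) = f x + total f xs

  total-++ : ∀ {X : Set} (f : X → ℤ) xs ys → total f (xs ++ ys) ≡ total f xs + total f ys
  total-++ f []       ys = sym (+-identityˡ _)
  total-++ f (x ∷ xs) ys = trans (cong (λ z → f x + z) (total-++ f xs ys)) (sym (+-assoc (f x) _ _))

  total-cong : ∀ {X : Set} {f g : X → ℤ} xs → (∀ x → x ∈ xs → f x ≡ g x) → total f xs ≡ total g xs
  total-cong []       f≡g = refl
  total-cong (x ∷ xs) f≡g = cong₂ _+_ (f≡g x (here refl)) (total-cong xs λ y y∈ → f≡g y (there y∈))

  total-concatMap : ∀ {X Y : Set} (f : Y → ℤ) (h : X → List Y) xs →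
    total f (concatMap h xs) ≡ total (λ x → total f (h x)) xs
  total-concatMap f h []       = refl
  total-concatMap f h (x ∷ xs) = trans (total-++ f (h x) (concatMap h xs)) (cong (λ z → total f (h x) + z) (total-concatMap f h xs))

  length-concatMap : ∀ {X Y : Set} (h : X → List Y) xs → + length (concatMap h xs) ≡ total (λ x → + length (h x)) xs
  length-concatMap h []       = refl
  length-concatMap h (x ∷ xs) = trans (cong +_ (length-++ (h x))) (cong (λ z → + length (h x) + z) (length-concatMap h xs))

  total-const : ∀ {X : Set} c (xs : List X) → total (λ _ → c) xs ≡ + length xs * c
  total-const c []       = sym (*-zeroˡ c)
  total-const c (x ∷ xs) = trans (cong (λ z → c + z) (total-const c xs)) (lemma c (+ length xs))
    where
    lemma : ∀ c n → c + n * c ≡ (1ℤ + n) * c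
    lemma = solve-∀

  -- The power series q (G₀ + q G₁ + q² G₂ + …)
  S : (ℕ → PowerSeries) → PowerSeries
  S G zero    = 0ℤ
  S G (suc n) = G 0 n + S (G ∘ suc) n

  total-weighted : ∀ {X : Set} (f : X → ℤ) G n → total f (weighted G n) ≡ S (λ a k → total f (G a k)) n
  total-weighted f G zero    = refl
  total-weighted f G (suc n) = trans (total-++ f (G 0 n) _) (cong (λ z → total f (G 0 n) + z) (total-weighted f (G ∘ suc) n))

  length-weighted : ∀ {X : Set} (G : ℕ → ℕ → List X) n → + length (weighted G n) ≡ S (λ a k → + length (G a k)) n
  length-weighted G zero    = refl
  length-weighted G (suc n) = trans (cong +_ (length-++ (G 0 n))) (cong (λ z → + length (G 0 n) + z) (length-weighted (G ∘ suc) n))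

  S-cong : ∀ {G H} → (∀ a k → G a k ≡ H a k) → ∀ n → S G n ≡ S H n
  S-cong G≡H zero    = refl
  S-cong G≡H (suc n) = cong₂ _+_ (G≡H 0 n) (S-cong (G≡H ∘ suc) n)

  S-+ : ∀ G H n → S (λ a k → G a k + H a k) n ≡ S G n + S H n
  S-+ G H zero    = refl
  S-+ G H (suc n) = trans (cong (λ z → G 0 n + H 0 n + z) (S-+ (G ∘ suc) (H ∘ suc) n))
    (interchange (G 0 n) (H 0 n) _ _)

  S-- : ∀ G H n → S (λ a k → G a k - H a k) n ≡ S G n - S H n
  S-- G H zero    = refl
  S-- G H (suc n) = trans (cong (λ z → G 0 n - H 0 n + z) (S-- (G ∘ suc) (H ∘ suc) n))
    (lemma (G 0 n) (H 0 n) _ _)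
    where
    lemma : ∀ a b c d → a - b + (c - d) ≡ a + c - (b + d)
    lemma = solve-∀

  S-* : ∀ c G n → S (λ a k → c * G a k) n ≡ c * S G n
  S-* c G zero    = sym (*-zeroʳ c)
  S-* c G (suc n) = trans (cong (λ z → c * G 0 n + z) (S-* c (G ∘ suc) n)) (sym (*-distribˡ-+ c _ _))

  S-zero : ∀ {G} → (∀ a k → G a k ≡ 0ℤ) → ∀ n → S G n ≡ 0ℤ
  S-zero G≡0 zero    = refl
  S-zero G≡0 (suc n) = cong₂ _+_ (G≡0 0 n) (S-zero (G≡0 ∘ suc) n)

  shiftˢ : PowerSeries → PowerSeries
  shiftˢ f zero    = 0ℤ
  shiftˢ f (suc n) = f n

  S-shift : ∀ G n → S (λ a → shiftˢ (G a)) n ≡ shiftˢ (S G) n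
  S-shift G zero          = refl
  S-shift G (suc zero)    = refl
  S-shift G (suc (suc n)) = cong (λ z → G 0 n + z) (S-shift (G ∘ suc) (suc n))

  S-two : ∀ {G} → (∀ a k → G (2 ℕ.+ a) k ≡ 0ℤ) → ∀ n → S G n ≡ shiftˢ (G 0) n + shiftˢ (shiftˢ (G 1)) n
  S-two G≡0 zero          = refl
  S-two G≡0 (suc zero)    = refl
  S-two {G} G≡0 (suc (suc n)) = cong (λ z → G 0 (suc n) + z) (trans (cong (λ z → G 1 n + z) (S-zero G≡0 n)) (+-identityʳ _))

  shiftˢ-* : ∀ c f n → shiftˢ (λ k → c * f k) n ≡ c * shiftˢ f n
  shiftˢ-* c f zero    = sym (*-zeroʳ c)
  shiftˢ-* c f (suc n) = refl

  -- Multiplication by `q / (1 - q)`.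
  constant-S : PowerSeries → PowerSeries
  constant-S X = S (λ _ → X)

  -- Multiplication by `q / (1 - q)` passes through the sum. With `S G = q W`, the identity `unfold`
  -- reads `q W / (1 - q) = q W + q (q W) / (1 - q)`.
  S-constant : ∀ G n → S (λ a → constant-S (G a)) n ≡ constant-S (S G) n
  S-constant G zero    = refl
  S-constant G (suc n) = begin
    constant-S (G 0) n + S (λ a → constant-S (G (suc a))) n ≡⟨ cong (λ z → constant-S (G 0) n + z) (S-constant (G ∘ suc) n) ⟩
    constant-S (G 0) n + constant-S (S (G ∘ suc)) n         ≡⟨ S-+ (λ _ → G 0) (λ _ → S (G ∘ suc)) n ⟨
    constant-S W n                                          ≡⟨ unfold n ⟩
    S G n + constant-S (S G) n                              ∎
    where
    open ≡-Reasoning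
    W : PowerSeries
    W k = G 0 k + S (G ∘ suc) k
    S≡ : ∀ k → S G k ≡ shiftˢ W k
    S≡ zero    = refl
    S≡ (suc k) = refl
    unfold : ∀ n → constant-S W n ≡ S G n + constant-S (S G) n
    unfold zero    = refl
    unfold (suc n) = cong (λ z → W n + z) (sym (trans (S-cong (λ _ → S≡) (suc n)) (S-shift (λ _ → W) (suc n))))

  -- There are n pairs (a , b) with a + b + 1 = n.
  S-diagonal : ∀ (H : ℕ → PowerSeries) n → S (λ i k → + i * H i k) n ≡ S (λ a → S (λ b → H (suc (a ℕ.+ b)))) n
  S-diagonal H zero    = refl
  S-diagonal H (suc n) = begin
    0ℤ * H 0 n + S (λ i k → + suc i * H (suc i) k) n
      ≡⟨ cong₂ _+_ (*-zeroˡ (H 0 n)) (S-cong (λ i k → lemma (+ i) (H (suc i) k)) n) ⟩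
    0ℤ + S (λ i k → H (suc i) k + + i * H (suc i) k) n
      ≡⟨ trans (+-identityˡ _) (S-+ (H ∘ suc) (λ i k → + i * H (suc i) k) n) ⟩
    S (H ∘ suc) n + S (λ i k → + i * H (suc i) k) n
      ≡⟨ cong (λ z → S (H ∘ suc) n + z) (S-diagonal (H ∘ suc) n) ⟩
    S (H ∘ suc) n + S (λ a → S (λ b → H (suc (suc (a ℕ.+ b))))) n ∎
    where
    open ≡-Reasoning
    lemma : ∀ i x → (1ℤ + i) * x ≡ x + i * x
    lemma = solve-∀

  Σ₃ : (Fin 3 → ℤ) → ℤ
  Σ₃ f = total f (allFin 3)

  Σ₂ : (Fin 2 → ℤ) → ℤ
  Σ₂ f = total f (allFin 2)

  total-+ : ∀ {X : Set} (f g : X → ℤ) xs → total (λ x → f x + g x) xs ≡ total f xs + total g xs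
  total-+ f g []       = refl
  total-+ f g (x ∷ xs) = trans (cong (λ z → f x + g x + z) (total-+ f g xs)) (interchange (f x) (g x) _ _)

  total-* : ∀ {X : Set} c (f : X → ℤ) xs → total (λ x → c * f x) xs ≡ c * total f xs
  total-* c f []       = sym (*-zeroʳ c)
  total-* c f (x ∷ xs) = trans (cong (λ z → c * f x + z) (total-* c f xs)) (sym (*-distribˡ-+ c _ _))

  -- The generating functions of the continuations to the right of a column

  F : ∀ {m} → Column m → PowerSeries
  F c n = + length (tails n c n)

  δ : PowerSeries
  δ zero    = 1ℤ
  δ (suc n) = 0ℤ

  w : ∀ {m} → Column m → Column m → ℤ
  w c d = + offset-count c d

  module _ {m : ℕ} where

    length-extensions : ∀ f (c : Column m) x → + length (extensions f c x) ≡ w c (proj₁ x) * + length (tails f (proj₁ x) (proj₂ x))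
    length-extensions f c (d , k) = trans (length-concatMap _ (offsets c d))
      (trans (total-cong (offsets c d) (λ t _ → cong +_ (length-map ((t , d) ∷_) (tails f d k))))
        (total-const (+ length (tails f d k)) (offsets c d)))

    F-splits : ∀ (c : Column m) n → F c n ≡ δ n + total (λ x → w c (proj₁ x) * F (proj₁ x) (proj₂ x)) (splits n)
    F-splits c zero    = cong (λ z → 1ℤ + z) (sym (trans (total-concatMap {X = Fin m} _ (λ g → splits-two g 0) (allFin m))
      (trans (total-cong (allFin m) (λ _ _ → refl)) (trans (total-const 0ℤ (allFin m)) (*-zeroʳ (+ length (allFin m)))))))
    F-splits c (suc n) = trans (length-concatMap (extensions n c) (splits (suc n)))
      (trans (total-cong (splits (suc n)) λ (d , k) x∈ →
        trans (length-extensions n c (d , k)) (cong (λ ts → w c d * + length ts)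
          (tails-fuel n k d k (bound d k (Equivalence.to (∈-splits d k) x∈)) ℕ.≤-refl)))
      (sym (+-identityˡ _)))
      where
      bound : ∀ (d : Column m) k → size d ℕ.+ k ≡ suc n → k ≤ n
      bound d k eq = ℕ.s≤s⁻¹ (ℕ.≤-trans (ℕ.+-monoˡ-≤ k (positive d)) (ℕ.≤-reflexive eq))

    -- Either nothing follows `c`, which gives `δ`, or a next column is placed in `w` ways; what
    -- comes after it depends neither on `c` nor on the offset.
    F-rec : ∀ (c : Column m) n → F c n ≡
      δ n + (S (λ a k → w c (one a) * F (one a) k) n +
             total (λ g → S (λ a → S (λ b k → w c (two a g b) * F (two a g b) k)) n) (allFin m))
    F-rec c n = trans (F-splits c n) (cong (λ z → δ n + z) (trans (total-++ f (splits-one n) _)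
      (cong₂ _+_
        (trans (total-weighted f (λ a → single (one a)) n) (S-cong (λ a k → +-identityʳ _) n))
        (trans (total-concatMap f (λ g → splits-two g n) (allFin m))
          (total-cong (allFin m) λ g _ → trans (total-weighted f (λ a → weighted λ b → single (two a g b)) n)
            (S-cong (λ a k → trans (total-weighted f (λ b → single (two a g b)) k) (S-cong (λ b l → +-identityʳ _) k)) n))))))
      where
      f : Column m × ℕ → ℤ
      f (d , k) = w c d * F d k

  F₁ : ℕ → PowerSeries
  F₁ a = F {3} (one a)

  F₂ : ℕ → Fin 3 → ℕ → PowerSeries
  F₂ a g b = F (two a g b)

  -- `A` is the series of the theorem. `B` has the number of cells as a weight because `one-one`
  -- contains that number. `D` is a slope: corrections aside, one more cell in a left component
  -- admits one more placement of each next column.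
  A B D f₀ f₁ : PowerSeries
  A = S F₁
  B = S (λ a k → + suc a * F₁ a k)
  f₀ = shiftˢ (F₁ 0)
  f₁ = shiftˢ (shiftˢ (F₁ 1))

  T : Fin 3 → PowerSeries
  T g = S λ a → S λ b → F₂ a g b

  D n = A n + Σ₃ (λ h → T h n)

  -- U h k and L h k are the contributions of the columns with a gap of h + 1
  -- cells whose upper, respectively lower, component has k + 1 cells.
  U L Y : Fin 3 → Fin 2 → PowerSeries
  U h 0F = S λ a → shiftˢ (F₂ a h 0)
  U h 1F = S λ a → shiftˢ (shiftˢ (F₂ a h 1))
  L h 0F = shiftˢ (S λ b → F₂ 0 h b)
  L h 1F = shiftˢ (shiftˢ (S λ b → F₂ 1 h b))
  Y h k n = U h k n + L h k n

  base : ℕ → Vec ℤ 14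
  base n = δ n ∷ A n ∷ B n ∷ f₀ n ∷ f₁ n ∷ T 0F n ∷ T 1F n ∷ T 2F n ∷
    Y 0F 0F n ∷ Y 0F 1F n ∷ Y 1F 0F n ∷ Y 1F 1F n ∷ Y 2F 0F n ∷ Y 2F 1F n ∷ []

  -- A hat denotes the linear form of a series in the entries of `base`, and of
  -- `state` below.
  δ̂ Â B̂ f̂₀ f̂₁ D̂ : Lin 14
  δ̂ = var zero
  Â = var (suc zero)
  B̂ = var (suc (suc zero))
  f̂₀ = var (suc (suc (suc zero)))
  f̂₁ = var (suc (suc (suc (suc zero))))

  T̂ : Fin 3 → Lin 14
  T̂ h = var (5 ↑ʳ (h ↑ˡ 6))

  Ŷ : Fin 3 → Fin 2 → Lin 14
  Ŷ h k = var (8 ↑ʳ combine h k)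

  -- The final zero mirrors the unfolding of `total` over `allFin 3`, so that the value of the form
  -- is a `Σ₃` by computation.
  Σ̂₃ : ∀ {n} → (Fin 3 → Lin n) → Lin n
  Σ̂₃ f = f 0F ⊕ (f 1F ⊕ (f 2F ⊕ con 0ℤ))

  Σ̂₂ : ∀ {n} → (Fin 2 → Lin n) → Lin n
  Σ̂₂ f = f 0F ⊕ (f 1F ⊕ con 0ℤ)

  D̂ = Â ⊕ Σ̂₃ T̂

  F̂₁ : ℕ → Lin 14
  F̂₁ a = δ̂ ⊕ ((+ suc a ⊙ Â ⊕ B̂) ⊕ Σ̂₃ λ h → + (a ∸ toℕ h) ⊙ T̂ h)

  -- The part of the series of a two-component column that is free of its heights. `f̂₀` and `f̂₁`
  -- account for next columns of one or two cells lost in the gap.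
  Ĉ : Fin 3 → Lin 14
  Ĉ g = δ̂ ⊕ ((+ (toℕ g ℕ.+ 3) ⊙ Â ⊕ B̂ ⊖ (+ toℕ g ⊙ f̂₀ ⊕ + (toℕ g ∸ 1) ⊙ f̂₁)) ⊕
    Σ̂₃ λ h → + (toℕ g ℕ.+ 2 ∸ toℕ h) ⊙ T̂ h)

  -- The two contributions of the height `x`, as a lower and as an upper height, taken together.
  -- This sum is a form in `base`, which contains `Y` and not `U` and `L` separately.
  φ̂ : Fin 3 → ℕ → Lin 14
  φ̂ g x = + 2 ⊙ (+ x ⊙ D̂) ⊖ Σ̂₃ λ h → Σ̂₂ λ k → + η x (toℕ g) (toℕ h) (toℕ k) ⊙ Ŷ h k

  correction : (Fin 3 → Fin 2 → PowerSeries) → Fin 3 → ℕ → Fin 3 → PowerSeries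
  correction Z g x h n = Σ₂ λ k → + η x (toℕ g) (toℕ h) (toℕ k) * Z h k n

  half : (Fin 3 → Fin 2 → PowerSeries) → Fin 3 → ℕ → PowerSeries
  half Z g x n = + x * D n - Σ₃ λ h → correction Z g x h n

  F-one : ∀ a n → F₁ a n ≡ ⟦ F̂₁ a ⟧ (base n)
  F-one a n = trans (F-rec (one a) n) (cong (λ z → δ n + z) (cong₂ _+_ ones (total-cong (allFin 3) λ h _ → twos h)))
    where
    ones : S (λ a′ k → w {3} (one a) (one a′) * F₁ a′ k) n ≡ + suc a * A n + B n
    ones = trans (S-cong (λ a′ k → trans
        (cong (λ c → + c * F₁ a′ k) (trans (one-one {3} a a′) (cong suc (sym (ℕ.+-suc a a′)))))
        (*-distribʳ-+ (F₁ a′ k) (+ suc a) (+ suc a′))) n)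
      (trans (S-+ (λ a′ k → + suc a * F₁ a′ k) (λ a′ k → + suc a′ * F₁ a′ k) n)
        (cong (λ z → z + B n) (S-* (+ suc a) F₁ n)))
    twos : ∀ h → S (λ a′ → S (λ b′ k → w (one a) (two a′ h b′) * F₂ a′ h b′ k)) n ≡ + (a ∸ toℕ h) * T h n
    twos h = trans (S-cong (λ a′ k → trans
        (S-cong (λ b′ l → cong (λ c → + c * F₂ a′ h b′ l) (one-two a a′ h b′)) k)
        (S-* (+ (a ∸ toℕ h)) (λ b′ → F₂ a′ h b′) k)) n)
      (S-* (+ (a ∸ toℕ h)) (λ a′ → S λ b′ → F₂ a′ h b′) n)

  g≤2 : ∀ (g : Fin 3) → toℕ g ≤ 2
  g≤2 g = ℕ.s≤s⁻¹ (toℕ<n g)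

  -- While the upper component of the next column is lost, the lower one lies beside the lower left
  -- component, so that correction depends on `a` alone; the other depends on `b` alone. Hence the
  -- two heights separate.
  F-two : ∀ a g b n → F₂ a g b n ≡ ⟦ Ĉ g ⟧ (base n) + (half U g a n + half L g b n)
  F-two a g b n = begin
    F₂ a g b n
      ≡⟨ F-rec (two a g b) n ⟩
    δ n + (S (λ a′ k → w (two a g b) (one a′) * F₁ a′ k) n +
           Σ₃ λ h → S (λ a′ → S (λ b′ k → w (two a g b) (two a′ h b′) * F₂ a′ h b′ k)) n)
      ≡⟨ cong (λ z → δ n + z) (cong₂ _+_ ones (total-cong (allFin 3) λ h _ → twos h)) ⟩
    δ n + ((+ (a ℕ.+ b) + + (γ ℕ.+ 3)) * A n + B n - (+ γ * f₀ n + + (γ ∸ 1) * f₁ n) +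
           Σ₃ λ h → (+ (a ℕ.+ b) + c h) * T h n - (correction U g a h n + correction L g b h n))
      ≡⟨ cong (λ z → δ n + ((+ (a ℕ.+ b) + + (γ ℕ.+ 3)) * A n + B n - (+ γ * f₀ n + + (γ ∸ 1) * f₁ n) + z))
           (sum (+ (a ℕ.+ b)) c (λ h → T h n) (λ h → correction U g a h n) (λ h → correction L g b h n) (allFin 3)) ⟩
    _ ≡⟨ assemble (δ n) (+ a) (+ b) (+ (γ ℕ.+ 3)) (A n) (B n) (+ γ * f₀ n + + (γ ∸ 1) * f₁ n)
           (Σ₃ λ h → T h n) (Σ₃ λ h → c h * T h n) (Σ₃ λ h → correction U g a h n) (Σ₃ λ h → correction L g b h n) ⟩
    ⟦ Ĉ g ⟧ (base n) + (half U g a n + half L g b n) ∎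
    where
    open ≡-Reasoning
    γ = toℕ g
    e = a ℕ.+ γ ℕ.+ 2 ℕ.+ b
    c : Fin 3 → ℤ
    c h = + (γ ℕ.+ 2 ∸ toℕ h)

    assemble : ∀ d a b g A B f T cT u l →
      d + ((a + b + g) * A + B - f + ((a + b) * T + cT - (u + l))) ≡
      d + (g * A + B - f + cT) + (a * (A + T) - u + (b * (A + T) - l))
    assemble = solve-∀

    sum : ∀ {X : Set} s (c t u l : X → ℤ) xs → total (λ h → (s + c h) * t h - (u h + l h)) xs ≡
      s * total t xs + total (λ h → c h * t h) xs - (total u xs + total l xs)
    sum s c t u l []       = lemma s
      where
      lemma : ∀ s → 0ℤ ≡ s * 0ℤ + 0ℤ - (0ℤ + 0ℤ)
      lemma = solve-∀
    sum s c t u l (x ∷ xs) = trans (cong (λ z → (s + c x) * t x - (u x + l x) + z) (sum s c t u l xs))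
      (lemma s (c x) (t x) (u x) (l x) _ _ _ _)
      where
      lemma : ∀ s c t u l T C U L → (s + c) * t - (u + l) + (s * T + C - (U + L)) ≡ s * (t + T) + (c * t + C) - (u + U + (l + L))
      lemma = solve-∀

    ones : S (λ a′ k → w (two a g b) (one a′) * F₁ a′ k) n ≡
      (+ (a ℕ.+ b) + + (γ ℕ.+ 3)) * A n + B n - (+ γ * f₀ n + + (γ ∸ 1) * f₁ n)
    ones = trans (S-cong expand n)
      (trans (S-- (λ a′ k → x * F₁ a′ k + + suc a′ * F₁ a′ k) (λ a′ k → + (γ ∸ a′) * F₁ a′ k) n)
        (cong₂ _-_
          (trans (S-+ (λ a′ k → x * F₁ a′ k) (λ a′ k → + suc a′ * F₁ a′ k) n) (cong (λ z → z + B n) (S-* x F₁ n)))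
          (trans (S-two (λ a′ k → cong (λ c → + c * F₁ (2 ℕ.+ a′) k) (ℕ.m≤n⇒m∸n≡0 (ℕ.≤-trans (g≤2 g) (ℕ.m≤m+n 2 a′)))) n)
            (cong₂ _+_ (shiftˢ-* (+ γ) (F₁ 0) n)
              (trans (shiftˢ-cong (shiftˢ-* (+ (γ ∸ 1)) (F₁ 1)) n) (shiftˢ-* (+ (γ ∸ 1)) (shiftˢ (F₁ 1)) n))))))
      where
      x = + (a ℕ.+ b) + + (γ ℕ.+ 3)

      shiftˢ-cong : ∀ {f h} → (∀ k → f k ≡ h k) → ∀ n → shiftˢ f n ≡ shiftˢ h n
      shiftˢ-cong f≡h zero    = refl
      shiftˢ-cong f≡h (suc n) = f≡h n

      expand : ∀ a′ k → w (two a g b) (one a′) * F₁ a′ k ≡ x * F₁ a′ k + + suc a′ * F₁ a′ k - + (γ ∸ a′) * F₁ a′ k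
      expand a′ k = lemma (w (two a g b) (one a′)) (+ (γ ∸ a′)) x (+ suc a′) (F₁ a′ k)
        (cong +_ (trans (two-one a g b a′) (count a b γ a′)))
        where
        count : ∀ a b g a′ → suc (suc (a ℕ.+ g ℕ.+ 2 ℕ.+ b) ℕ.+ a′) ≡ a ℕ.+ b ℕ.+ (g ℕ.+ 3) ℕ.+ suc a′
        count = ℕ-Solver.solve-∀
        lemma : ∀ p q x y f → p + q ≡ x + y → p * f ≡ x * f + y * f - q * f
        lemma p q x y f eq = trans (step₁ p q f) (trans (cong (λ z → z * f - q * f) eq) (step₂ x y q f))
          where
          step₁ : ∀ p q f → p * f ≡ (p + q) * f - q * f
          step₁ = solve-∀
          step₂ : ∀ x y q f → (x + y) * f - q * f ≡ x * f + y * f - q * f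
          step₂ = solve-∀

    twos : ∀ h → S (λ a′ → S (λ b′ k → w (two a g b) (two a′ h b′) * F₂ a′ h b′ k)) n ≡
      (+ (a ℕ.+ b) + c h) * T h n - (correction U g a h n + correction L g b h n)
    twos h = begin
      S (λ a′ → S (λ b′ k → w (two a g b) (two a′ h b′) * F₂ a′ h b′ k)) n
        ≡⟨ S-cong (λ a′ k → trans (S-cong (λ b′ l → expand a′ b′ l) k)
             (trans (S-- _ _ k) (cong₂ _-_ (S-* x _ k) (S-+ _ _ k)))) n ⟩
      S (λ a′ k → x * S (λ b′ → F₂ a′ h b′) k -
        (S (λ b′ l → ηᵃ b′ * F₂ a′ h b′ l) k + S (λ b′ l → ηᵇ a′ * F₂ a′ h b′ l) k)) n
        ≡⟨ trans (S-- _ _ n) (cong₂ _-_ (S-* x _ n) (S-+ _ _ n)) ⟩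
      x * T h n - (S (λ a′ k → S (λ b′ l → ηᵃ b′ * F₂ a′ h b′ l) k) n +
                   S (λ a′ k → S (λ b′ l → ηᵇ a′ * F₂ a′ h b′ l) k) n)
        ≡⟨ cong (λ z → x * T h n - z) (cong₂ _+_ inner outer) ⟩
      x * T h n - (correction U g a h n + correction L g b h n) ∎
      where
      θ = toℕ h
      x = + (a ℕ.+ b) + c h
      ηᵃ ηᵇ : ℕ → ℤ
      ηᵃ k = + η a γ θ k
      ηᵇ k = + η b γ θ k

      -- Three or more cells are adjacent to at least four, more than a gap holds.
      vanish : ∀ x k → η x γ θ (2 ℕ.+ k) ≡ 0
      vanish x k = cong (λ z → z ℕ.⊓ (γ ℕ.+ x ∸ (2 ℕ.+ k ℕ.+ θ))) (ℕ.m≤n⇒m∸n≡0 (ℕ.≤-trans (g≤2 g) (ℕ.m≤m+n 2 k)))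

      shifts : ∀ p q (f₀ f₁ : PowerSeries) k →
        shiftˢ (λ l → p * f₀ l) k + shiftˢ (shiftˢ (λ l → q * f₁ l)) k ≡ p * shiftˢ f₀ k + (q * shiftˢ (shiftˢ f₁) k + 0ℤ)
      shifts p q f₀ f₁ k = cong₂ _+_ (shiftˢ-* p f₀ k) (trans (twice k) (sym (+-identityʳ _)))
        where
        twice : ∀ k → shiftˢ (shiftˢ (λ l → q * f₁ l)) k ≡ q * shiftˢ (shiftˢ f₁) k
        twice zero    = sym (*-zeroʳ q)
        twice (suc k) = shiftˢ-* q f₁ k

      inner : S (λ a′ k → S (λ b′ l → ηᵃ b′ * F₂ a′ h b′ l) k) n ≡ correction U g a h n
      inner = trans (S-cong (λ a′ k → trans
          (S-two (λ b′ l → cong (λ z → + z * F₂ a′ h (2 ℕ.+ b′) l) (vanish a b′)) k)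
          (trans (shifts (ηᵃ 0) (ηᵃ 1) (F₂ a′ h 0) (F₂ a′ h 1) k) (cong (λ z → ηᵃ 0 * shiftˢ (F₂ a′ h 0) k + z) (+-identityʳ _)))) n)
        (trans (S-+ (λ a′ k → ηᵃ 0 * shiftˢ (F₂ a′ h 0) k) (λ a′ k → ηᵃ 1 * shiftˢ (shiftˢ (F₂ a′ h 1)) k) n)
          (cong₂ _+_ (S-* (ηᵃ 0) _ n) (trans (S-* (ηᵃ 1) _ n) (sym (+-identityʳ _)))))

      outer : S (λ a′ k → S (λ b′ l → ηᵇ a′ * F₂ a′ h b′ l) k) n ≡ correction L g b h n
      outer = trans (S-cong (λ a′ k → S-* (ηᵇ a′) (λ b′ → F₂ a′ h b′) k) n)
        (trans (S-two (λ a′ l → cong (λ z → + z * S (λ b′ → F₂ (2 ℕ.+ a′) h b′) l) (vanish b a′)) n)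
          (shifts (ηᵇ 0) (ηᵇ 1) (S λ b′ → F₂ 0 h b′) (S λ b′ → F₂ 1 h b′) n))

      expand : ∀ a′ b′ l → w (two a g b) (two a′ h b′) * F₂ a′ h b′ l ≡
        x * F₂ a′ h b′ l - (ηᵃ b′ * F₂ a′ h b′ l + ηᵇ a′ * F₂ a′ h b′ l)
      expand a′ b′ l = lemma (w (two a g b) (two a′ h b′)) (ηᵃ b′) (ηᵇ a′) x (F₂ a′ h b′ l)
        (cong +_ (trans (two-two a g b a′ h b′ (g≤2 g)) count))
        where
        regroup : ∀ a b g → a ℕ.+ g ℕ.+ 2 ℕ.+ b ≡ a ℕ.+ b ℕ.+ (g ℕ.+ 2)
        regroup = ℕ-Solver.solve-∀
        count : a ℕ.+ γ ℕ.+ 2 ℕ.+ b ∸ θ ≡ a ℕ.+ b ℕ.+ (γ ℕ.+ 2 ∸ θ)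
        count = trans (cong (_∸ θ) (regroup a b γ))
          (ℕ.+-∸-assoc (a ℕ.+ b) (ℕ.≤-trans (g≤2 h) (ℕ.m≤n+m 2 γ)))
        lemma : ∀ p q r x f → p + (q + r) ≡ x → p * f ≡ x * f - (q * f + r * f)
        lemma p q r x f refl = step p q r f
          where
          step : ∀ p q r f → p * f ≡ (p + (q + r)) * f - (q * f + r * f)
          step = solve-∀

  φ-halves : ∀ g x n → ⟦ φ̂ g x ⟧ (base n) ≡ half U g x n + half L g x n
  φ-halves g x n = trans
    (cong (λ z → + 2 * (+ x * D n) - z) (trans (total-cong (allFin 3) λ h _ → split h)
      (total-+ (λ h → correction U g x h n) (λ h → correction L g x h n) (allFin 3))))
    (lemma (+ x * D n) _ _)
    where
    lemma : ∀ d u l → + 2 * d - (u + l) ≡ d - u + (d - l)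
    lemma = solve-∀
    split : ∀ h → Σ₂ (λ k → + η x (toℕ g) (toℕ h) (toℕ k) * Y h k n) ≡ correction U g x h n + correction L g x h n
    split h = trans (total-cong (allFin 2) λ k _ → *-distribˡ-+ (+ η x (toℕ g) (toℕ h) (toℕ k)) (U h k n) (L h k n))
      (total-+ (λ k → + η x (toℕ g) (toℕ h) (toℕ k) * U h k n) (λ k → + η x (toℕ g) (toℕ h) (toℕ k) * L h k n) (allFin 2))

  -- The series that close the system

  A₁ A₂ P Q f₁′ : PowerSeries
  A₁ = S (F₁ ∘ suc)
  A₂ = S λ a → F₁ (2 ℕ.+ a)
  P = constant-S D
  Q = constant-S P
  f₁′ = shiftˢ (F₁ 1)

  C : Fin 3 → PowerSeries
  C g n = ⟦ Ĉ g ⟧ (base n)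

  φ : Fin 3 → ℕ → PowerSeries
  φ g x n = ⟦ φ̂ g x ⟧ (base n)

  K Φ Φ′ Φ″ Z : Fin 3 → PowerSeries
  K g = constant-S (C g)
  Φ g = S (φ g)
  Φ′ g = S (φ g ∘ suc)
  Φ″ g = S λ x → φ g (2 ℕ.+ x)

  -- `W g k` collects the columns with a component of `k + 1` cells in either position, leaving out
  -- the weight of that component, which `Y-shift` restores. Joining both positions makes `φ` appear
  -- instead of its halves.
  V W : Fin 3 → ℕ → PowerSeries
  V g k = constant-S (φ g k)
  W g k = S λ x n → F₂ x g k n + F₂ k g x n
  Z g = shiftˢ (W g 1)

  -- By `F-two` every term involves at most one height; summing over the other gives a factor
  -- `q / (1 - q)`, and the two halves merge into `φ`.
  T-expansion : ∀ g n → T g n ≡ constant-S (λ k → K g k + Φ g k) n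
  T-expansion g n = begin
    T g n
      ≡⟨ S-cong (λ a k → S-cong (λ b l → F-two a g b l) k) n ⟩
    S (λ a → S (λ b k → C g k + (half U g a k + half L g b k))) n
      ≡⟨ S-cong (λ a k → trans (S-+ (λ _ → C g) (λ b l → half U g a l + half L g b l) k)
           (cong (λ z → K g k + z) (S-+ (λ _ → half U g a) (half L g) k))) n ⟩
    S (λ a k → K g k + (constant-S (half U g a) k + S (half L g) k)) n
      ≡⟨ trans (S-+ (λ _ → K g) (λ a k → constant-S (half U g a) k + S (half L g) k) n)
           (cong (λ z → constant-S (K g) n + z) (S-+ (λ a → constant-S (half U g a)) (λ _ → S (half L g)) n)) ⟩
    constant-S (K g) n + (S (λ a → constant-S (half U g a)) n + constant-S (S (half L g)) n)
      ≡⟨ cong (λ z → constant-S (K g) n + (z + constant-S (S (half L g)) n)) (S-constant (half U g) n) ⟩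
    constant-S (K g) n + (constant-S (S (half U g)) n + constant-S (S (half L g)) n)
      ≡⟨ trans (S-+ (λ _ → K g) (λ _ → Φ g) n) (cong (λ z → constant-S (K g) n + z)
           (trans (S-cong (λ _ k → trans (S-cong {φ g} (φ-halves g) k) (S-+ (half U g) (half L g) k)) n)
             (S-+ (λ _ → S (half U g)) (λ _ → S (half L g)) n))) ⟨
    constant-S (λ k → K g k + Φ g k) n ∎
    where
    open ≡-Reasoning

  W-expansion : ∀ g k n → W g k n ≡ + 2 * K g n + V g k n + Φ g n
  W-expansion g k n = begin
    W g k n
      ≡⟨ S-cong (λ x l → trans (cong₂ _+_ (F-two x g k l) (F-two k g x l))
           (trans (lemma (C g l) (half U g x l) (half L g k l) (half U g k l) (half L g x l))
             (sym (cong₂ (λ y z → + 2 * C g l + y + z) (φ-halves g k l) (φ-halves g x l))))) n ⟩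
    S (λ x l → + 2 * C g l + φ g k l + φ g x l) n
      ≡⟨ trans (S-+ (λ _ l → + 2 * C g l + φ g k l) (φ g) n) (cong (λ z → z + Φ g n)
           (trans (S-+ (λ _ l → + 2 * C g l) (λ _ → φ g k) n) (cong (λ z → z + V g k n) (S-* (+ 2) (λ _ → C g) n)))) ⟩
    + 2 * K g n + V g k n + Φ g n ∎
    where
    open ≡-Reasoning
    lemma : ∀ c ux lk uk lx → c + (ux + lk) + (c + (uk + lx)) ≡ + 2 * c + (uk + lk) + (ux + lx)
    lemma = solve-∀

  Y-shift : ∀ g n → Y g 0F n ≡ shiftˢ (W g 0) n × Y g 1F n ≡ shiftˢ (Z g) n
  Y-shift g n =
    trans (cong (λ z → z + L g 0F n) (S-shift (λ a → F₂ a g 0) n)) (shifted n) ,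
    trans (cong (λ z → z + L g 1F n) (S-shift (λ a → shiftˢ (F₂ a g 1)) n)) (shifted² n)
    where
    shifted : ∀ n → shiftˢ (S λ a → F₂ a g 0) n + L g 0F n ≡ shiftˢ (W g 0) n
    shifted zero    = refl
    shifted (suc n) = sym (S-+ (λ a → F₂ a g 0) (λ b → F₂ 0 g b) n)
    shifted² : ∀ n → shiftˢ (S λ a → shiftˢ (F₂ a g 1)) n + L g 1F n ≡ shiftˢ (Z g) n
    shifted² zero          = refl
    shifted² (suc zero)    = refl
    shifted² (suc (suc n)) = trans
      (cong (λ z → z + S (λ b → F₂ 1 g b) n) (S-shift (λ a → F₂ a g 1) (suc n)))
      (sym (S-+ (λ a → F₂ a g 1) (λ b → F₂ 1 g b) n))

  -- Right gaps satisfy `h ≤ 2`, so by `η-large` the corrections are constant from `x = 2` on. This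
  -- is why the sums starting at 0, 1 and 2 are kept apart as `Φ`, `Φ′` and `Φ″`.
  φ-step : ∀ g x n → φ g (3 ℕ.+ x) n ≡ φ g (2 ℕ.+ x) n + + 2 * D n
  φ-step g x n = trans (cong (λ z → + 2 * (+ (3 ℕ.+ x) * D n) - z)
      (total-cong (allFin 3) λ h _ → total-cong (allFin 2) λ k _ → cong (λ z → + z * Y h k n)
        (trans (η-large (3 ℕ.+ x) (toℕ g) (toℕ h) (toℕ k) (ℕ.≤-trans (g≤2 h) (ℕ.m≤m+n 2 (suc x))))
          (sym (η-large (2 ℕ.+ x) (toℕ g) (toℕ h) (toℕ k) (ℕ.≤-trans (g≤2 h) (ℕ.m≤m+n 2 x)))))))
    (lemma (+ (2 ℕ.+ x)) (D n) _)
    where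
    lemma : ∀ x d y → + 2 * ((1ℤ + x) * d) - y ≡ + 2 * (x * d) - y + + 2 * d
    lemma = solve-∀

  Φ″-step : ∀ g n → Φ″ g (suc n) ≡ φ g 2 n + (Φ″ g n + + 2 * P n)
  Φ″-step g n = cong (λ z → φ g 2 n + z) (trans (S-cong {λ x → φ g (3 ℕ.+ x)} (φ-step g) n)
    (trans (S-+ (λ x → φ g (2 ℕ.+ x)) (λ _ k → + 2 * D k) n) (cong (λ z → Φ″ g n + z) (S-* (+ 2) (λ _ → D) n))))

  -- From three cells on, no difference in `F̂₁` is truncated, which leaves an affine function of
  -- the height.
  F₁-linear : ∀ a n → F₁ (2 ℕ.+ a) n ≡ C 0F n + + a * D n
  F₁-linear a n = trans (F-one (2 ℕ.+ a) n)
    (trans (cong (λ z → δ n + (+ (3 ℕ.+ a) * A n + B n + z))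
      (trans (total-cong (allFin 3) λ h _ → trans (cong (λ z → + z * T h n) (count h))
          (*-distribʳ-+ (T h n) (+ a) (+ (2 ∸ toℕ h))))
        (trans (total-+ (λ h → + a * T h n) (λ h → + (2 ∸ toℕ h) * T h n) (allFin 3))
          (cong (λ z → z + Σ₃ λ h → + (2 ∸ toℕ h) * T h n) (total-* (+ a) (λ h → T h n) (allFin 3))))))
      (lemma (δ n) (+ a) (A n) (B n) (Σ₃ λ h → T h n) (Σ₃ λ h → + (2 ∸ toℕ h) * T h n)))
    where
    count : ∀ h → 2 ℕ.+ a ∸ toℕ h ≡ a ℕ.+ (2 ∸ toℕ h)
    count h = trans (cong (_∸ toℕ h) (ℕ.+-comm 2 a)) (ℕ.+-∸-assoc a (g≤2 h))
    lemma : ∀ d a A B T cT → d + ((+ 3 + a) * A + B + (a * T + cT)) ≡ d + (+ 3 * A + B - 0ℤ + cT) + a * (A + T)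
    lemma = solve-∀

  -- Every component is adjacent to at least two consecutive cells on its left, so a one-cell gap
  -- loses nothing and may be filled.
  F₂-gap₀ : ∀ a b n → F₂ a 0F b n ≡ F₁ (2 ℕ.+ (a ℕ.+ b)) n
  F₂-gap₀ a b n = trans (F-two a 0F b n) (trans (lemma (C 0F n) (+ a) (+ b) (D n)) (sym (F₁-linear (a ℕ.+ b) n)))
    where
    lemma : ∀ c a b d → c + (a * d - 0ℤ + (b * d - 0ℤ)) ≡ c + (a + b) * d
    lemma = solve-∀

  S-index : ∀ X n → S (λ a k → + a * X k) n ≡ constant-S (constant-S X) n
  S-index X n = S-diagonal (λ _ → X) n

  A₂-expansion : ∀ n → A₂ n ≡ K 0F n + Q n
  A₂-expansion n = trans (S-cong {λ a → F₁ (2 ℕ.+ a)} F₁-linear n) (trans (S-+ (λ _ → C 0F) (λ a k → + a * D k) n)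
    (cong (λ z → K 0F n + z) (S-index D n)))

  φ-gap₀ : ∀ x n → φ 0F x n ≡ + 2 * (+ x * D n)
  φ-gap₀ x n = +-identityʳ _

  Φ-gap₀ : ∀ n → Φ 0F n ≡ + 2 * Q n
  Φ-gap₀ n = trans (S-cong {φ 0F} φ-gap₀ n) (trans (S-* (+ 2) (λ x k → + x * D k) n) (cong (λ z → + 2 * z) (S-index D n)))

  W-gap₀ : ∀ k n → W 0F k n ≡ + 2 * A₂ n + + 2 * (+ k * P n)
  W-gap₀ k n = trans (W-expansion 0F k n)
    (trans (cong₂ (λ y z → + 2 * K 0F n + y + z)
        (trans (S-cong (λ _ → φ-gap₀ k) n) (trans (S-* (+ 2) (λ _ l → + k * D l) n) (cong (λ z → + 2 * z) (S-* (+ k) (λ _ → D) n))))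
        (Φ-gap₀ n))
      (trans (lemma (K 0F n) (Q n) (+ 2 * (+ k * P n))) (cong (λ z → + 2 * z + + 2 * (+ k * P n)) (sym (A₂-expansion n)))))
    where
    lemma : ∀ k q p → + 2 * k + p + + 2 * q ≡ + 2 * (k + q) + p
    lemma = solve-∀

  T₀-step : ∀ n → T 0F (suc n) ≡ A₂ n + Q n + T 0F n
  T₀-step n = trans (T-expansion 0F (suc n)) (cong₂ _+_
    (trans (cong (λ z → K 0F n + z) (Φ-gap₀ n)) (trans (lemma (K 0F n) (Q n)) (cong (λ z → z + Q n) (sym (A₂-expansion n)))))
    (sym (T-expansion 0F n)))
    where
    lemma : ∀ k q → k + + 2 * q ≡ k + q + q
    lemma = solve-∀

  -- A weight `a` counts the ways of cutting a solid column into two parts around one cell; by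
  -- `F₂-gap₀` the weighted sum is the series of the columns with a one-cell gap, so it stays within
  -- the system.
  B-step : ∀ n → B (suc n) ≡ F₁ 0 n + (+ 2 * A₁ n + T 0F n)
  B-step n = cong₂ _+_ (*-identityˡ (F₁ 0 n)) (trans
    (S-cong (λ a k → lemma (+ a) (F₁ (suc a) k)) n)
    (trans (S-+ (λ a k → + 2 * F₁ (suc a) k) (λ a k → + a * F₁ (suc a) k) n)
      (cong₂ _+_ (S-* (+ 2) (F₁ ∘ suc) n) (trans (S-diagonal (F₁ ∘ suc) n)
        (S-cong (λ a k → S-cong (λ b l → sym (F₂-gap₀ a b l)) k) n)))))
    where
    lemma : ∀ a x → (+ 2 + a) * x ≡ + 2 * x + a * x
    lemma = solve-∀

  -- The linear recurrence

  -- For one-cell gaps, `K`, `Φ` and `V` are expressed through `A₂`, `P` and `Q`, so they have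
  -- entries for the two larger gaps only.
  state : ℕ → Vec ℤ 34
  state n = base n Vec.++
    ( A₁ n ∷ A₂ n ∷ P n ∷ Q n ∷ f₁′ n ∷ Z 0F n ∷ Z 1F n ∷ Z 2F n ∷ K 1F n ∷ K 2F n ∷ Φ 1F n ∷ Φ 2F n ∷
      Φ′ 1F n ∷ Φ′ 2F n ∷ Φ″ 1F n ∷ Φ″ 2F n ∷ V 1F 0 n ∷ V 1F 1 n ∷ V 2F 0 n ∷ V 2F 1 n ∷ [])

  embed : ∀ {m} n → Lin m → Lin (m ℕ.+ n)
  embed n (var i) = var (i ↑ˡ n)
  embed n (con c) = con c
  embed n (l ⊕ r) = embed n l ⊕ embed n r
  embed n (l ⊖ r) = embed n l ⊖ embed n r
  embed n (c ⊙ l) = c ⊙ embed n l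

  private
    e : Lin 14 → Lin 34
    e = embed 20

    rest : Fin 20 → Lin 34
    rest i = var (14 ↑ʳ i)

    A₁̂ A₂̂ P̂ Q̂ f₁′̂ : Lin 34
    A₁̂ = rest 0F
    A₂̂ = rest 1F
    P̂ = rest 2F
    Q̂ = rest 3F
    f₁′̂ = rest 4F

    Ẑ : Fin 3 → Lin 34
    Ẑ g = rest (5 ↑ʳ (g ↑ˡ 12))

    K̂ Φ̂ Φ̂′ Φ̂″ : Fin 2 → Lin 34
    K̂ g = rest (8 ↑ʳ (g ↑ˡ 10))
    Φ̂ g = rest (10 ↑ʳ (g ↑ˡ 8))
    Φ̂′ g = rest (12 ↑ʳ (g ↑ˡ 6))
    Φ̂″ g = rest (14 ↑ʳ (g ↑ˡ 4))

    V̂ : Fin 2 → Fin 2 → Lin 34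
    V̂ g k = rest (16 ↑ʳ combine g k)

    Ŵ : Fin 2 → Fin 2 → Lin 34
    Ŵ g k = + 2 ⊙ K̂ g ⊕ V̂ g k ⊕ Φ̂ g

  -- The rows are shaped to unfold to the right sides of the step lemmas, hence the factors `0ℤ`.
  -- They have no constant terms, so their coefficients form the matrix.
  equations : Vec (Lin 34) 34
  equations =
    0ℤ ⊙ e δ̂ ∷
    e (F̂₁ 0) ⊕ A₁̂ ∷
    e (F̂₁ 0) ⊕ (+ 2 ⊙ A₁̂ ⊕ e (T̂ 0F)) ∷
    e (F̂₁ 0) ∷
    f₁′̂ ∷
    A₂̂ ⊕ Q̂ ⊕ e (T̂ 0F) ∷
    K̂ 0F ⊕ Φ̂ 0F ⊕ e (T̂ 1F) ∷
    K̂ 1F ⊕ Φ̂ 1F ⊕ e (T̂ 2F) ∷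
    + 2 ⊙ A₂̂ ⊕ + 2 ⊙ (0ℤ ⊙ P̂) ∷
    Ẑ 0F ∷
    Ŵ 0F 0F ∷
    Ẑ 1F ∷
    Ŵ 1F 0F ∷
    Ẑ 2F ∷
    e (F̂₁ 1) ⊕ A₂̂ ∷
    e (Ĉ 0F) ⊕ (P̂ ⊕ A₂̂) ∷
    e D̂ ⊕ P̂ ∷
    P̂ ⊕ Q̂ ∷
    e (F̂₁ 1) ∷
    + 2 ⊙ A₂̂ ⊕ + 2 ⊙ (1ℤ ⊙ P̂) ∷
    Ŵ 0F 1F ∷
    Ŵ 1F 1F ∷
    e (Ĉ 1F) ⊕ K̂ 0F ∷
    e (Ĉ 2F) ⊕ K̂ 1F ∷
    e (φ̂ 1F 0) ⊕ Φ̂′ 0F ∷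
    e (φ̂ 2F 0) ⊕ Φ̂′ 1F ∷
    e (φ̂ 1F 1) ⊕ Φ̂″ 0F ∷
    e (φ̂ 2F 1) ⊕ Φ̂″ 1F ∷
    e (φ̂ 1F 2) ⊕ (Φ̂″ 0F ⊕ + 2 ⊙ P̂) ∷
    e (φ̂ 2F 2) ⊕ (Φ̂″ 1F ⊕ + 2 ⊙ P̂) ∷
    e (φ̂ 1F 0) ⊕ V̂ 0F 0F ∷
    e (φ̂ 1F 1) ⊕ V̂ 0F 1F ∷
    e (φ̂ 2F 0) ⊕ V̂ 1F 0F ∷
    e (φ̂ 2F 1) ⊕ V̂ 1F 1F ∷ []

  state-step : ∀ n → state (suc n) ≡ Vec.map (λ l → ⟦ l ⟧ (state n)) equations
  state-step n =
    refl ∷≡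
    cong (λ z → z + A₁ n) (F-one 0 n) ∷≡
    trans (B-step n) (cong (λ z → z + (+ 2 * A₁ n + T 0F n)) (F-one 0 n)) ∷≡
    F-one 0 n ∷≡
    refl ∷≡
    T₀-step n ∷≡
    T-step 1F ∷≡
    T-step 2F ∷≡
    trans (proj₁ (Y-shift 0F (suc n))) (W-gap₀ 0 n) ∷≡
    proj₂ (Y-shift 0F (suc n)) ∷≡
    trans (proj₁ (Y-shift 1F (suc n))) (W-expansion 1F 0 n) ∷≡
    proj₂ (Y-shift 1F (suc n)) ∷≡
    trans (proj₁ (Y-shift 2F (suc n))) (W-expansion 2F 0 n) ∷≡
    proj₂ (Y-shift 2F (suc n)) ∷≡
    cong (λ z → z + A₂ n) (F-one 1 n) ∷≡
    A₂-step ∷≡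
    refl ∷≡
    refl ∷≡
    F-one 1 n ∷≡
    W-gap₀ 1 n ∷≡
    W-expansion 1F 1 n ∷≡
    W-expansion 2F 1 n ∷≡
    refl ∷≡
    refl ∷≡
    refl ∷≡
    refl ∷≡
    refl ∷≡
    refl ∷≡
    Φ″-step 1F n ∷≡
    Φ″-step 2F n ∷≡
    refl ∷≡
    refl ∷≡
    refl ∷≡
    refl ∷≡
    refl
    where
    infixr 5 _∷≡_
    _∷≡_ : ∀ {k} {x y : ℤ} {xs ys : Vec ℤ k} → x ≡ y → xs ≡ ys → x ∷ xs ≡ y ∷ ys
    _∷≡_ = cong₂ _∷_

    T-step : ∀ g → T g (suc n) ≡ K g n + Φ g n + T g n
    T-step g = trans (T-expansion g (suc n)) (cong (λ z → K g n + Φ g n + z) (sym (T-expansion g n)))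

    A₂-step : A₂ (suc n) ≡ C 0F n + (P n + A₂ n)
    A₂-step = trans (A₂-expansion (suc n))
      (trans (lemma (C 0F n) (K 0F n) (P n) (Q n)) (cong (λ z → C 0F n + (P n + z)) (sym (A₂-expansion n))))
      where
      lemma : ∀ c k p q → c + k + (p + q) ≡ c + (p + (k + q))
      lemma = solve-∀

  infixl 9 _·_

  _·_ : ∀ {k n} → Vec ℤ k → Vec (Vec ℤ n) k → Vec ℤ n
  []      · []       = 0̂
  (x ∷ u) · (r ∷ rs) = Vec.zipWith _+_ (Vec.map (x *_) r) (u · rs)

  ·-∙ : ∀ {k n} (u : Vec ℤ k) (rs : Vec (Vec ℤ n) k) ρ → u · rs ∙ ρ ≡ u ∙ Vec.map (_∙ ρ) rs
  ·-∙ []      []       ρ = ∙-zeroˡ ρ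
  ·-∙ (x ∷ u) (r ∷ rs) ρ = trans (∙-+ (Vec.map (x *_) r) (u · rs) ρ) (cong₂ _+_ (∙-* x r ρ) (·-∙ u rs ρ))

  map-zero : ∀ {n} (r : Vec ℤ n) → Vec.map (0ℤ *_) r ≡ 0̂
  map-zero []      = refl
  map-zero (x ∷ r) = cong₂ _∷_ (*-zeroˡ x) (map-zero r)

  zip-zero : ∀ {n} → Vec.zipWith _+_ (0̂ {n}) 0̂ ≡ 0̂
  zip-zero {zero}  = refl
  zip-zero {suc n} = cong (0ℤ ∷_) zip-zero

  ·-zeroˡ : ∀ {k n} (rs : Vec (Vec ℤ n) k) → 0̂ · rs ≡ 0̂
  ·-zeroˡ []       = refl
  ·-zeroˡ (r ∷ rs) = trans (cong₂ (Vec.zipWith _+_) (map-zero r) (·-zeroˡ rs)) zip-zero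

  -- A product with a linear recurrent sequence, by Horner's rule

  module _ {d} (matrix : Vec (Vec ℤ d) d) (ρ : ℕ → Vec ℤ d) (step : ∀ n → ρ (suc n) ≡ Vec.map (_∙ ρ n) matrix)
    (p : PowerSeries) (v : Vec ℤ d) where

    horner : ℕ → Vec ℤ d
    horner zero    = Vec.map (p 0 *_) v
    horner (suc n) = Vec.zipWith _+_ (horner n · matrix) (Vec.map (p (suc n) *_) v)

    -- A row vector times the matrix, evaluated at `ρ m`, is the row vector evaluated at
    -- `ρ (suc m)`; the general `m` lets the induction absorb this shift.
    horner-∙ : ∀ n m → horner n ∙ ρ m ≡ total (λ k → p k * (v ∙ ρ (n ∸ k ℕ.+ m))) (upTo (suc n))
    horner-∙ zero    m = trans (∙-* (p 0) v (ρ m)) (sym (+-identityʳ _))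
    horner-∙ (suc n) m = begin
      horner (suc n) ∙ ρ m
        ≡⟨ ∙-+ (horner n · matrix) (Vec.map (p (suc n) *_) v) (ρ m) ⟩
      horner n · matrix ∙ ρ m + Vec.map (p (suc n) *_) v ∙ ρ m
        ≡⟨ cong₂ _+_ (·-∙ (horner n) matrix (ρ m)) (∙-* (p (suc n)) v (ρ m)) ⟩
      horner n ∙ Vec.map (_∙ ρ m) matrix + p (suc n) * (v ∙ ρ m)
        ≡⟨ cong (λ σ → horner n ∙ σ + p (suc n) * (v ∙ ρ m)) (step m) ⟨
      horner n ∙ ρ (suc m) + p (suc n) * (v ∙ ρ m)
        ≡⟨ cong (λ z → z + p (suc n) * (v ∙ ρ m)) (horner-∙ n (suc m)) ⟩
      total (λ k → p k * (v ∙ ρ (n ∸ k ℕ.+ suc m))) (upTo (suc n)) + p (suc n) * (v ∙ ρ m)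
        ≡⟨ cong₂ _+_ (total-cong (upTo (suc n)) λ k k∈ → cong (λ i → p k * (v ∙ ρ i)) (reindex k (ℕ.s≤s⁻¹ (∈-upTo⁻ k∈))))
             (sym (trans (+-identityʳ _) (cong (λ i → p (suc n) * (v ∙ ρ (i ℕ.+ m))) (ℕ.n∸n≡0 n)))) ⟩
      total h (upTo (suc n)) + total h (suc n ∷ [])
        ≡⟨ total-++ h (upTo (suc n)) (suc n ∷ []) ⟨
      total h (upTo (suc n) ∷ʳ suc n)
        ≡⟨ cong (total h) (upTo-∷ʳ (suc n)) ⟩
      total h (upTo (suc (suc n))) ∎
      where
      open ≡-Reasoning
      h : ℕ → ℤ
      h k = p k * (v ∙ ρ (suc n ∸ k ℕ.+ m))
      reindex : ∀ k → k ≤ n → n ∸ k ℕ.+ suc m ≡ suc n ∸ k ℕ.+ m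
      reindex k k≤n = trans (ℕ.+-suc (n ∸ k) m) (cong (ℕ._+ m) (sym (ℕ.+-∸-assoc 1 k≤n)))

    ⊛-horner : ∀ n → (p ⊛ λ k → v ∙ ρ k) n ≡ horner n ∙ ρ 0
    ⊛-horner n = trans (foldr-total (λ k → p k * (v ∙ ρ (n ∸ k))) (upTo (suc n)))
      (trans (total-cong (upTo (suc n)) λ k _ → cong (λ i → p k * (v ∙ ρ i)) (sym (ℕ.+-identityʳ (n ∸ k))))
        (sym (horner-∙ n 0)))
      where
      foldr-total : ∀ h (ks : List ℕ) → foldr _+_ 0ℤ (List.map h ks) ≡ total h ks
      foldr-total h []       = refl
      foldr-total h (k ∷ ks) = cong (λ z → h k + z) (foldr-total h ks)

    -- Threads the Horner vector u of index n through the comparison, so that each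
    -- of these vectors is computed only once.
    agrees : PowerSeries → ℕ → ℕ → Vec ℤ d → Bool
    agrees g zero    n u = ⌊ Vec.≡-dec ℤ._≟_ u 0̂ ⌋
    agrees g (suc l) n u = ⌊ u ∙ ρ 0 ℤ.≟ g n ⌋ ∧
      agrees g l (suc n) (Vec.zipWith _+_ (u · matrix) (Vec.map (p (suc n) *_) v))

    agrees-sound : ∀ g l n → IsTrue (agrees g l n (horner n)) →
      (∀ i → i < l → horner (n ℕ.+ i) ∙ ρ 0 ≡ g (n ℕ.+ i)) × horner (n ℕ.+ l) ≡ 0̂
    agrees-sound g zero    n ok = (λ _ ()) , trans (cong horner (ℕ.+-identityʳ n)) (toWitness ok)
    agrees-sound g (suc l) n ok with Equivalence.to T-∧ ok
    ... | now , later with agrees-sound g l (suc n) later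
    ... | coeffs , end = coeffs′ , trans (cong horner (ℕ.+-suc n l)) end
      where
      coeffs′ : ∀ i → i < suc l → horner (n ℕ.+ i) ∙ ρ 0 ≡ g (n ℕ.+ i)
      coeffs′ zero    _         = subst (λ k → horner k ∙ ρ 0 ≡ g k) (sym (ℕ.+-identityʳ n)) (toWitness now)
      coeffs′ (suc i) (s≤s i<l) = subst (λ k → horner k ∙ ρ 0 ≡ g k) (sym (ℕ.+-suc n i)) (coeffs i i<l)

    -- Once the coefficients of `p` have run out, a step is just multiplication by the matrix, which
    -- keeps zero at zero.
    horner-zero : ∀ l → (∀ i → p (suc (l ℕ.+ i)) ≡ 0ℤ) → horner l ≡ 0̂ → ∀ i → horner (l ℕ.+ i) ≡ 0̂
    horner-zero l p≡0 eq zero    = trans (cong horner (ℕ.+-identityʳ l)) eq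
    horner-zero l p≡0 eq (suc i) = trans (cong horner (ℕ.+-suc l i))
      (trans (cong₂ (Vec.zipWith _+_)
        (trans (cong (_· matrix) (horner-zero l p≡0 eq i)) (·-zeroˡ matrix))
        (trans (cong (λ c → Vec.map (c *_) v) (p≡0 i)) (map-zero v)))
      zip-zero)

    ⊛-recurrent : ∀ g l → IsTrue (agrees g l 0 (horner 0)) →
      (∀ i → p (suc (l ℕ.+ i)) ≡ 0ℤ) → (∀ i → g (l ℕ.+ i) ≡ 0ℤ) → ∀ n → (p ⊛ λ k → v ∙ ρ k) n ≡ g n
    ⊛-recurrent g l ok p≡0 g≡0 n = trans (⊛-horner n) (go (n ℕ.<? l))
      where
      sound = agrees-sound g l 0 ok
      go : Dec (n < l) → horner n ∙ ρ 0 ≡ g n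
      go (yes n<l) = proj₁ sound n n<l
      go (no n≮l) with ℕ.m≤n⇒∃[o]m+o≡n (ℕ.≮⇒≥ n≮l)
      ... | i , refl = trans (cong (_∙ ρ 0) (horner-zero l p≡0 (proj₂ sound) i)) (trans (∙-zeroˡ (ρ 0)) (sym (g≡0 i)))

  matrix : Vec (Vec ℤ 34) 34
  matrix = Vec.map coefficients equations

  homogeneous : ∀ {k n} (ls : Vec (Lin n) k) ρ → Vec.map constant ls ≡ 0̂ →
    Vec.map (λ l → ⟦ l ⟧ ρ) ls ≡ Vec.map (_∙ ρ) (Vec.map coefficients ls)
  homogeneous []       ρ _  = refl
  homogeneous (l ∷ ls) ρ eq = cong₂ _∷_
    (trans (⟦⟧-normal l ρ) (trans (cong (_+ coefficients l ∙ ρ) (Vec.∷-injectiveˡ eq)) (+-identityˡ _)))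
    (homogeneous ls ρ (Vec.∷-injectiveʳ eq))

  state-matrix : ∀ n → state (suc n) ≡ Vec.map (_∙ state n) matrix
  state-matrix n = trans (state-step n) (homogeneous equations (state n) refl)

  target : Vec ℤ 34
  target = unit 1F

  A-quotient : A ≐ M / N
  -- 28 is the degree of `N`, and `M` has degree 27, so the indices below 28 cover all of `M`; the
  -- underscore is the evaluated check.
  A-quotient = refl , λ n → trans (⊛-cong n) (⊛-recurrent matrix state state-matrix N target M 28 _ (λ _ → refl) (λ _ → refl) n)
    where
    ⊛-cong : ∀ n → (N ⊛ A) n ≡ (N ⊛ λ k → target ∙ state k) n
    ⊛-cong n = cong (foldr _+_ 0ℤ) (map-cong (λ k → cong (N k *_) (sym (∙-unit 1F (state (n ∸ k))))) (upTo (suc n)))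

  -- A code is the height of a solid first column followed by one of its continuations, which is how
  -- `A` sums the series `F₁`.
  A-cheesy : IsCheesyGF 3 A
  A-cheesy n = length (codes n) , cheesy-bijection (codes n) (unique-codes n) (∈-codes n) ,
    sym (trans (length-weighted (λ a k → List.map (a ,_) (tails k (one a) k)) n)
      (S-cong (λ a k → cong +_ (length-map {B = Code 3} (a ,_) (tails k (one a) k))) n))

open GeneratingFunction

proposition4 : ∃[ L ] IsCheesyGF 3 L × L ≐ M / N
proposition4 = A , A-cheesy , A-quotient
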